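{- Let $D$ be a degree-$5$ oriented multigraph with $n$ vertices. Then $\mathrm{fas}(D)\le \frac{24n}{29}$.
   Context: All digraphs are finite. An oriented multigraph is a directed multigraph (parallel arcs allowed) without loops and without directed cycles of length 2; arcs are counted with multiplicity. The degree of a vertex is the number of arcs incident with it (the sum of its out-degree and in-degree, counted with multiplicity). $D$ is degree-$k$ if every vertex of $D$ has degree exactly $k$. A set $F$ of arcs of $D$ is a feedback arc set if $D-F$ has no directed cycle; $\mathrm{fas}(D)$ is the minimum number of arcs in a feedback arc set of $D$. -}

module Defs where

open import Data.Fin using (Fin; zero; toℕ; finToFun; funToFin)
open import Data.Fin.Properties
  using (_≟_; any?; all?; injective⇒≤; finToFun-funToFin)
open import Data.Fin.Subset using (Subset; _∉_; ⊤; ∣_∣)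
open import Data.Fin.Subset.Properties using (∈⊤; _∈?_; anySubset?)
open import Data.List using (allFin; filter; length)
open import Data.Nat using (ℕ; suc; _+_; _<_; _≤_; _<?_)
open import Data.Nat.DivMod using (_mod_)
open import Data.Nat.Induction using (<-wellFounded)
open import Data.Nat.Properties using (anyUpTo?; ≮⇒≥)
open import Data.Product using (Σ; ∃; _×_; _,_; proj₁; proj₂)
open import Function using (_∘_)
open import Function.Definitions using (Injective)
open import Induction.WellFounded using (Acc; acc)
open import Relation.Binary.PropositionalEquality
  using (_≡_; _≢_; sym; trans; cong; subst)
open import Relation.Nullary
  using (Dec; yes; no; ¬_; ¬?; map′; _×-dec_; _→-dec_)

record MultiDigraph (V A : Set) : Set where
  field
    src tgt : A → V

open MultiDigraph public

-- Cyclic successor: i ↦ i + 1 modulo suc k.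
next : ∀ {k} → Fin (suc k) → Fin (suc k)
next {k} i = suc (toℕ i) mod suc k

-- Cycles are simple: no vertex is repeated.  They have at least one arc,
-- and a loop is a cycle of length 1.
record DirectedCycle {V A : Set} (D : MultiDigraph V A) : Set where
  field
    pred-length : ℕ
    arc         : Fin (suc pred-length) → A
    consecutive : ∀ i → tgt D (arc i) ≡ src D (arc (next i))
    distinct    : Injective _≡_ _≡_ (src D ∘ arc)

  cycleLength : ℕ
  cycleLength = suc pred-length

open DirectedCycle public

record IsOriented {V A : Set} (D : MultiDigraph V A) : Set where
  field
    loopless   : ∀ a → src D a ≢ tgt D a
    no-2-cycle : ∀ (C : DirectedCycle D) → cycleLength C ≢ 2

module _ {n m : ℕ} (D : MultiDigraph (Fin n) (Fin m)) where

  outDegree inDegree degree : Fin n → ℕ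
  outDegree v = length (filter (λ a → src D a ≟ v) (allFin m))
  inDegree  v = length (filter (λ a → tgt D a ≟ v) (allFin m))
  degree    v = outDegree v + inDegree v

  IsDegree : ℕ → Set
  IsDegree k = ∀ v → degree v ≡ k

  deleteArcs : (F : Subset m) → MultiDigraph (Fin n) (Σ (Fin m) (_∉ F))
  deleteArcs F .src = src D ∘ proj₁
  deleteArcs F .tgt = tgt D ∘ proj₁

  IsFeedbackArcSet : Subset m → Set
  IsFeedbackArcSet F = ¬ DirectedCycle (deleteArcs F)

  IsMinimumFeedbackArcSet : Subset m → Set
  IsMinimumFeedbackArcSet F =
    IsFeedbackArcSet F × (∀ G → IsFeedbackArcSet G → ∣ F ∣ ≤ ∣ G ∣)

  -- Being a feedback arc set is decidable: a cycle has at most n arcs, so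
  -- there are finitely many candidates.
  private
    CycleArcs : Subset m → ∀ k → (Fin (suc k) → Fin m) → Set
    CycleArcs F k f =
        (∀ i → f i ∉ F)
      × (∀ i → tgt D (f i) ≡ src D (f (next i)))
      × (∀ i j → src D (f i) ≡ src D (f j) → i ≡ j)

    cycleArcs? : ∀ F k f → Dec (CycleArcs F k f)
    cycleArcs? F k f =
        all? (λ i → ¬? (f i ∈? F))
      ×-dec all? (λ i → tgt D (f i) ≟ src D (f (next i)))
      ×-dec all? (λ i → all? λ j → (src D (f i) ≟ src D (f j)) →-dec (i ≟ j))

    cycleArcs-resp : ∀ F k {f g} → (∀ i → f i ≡ g i) →
                     CycleArcs F k f → CycleArcs F k g
    cycleArcs-resp F k eq (av , co , di) =
        (λ i → subst (_∉ F) (eq i) (av i))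
      , (λ i → trans (cong (tgt D) (sym (eq i)))
                 (trans (co i) (cong (src D) (eq (next i)))))
      , (λ i j e → di i j (trans (cong (src D) (eq i))
                             (trans e (cong (src D) (sym (eq j))))))

    CodedCycle : Subset m → ℕ → Set
    CodedCycle F k = ∃ λ c → CycleArcs F k (finToFun c)

    decode : ∀ {F} → (∃ λ k → k < n × CodedCycle F k) →
             DirectedCycle (deleteArcs F)
    decode (k , _ , c , av , co , di) = record
      { pred-length = k
      ; arc         = λ i → finToFun c i , av i
      ; consecutive = co
      ; distinct    = di _ _
      }

    encode : ∀ {F} → DirectedCycle (deleteArcs F) →
             ∃ λ k → k < n × CodedCycle F k
    encode {F} C =
        pred-length C
      , injective⇒≤ (distinct C)
      , funToFin (proj₁ ∘ arc C)
      , cycleArcs-resp F _ (sym ∘ finToFun-funToFin (proj₁ ∘ arc C))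
          ( proj₂ ∘ arc C , consecutive C , λ _ _ → distinct C)

  isFeedbackArcSet? : ∀ F → Dec (IsFeedbackArcSet F)
  isFeedbackArcSet? F =
    ¬? (map′ decode encode
         (anyUpTo? (λ k → any? (λ c → cycleArcs? F k (finToFun c))) n))

  ⊤-isFeedbackArcSet : IsFeedbackArcSet ⊤
  ⊤-isFeedbackArcSet C = proj₂ (arc C zero) ∈⊤

  private
    minimise : ∀ F → IsFeedbackArcSet F → Acc _<_ ∣ F ∣ →
               ∃ IsMinimumFeedbackArcSet
    minimise F fb (acc rec)
      with anySubset? (λ G → isFeedbackArcSet? G ×-dec (∣ G ∣ <? ∣ F ∣))
    ... | yes (G , fbG , G<F) = minimise G fbG (rec G<F)
    ... | no ∄G = F , fb , λ G fbG → ≮⇒≥ (λ G<F → ∄G (G , fbG , G<F))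

  minimumFeedbackArcSet : ∃ IsMinimumFeedbackArcSet
  minimumFeedbackArcSet = minimise ⊤ ⊤-isFeedbackArcSet (<-wellFounded _)

  fas : ℕ
  fas = ∣ proj₁ minimumFeedbackArcSet ∣

{-# OPTIONS --safe #-}

-- The vertices are ranked so that few arcs go back.  A vertex with o out-arcs and
-- i in-arcs gets a weight φ o i, in units of 1/8700, so that 24/29 is 7200, the weight
-- of the types (o , i) = (2 , 3) and (3 , 2).  By induction on the number of arcs, an
-- oriented multigraph in which every vertex has out- or in-degree at most 2 has a ranking
-- with at most Φ / 8700 backward arcs, where Φ is the total weight.
--
-- Deleting a vertex costs min(o , i) backward arcs, since it can be ranked first or
-- last.  The weights are chosen so that deletion pays off on average over all vertices,
-- except for a deficit at the vertices of types (2 , 1) and (1 , 2).  A vertex v = (2 , 1)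
-- with in-neighbour u can be contracted into u for free; if u → v → w → u is a triangle,
-- this creates a 2-cycle, which is cancelled at cost 1 because exactly one of its arcs
-- goes back.  Contraction, cancellation or deletion of a few vertices near v stays within
-- the budget unless u = (2 , ≥ 3) and both out-neighbours of v have one of the types
-- (1 , 2), (1 , 3) and (2 , 3).  In that case deleting one of them turns v into a vertex of
-- type (1 , 1), whose elimination saves enough to cover the deficit in the average.
module Submission where

open import Defs
open import Data.Bool using (Bool; true; false; T; _∧_; if_then_else_)
open import Data.Bool.Properties using (T-∧; T-≡)
open import Data.Empty using (⊥; ⊥-elim)
open import Data.Fin using (Fin; zero; suc; toℕ)
open import Data.Fin.Properties using (_≟_; any?; toℕ-injective)
open import Data.Fin.Subset using (∣_∣)
open import Data.List using (List; []; _∷_; length; filter; tabulate)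
open import Data.List.Relation.Unary.All using (All; []; _∷_)
open import Data.Nat hiding (_≟_)
open import Data.Nat.DivMod using (_/_; m/n*n≤m)
import Data.Nat as ℕ
open import Data.Nat.Properties hiding (_≟_; suc-injective)
open import Data.Product
open import Data.Sum using (_⊎_; inj₁; inj₂)
import Data.Sum as Sum
open import Data.Unit using (⊤; tt)
open import Data.Vec using (Vec; []; _∷_; lookup)
import Data.Vec as Vec
open import Data.Vec.Properties using (lookup∘tabulate; lookup⇒[]=)
open import Function using (_∘_)
open import Function.Bundles using (Equivalence)
open import Relation.Binary using (tri<; tri≈; tri>)
open import Relation.Binary.PropositionalEquality
open import Relation.Nullary
open import Relation.Nullary.Decidable using (dec-true; dec-false)
open import Algebra.Properties.CommutativeSemigroup +-commutativeSemigroup using (interchange)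
open import Algebra.Properties.CommutativeMonoid.Sum +-0-commutativeMonoid
  using (sum; sum-cong-≗; ∑-distrib-+; ∑-comm)

-- Degree 5 forces the thin condition, and unlike regularity it survives deletion. The average is a
-- double count: if all deletions fail, summing the failures over the deleted vertices and
-- exchanging sums charges each vertex `x` with 8700 * min(o , i) and credits it with the weight it
-- loses in every deletion, its own included. Paying off thus becomes a condition on the type of
-- `x`. In the rates used there is no slack at (3 , 1), where 2 * 3729 + 3 * 414 = 8700, nor at (3 ,
-- 2), where 7200 + 3 * 1086 + 2 * 3471 = 17400. The 2900 of (1 , 1) is a third of 8700, as a
-- directed triangle demands. The type (2 , 1) collects only 2 * 3292 + 2 * 392 = 7368. The missing
-- 1332 comes from the same count: if deleting an out-neighbour `w` of `v` fails although a
-- contraction afterwards would save c, then that deletion misses by more than c. This surplus of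
-- `w` is shared out among its neighbours. Contraction cannot handle u = (2 , ≥ 3) itself, since the
-- merged vertex would have both degrees at least 3.

infixl 6 _⊕_
infixl 7 _⊛_

-- Reflective checking of linear inequalities over the natural numbers

data Lin (k : ℕ) : Set where
  con  : ℕ → Lin k
  var  : Fin k → Lin k
  _⊕_  : Lin k → Lin k → Lin k
  _⊛_  : Lin k → ℕ → Lin k

⟦_⟧ : ∀ {k} → Lin k → Vec ℕ k → ℕ
⟦ con c ⟧ ρ = c
⟦ var i ⟧ ρ = lookup ρ i
⟦ e ⊕ f ⟧ ρ = ⟦ e ⟧ ρ + ⟦ f ⟧ ρ
⟦ e ⊛ c ⟧ ρ = ⟦ e ⟧ ρ * c

Coeffs : ℕ → Set
Coeffs k = ℕ × Vec ℕ k

dot : ∀ {k} → Vec ℕ k → Vec ℕ k → ℕ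
dot []       []       = 0
dot (c ∷ cs) (x ∷ xs) = c * x + dot cs xs

zeros : ∀ k → Vec ℕ k
zeros zero    = []
zeros (suc k) = 0 ∷ zeros k

unit : ∀ {k} → Fin k → Vec ℕ k
unit zero    = 1 ∷ zeros _
unit (suc i) = 0 ∷ unit i

addV : ∀ {k} → Vec ℕ k → Vec ℕ k → Vec ℕ k
addV []       []       = []
addV (c ∷ cs) (d ∷ ds) = c + d ∷ addV cs ds

mulV : ∀ {k} → ℕ → Vec ℕ k → Vec ℕ k
mulV m []       = []
mulV m (c ∷ cs) = m * c ∷ mulV m cs

coeffs : ∀ {k} → Lin k → Coeffs k
coeffs (con c) = c , zeros _
coeffs (var i) = 0 , unit i
coeffs (e ⊕ f) = proj₁ (coeffs e) + proj₁ (coeffs f) , addV (proj₂ (coeffs e)) (proj₂ (coeffs f))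
coeffs (e ⊛ c) = c * proj₁ (coeffs e) , mulV c (proj₂ (coeffs e))

value : ∀ {k} → Coeffs k → Vec ℕ k → ℕ
value (c , cs) ρ = c + dot cs ρ

dot-zeros : ∀ {k} (ρ : Vec ℕ k) → dot (zeros k) ρ ≡ 0
dot-zeros []      = refl
dot-zeros (x ∷ ρ) = dot-zeros ρ

dot-unit : ∀ {k} (i : Fin k) ρ → dot (unit i) ρ ≡ lookup ρ i
dot-unit zero    (x ∷ ρ) = trans (cong₂ _+_ (*-identityˡ x) (dot-zeros ρ)) (+-identityʳ x)
dot-unit (suc i) (x ∷ ρ) = dot-unit i ρ

dot-add : ∀ {k} (cs ds ρ : Vec ℕ k) → dot (addV cs ds) ρ ≡ dot cs ρ + dot ds ρ
dot-add []       []       []      = refl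
dot-add (c ∷ cs) (d ∷ ds) (x ∷ ρ) =
  trans (cong₂ _+_ (*-distribʳ-+ x c d) (dot-add cs ds ρ)) (interchange (c * x) (d * x) _ _)

dot-mul : ∀ {k} m (cs ρ : Vec ℕ k) → dot (mulV m cs) ρ ≡ m * dot cs ρ
dot-mul m []       []      = sym (*-zeroʳ m)
dot-mul m (c ∷ cs) (x ∷ ρ) =
  trans (cong₂ _+_ (*-assoc m c x) (dot-mul m cs ρ)) (sym (*-distribˡ-+ m (c * x) _))

coeffs-sound : ∀ {k} (e : Lin k) ρ → value (coeffs e) ρ ≡ ⟦ e ⟧ ρ
coeffs-sound (con c) ρ = trans (cong (c +_) (dot-zeros ρ)) (+-identityʳ c)
coeffs-sound (var i) ρ = dot-unit i ρ
coeffs-sound (e ⊕ f) ρ = trans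
  (cong (proj₁ (coeffs e) + proj₁ (coeffs f) +_) (dot-add (proj₂ (coeffs e)) (proj₂ (coeffs f)) ρ))
  (trans (interchange (proj₁ (coeffs e)) _ _ _) (cong₂ _+_ (coeffs-sound e ρ) (coeffs-sound f ρ)))
coeffs-sound (e ⊛ c) ρ = trans
  (cong (c * proj₁ (coeffs e) +_) (dot-mul c (proj₂ (coeffs e)) ρ))
  (trans (sym (*-distribˡ-+ c (proj₁ (coeffs e)) _)) (trans (cong (c *_) (coeffs-sound e ρ)) (*-comm c _)))

leqV : ∀ {k} → Vec ℕ k → Vec ℕ k → Bool
leqV []       []       = true
leqV (c ∷ cs) (d ∷ ds) = (c ≤ᵇ d) ∧ leqV cs ds

leqV-sound : ∀ {k} (cs ds : Vec ℕ k) → T (leqV cs ds) → ∀ ρ → dot cs ρ ≤ dot ds ρ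
leqV-sound []       []       _ []      = z≤n
leqV-sound (c ∷ cs) (d ∷ ds) h (x ∷ ρ) with Equivalence.to T-∧ h
... | p , q = +-mono-≤ (*-monoˡ-≤ x (≤ᵇ⇒≤ c d p)) (leqV-sound cs ds q ρ)

record Hyp {k} (ρ : Vec ℕ k) : Set where
  constructor hyp
  field
    factor     : ℕ
    left right : Lin k
    holds      : ⟦ left ⟧ ρ ≤ ⟦ right ⟧ ρ

open Hyp

lefts rights : ∀ {k} {ρ : Vec ℕ k} → List (Hyp ρ) → Lin k
lefts  []       = con 0
lefts  (h ∷ hs) = left h ⊛ factor h ⊕ lefts hs
rights []       = con 0
rights (h ∷ hs) = right h ⊛ factor h ⊕ rights hs

combined : ∀ {k} {ρ : Vec ℕ k} (hs : List (Hyp ρ)) → ⟦ lefts hs ⟧ ρ ≤ ⟦ rights hs ⟧ ρ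
combined []       = z≤n
combined (h ∷ hs) = +-mono-≤ (*-monoˡ-≤ (factor h) (holds h)) (combined hs)

-- Comparing coefficients is sound because the variables take values in ℕ. All coefficients are
-- literals, so the test is plain evaluation.
check : ∀ {k} → Lin k → Lin k → Bool
check e f = (proj₁ (coeffs e) ≤ᵇ proj₁ (coeffs f)) ∧ leqV (proj₂ (coeffs e)) (proj₂ (coeffs f))

check-sound : ∀ {k} (e f : Lin k) → T (check e f) → ∀ ρ → ⟦ e ⟧ ρ ≤ ⟦ f ⟧ ρ
check-sound e f h ρ with Equivalence.to T-∧ h
... | p , q = subst₂ _≤_ (coeffs-sound e ρ) (coeffs-sound f ρ)
  (+-mono-≤ (≤ᵇ⇒≤ _ _ p) (leqV-sound (proj₂ (coeffs e)) _ q ρ))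

-- A Farkas certificate: each hypothesis comes with its multiplier.
linear : ∀ {k} (ρ : Vec ℕ k) (hs : List (Hyp ρ)) (e f : Lin k) →
         {_ : T (check (e ⊕ rights hs) (f ⊕ lefts hs))} → ⟦ e ⟧ ρ ≤ ⟦ f ⟧ ρ
linear ρ hs e f {h} = +-cancelʳ-≤ (⟦ rights hs ⟧ ρ) _ _
  (≤-trans (check-sound (e ⊕ rights hs) (f ⊕ lefts hs) h ρ)
           (+-monoʳ-≤ (⟦ f ⟧ ρ) (combined hs)))

pattern x₀ = var zero
pattern x₁ = var (suc zero)
pattern x₂ = var (suc (suc zero))
pattern x₃ = var (suc (suc (suc zero)))
pattern x₄ = var (suc (suc (suc (suc zero))))
pattern x₅ = var (suc (suc (suc (suc (suc zero)))))
pattern x₆ = var (suc (suc (suc (suc (suc (suc zero))))))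

num≤ : ∀ {m n} {_ : T (m ≤ᵇ n)} → m ≤ n
num≤ {m} {n} {h} = ≤ᵇ⇒≤ m n h

-- Vertex types and their weights

Thin : ℕ → ℕ → Set
Thin o i = o ≤ 2 ⊎ i ≤ 2

thin-sym : ∀ {o i} → Thin o i → Thin i o
thin-sym = Sum.swap

-- Deleting arcs never leaves the class, so only contraction needs a separate check.
thin-mono : ∀ {o i o' i'} → o' ≤ o → i' ≤ i → Thin o i → Thin o' i'
thin-mono p q = Sum.map (≤-trans p) (≤-trans q)

¬thin : ∀ {o i} {A : Set} → Thin (3 + o) (3 + i) → A
¬thin (inj₁ (s≤s (s≤s ())))
¬thin (inj₂ (s≤s (s≤s ())))

opaque
  -- Opaque, because a product with a large literal unfolds to as many additions.
  ℓ : ℕ → ℕ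
  ℓ j = j * 1560

  ℓ-0 : ℓ 0 ≡ 0
  ℓ-0 = refl

  ℓ-up : ∀ j → ℓ j + 1560 ≤ ℓ (suc j)
  ℓ-up j = ≤-reflexive (+-comm (j * 1560) 1560)

  ℓ-down : ∀ j → ℓ (suc j) ≤ ℓ j + 1560
  ℓ-down j = ≤-reflexive (+-comm 1560 (j * 1560))

  ℓ-≥ : ∀ j → j * 1560 ≤ ℓ j
  ℓ-≥ j = ≤-refl

opaque
  -- The weights of the types (1 , k + 1) and (2 , k + 2).
  row₁ row₂ : ℕ → ℕ
  row₁ 0             = 2900
  row₁ 1             = 3292
  row₁ (suc (suc j)) = ℓ j + 3729
  row₂ 0       = 6114
  row₂ (suc j) = ℓ j + 7200

  -- φ out in is the weight of a vertex; types with both degrees at least 3 never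
  -- occur (they are not Thin), and their weight is a dummy.
  φ : ℕ → ℕ → ℕ
  φ zero                i                   = 0
  φ (suc o)             zero                = 0
  φ 1                   (suc i)             = row₁ i
  φ (suc (suc o))       1                   = row₁ (suc o)
  φ 2                   (suc (suc i))       = row₂ i
  φ (suc (suc (suc o))) 2                   = row₂ (suc o)
  φ (suc (suc (suc o))) (suc (suc (suc i))) = 0

  φ-sym : ∀ o i → φ o i ≡ φ i o
  φ-sym zero    zero    = refl
  φ-sym zero    (suc i) = refl
  φ-sym (suc o) zero    = refl
  φ-sym 1 1 = refl
  φ-sym 1 (suc (suc i)) = refl
  φ-sym (suc (suc o)) 1 = refl
  φ-sym 2 2 = refl
  φ-sym 2 (suc (suc (suc i))) = refl
  φ-sym (suc (suc (suc o))) 2 = refl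
  φ-sym (suc (suc (suc o))) (suc (suc (suc i))) = refl

  φ-0ˡ : ∀ i → φ 0 i ≡ 0
  φ-0ˡ i = refl

  φ-0ʳ : ∀ o → φ o 0 ≡ 0
  φ-0ʳ zero    = refl
  φ-0ʳ (suc o) = refl

  φ-21 : φ 2 1 ≡ 3292
  φ-21 = refl

  φ-≥2900 : ∀ o i → Thin (1 + o) (1 + i) → 2900 ≤ φ (1 + o) (1 + i)
  φ-≥2900 0 0 t = num≤
  φ-≥2900 0 1 t = num≤
  φ-≥2900 0 (suc (suc i)) t = linear (ℓ i ∷ []) [] (con 2900) (x₀ ⊕ con 3729)
  φ-≥2900 1 0 t = num≤
  φ-≥2900 (suc (suc o)) 0 t = linear (ℓ o ∷ []) [] (con 2900) (x₀ ⊕ con 3729)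
  φ-≥2900 1 1 t = num≤
  φ-≥2900 1 (suc (suc i)) t = linear (ℓ i ∷ []) [] (con 2900) (x₀ ⊕ con 7200)
  φ-≥2900 (suc (suc o)) 1 t = linear (ℓ o ∷ []) [] (con 2900) (x₀ ⊕ con 7200)
  φ-≥2900 (suc (suc o)) (suc (suc i)) t = ¬thin t

  φ-12 : φ 1 2 ≡ 3292
  φ-12 = refl

  φ-22 : φ 2 2 ≡ 6114
  φ-22 = refl

  φ-1≥3 : ∀ i → 3729 ≤ φ 1 (3 + i)
  φ-1≥3 i = linear (ℓ i ∷ []) [] (con 3729) (x₀ ⊕ con 3729)

  φ-2≥3 : ∀ i → 7200 ≤ φ 2 (3 + i)
  φ-2≥3 i = linear (ℓ i ∷ []) [] (con 7200) (x₀ ⊕ con 7200)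

  deg5-a : ℓ 1 + 3729 ≤ 7200
  deg5-a = linear (ℓ 0 ∷ ℓ 1 ∷ [])
    (hyp 1 x₁ (x₀ ⊕ con 1560) (ℓ-down 0) ∷ hyp 1 x₀ (con 0) (≤-reflexive ℓ-0) ∷ []) (x₁ ⊕ con 3729) (con 7200)

  φ-deg5 : ∀ o i → o + i ≡ 5 → φ o i ≤ 7200
  φ-deg5 0 .5 refl = num≤
  φ-deg5 1 .4 refl = deg5-a
  φ-deg5 2 .3 refl = ≤-reflexive (cong (_+ 7200) ℓ-0)
  φ-deg5 3 .2 refl = ≤-reflexive (cong (_+ 7200) ℓ-0)
  φ-deg5 4 .1 refl = deg5-a
  φ-deg5 5 .0 refl = num≤
  φ-deg5 (suc (suc (suc (suc (suc (suc o)))))) i ()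

  -- The cheapest arc is the one from (1 , 1) to (2 , 1), worth 3292 - 2900 = 392.
  step-out : ∀ o i → Thin (2 + o) (1 + i) → φ (1 + o) (1 + i) + 392 ≤ φ (2 + o) (1 + i)
  step-out 0 0 t = num≤
  step-out 0 1 t = num≤
  step-out 0 (suc (suc i)) t =
    linear (ℓ i ∷ []) [] (x₀ ⊕ con 3729 ⊕ con 392) (x₀ ⊕ con 7200)
  step-out 1 0 t = linear (ℓ 0 ∷ []) [] (con 3292 ⊕ con 392) (x₀ ⊕ con 3729)
  step-out (suc (suc o)) 0 t =
    linear (ℓ o ∷ ℓ (suc o) ∷ []) (hyp 1 (x₀ ⊕ con 1560) x₁ (ℓ-up o) ∷ [])
    (x₀ ⊕ con 3729 ⊕ con 392) (x₁ ⊕ con 3729)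
  step-out 1 1 t = linear (ℓ 0 ∷ []) [] (con 6114 ⊕ con 392) (x₀ ⊕ con 7200)
  step-out (suc (suc o)) 1 t =
    linear (ℓ o ∷ ℓ (suc o) ∷ []) (hyp 1 (x₀ ⊕ con 1560) x₁ (ℓ-up o) ∷ [])
    (x₀ ⊕ con 7200 ⊕ con 392) (x₁ ⊕ con 7200)
  step-out (suc o) (suc (suc i)) t = ¬thin t

  -- Covers the case that `step-out` leaves open: when one side is emptied the weight falls to 0,
  -- and this must still be worth 392 for each lost arc.
  φ-≥degree : ∀ o i → Thin (1 + o) (1 + i) → (1 + o + (1 + i)) * 392 ≤ φ (1 + o) (1 + i)
  φ-≥degree 0 0 t = num≤
  φ-≥degree 0 1 t = num≤
  φ-≥degree 0 (suc (suc i)) t =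
    linear (i ∷ ℓ i ∷ []) (hyp 1 (x₀ ⊛ 1560) x₁ (ℓ-≥ i) ∷ []) ((con 4 ⊕ x₀) ⊛ 392) (x₁ ⊕ con 3729)
  φ-≥degree 1 0 t = num≤
  φ-≥degree (suc (suc o)) 0 t =
    linear (o ∷ ℓ o ∷ []) (hyp 1 (x₀ ⊛ 1560) x₁ (ℓ-≥ o) ∷ []) ((con 3 ⊕ x₀ ⊕ con 1) ⊛ 392) (x₁ ⊕ con 3729)
  φ-≥degree 1 1 t = num≤
  φ-≥degree 1 (suc (suc i)) t =
    linear (i ∷ ℓ i ∷ []) (hyp 1 (x₀ ⊛ 1560) x₁ (ℓ-≥ i) ∷ []) ((con 5 ⊕ x₀) ⊛ 392) (x₁ ⊕ con 7200)
  φ-≥degree (suc (suc o)) 1 t =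
    linear (o ∷ ℓ o ∷ []) (hyp 1 (x₀ ⊛ 1560) x₁ (ℓ-≥ o) ∷ []) ((con 3 ⊕ x₀ ⊕ con 2) ⊛ 392) (x₁ ⊕ con 7200)
  φ-≥degree (suc (suc o)) (suc (suc i)) t = ¬thin t

  -- The effect of cancelling a 2-cycle on one of its vertices.
  diag : ∀ o i → Thin (1 + o) (1 + i) → φ o i + 2900 ≤ φ (1 + o) (1 + i)
  diag 0 i t = φ-≥2900 0 i t
  diag (suc o) 0 t = φ-≥2900 (suc o) 0 t
  diag 1 1 t = num≤
  diag 1 2 t = linear (ℓ 0 ∷ []) [] (con 3292 ⊕ con 2900) (x₀ ⊕ con 7200)
  diag 1 (suc (suc (suc i))) t =
    linear (ℓ i ∷ ℓ (suc i) ∷ []) (hyp 1 (x₀ ⊕ con 1560) x₁ (ℓ-up i) ∷ [])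
      (x₀ ⊕ con 3729 ⊕ con 2900) (x₁ ⊕ con 7200)
  diag 2 1 t = linear (ℓ 0 ∷ []) [] (con 3292 ⊕ con 2900) (x₀ ⊕ con 7200)
  diag (suc (suc (suc o))) 1 t =
    linear (ℓ o ∷ ℓ (suc o) ∷ []) (hyp 1 (x₀ ⊕ con 1560) x₁ (ℓ-up o) ∷ [])
    (x₀ ⊕ con 3729 ⊕ con 2900) (x₁ ⊕ con 7200)
  diag (suc (suc o)) (suc (suc i)) t = ¬thin t

  -- Once (1 , 1) is excluded, the worst case is (2 , 2), where 6114 - 2900 = 3214.
  diag-3214 : ∀ o i → Thin (1 + o) (1 + i) → 1 ≤ o + i → φ o i + 3214 ≤ φ (1 + o) (1 + i)
  diag-3214 0 1 t p = num≤
  diag-3214 0 (suc (suc i)) t p = linear (ℓ i ∷ []) [] (con 3214) (x₀ ⊕ con 3729)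
  diag-3214 1 0 t p = num≤
  diag-3214 (suc (suc o)) 0 t p = linear (ℓ o ∷ []) [] (con 3214) (x₀ ⊕ con 3729)
  diag-3214 1 1 t p = num≤
  diag-3214 1 2 t p = linear (ℓ 0 ∷ []) [] (con 3292 ⊕ con 3214) (x₀ ⊕ con 7200)
  diag-3214 1 (suc (suc (suc i))) t p =
    linear (ℓ i ∷ ℓ (suc i) ∷ []) (hyp 1 (x₀ ⊕ con 1560) x₁ (ℓ-up i) ∷ [])
      (x₀ ⊕ con 3729 ⊕ con 3214) (x₁ ⊕ con 7200)
  diag-3214 2 1 t p = linear (ℓ 0 ∷ []) [] (con 3292 ⊕ con 3214) (x₀ ⊕ con 7200)
  diag-3214 (suc (suc (suc o))) 1 t p =
    linear (ℓ o ∷ ℓ (suc o) ∷ []) (hyp 1 (x₀ ⊕ con 1560) x₁ (ℓ-up o) ∷ [])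
    (x₀ ⊕ con 3729 ⊕ con 3214) (x₁ ⊕ con 7200)
  diag-3214 (suc (suc o)) (suc (suc i)) t p = ¬thin t

  diag-1≥3 : ∀ i → φ 0 (2 + i) + 3729 ≤ φ 1 (3 + i)
  diag-1≥3 i = linear (ℓ i ∷ []) [] (con 3729) (x₀ ⊕ con 3729)

  diag-2≥3 : ∀ i → φ 1 (2 + i) + 3908 ≤ φ 2 (3 + i)
  diag-2≥3 0 = linear (ℓ 0 ∷ []) [] (con 3292 ⊕ con 3908) (x₀ ⊕ con 7200)
  diag-2≥3 (suc i) =
    linear (ℓ i ∷ ℓ (suc i) ∷ []) (hyp 1 (x₀ ⊕ con 1560) x₁ (ℓ-up i) ∷ [])
    (x₀ ⊕ con 3729 ⊕ con 3908) (x₁ ⊕ con 7200)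

  -- Contracting a vertex of type (2 , 1) into its in-neighbour.
  grow : ∀ o i → 1 ≤ o → i ≤ 2 → φ (1 + o) i ≤ φ o i + 3292
  grow (suc o) 0 p q = num≤
  grow 1 1 p q = num≤
  grow 2 1 p q = linear (ℓ 0 ∷ []) (hyp 1 x₀ (con 0) (≤-reflexive ℓ-0) ∷ []) (x₀ ⊕ con 3729) (con 3292 ⊕ con 3292)
  grow (suc (suc (suc o))) 1 p q =
    linear (ℓ o ∷ ℓ (suc o) ∷ []) (hyp 1 x₁ (x₀ ⊕ con 1560) (ℓ-down o) ∷ [])
    (x₁ ⊕ con 3729) (x₀ ⊕ con 3729 ⊕ con 3292)
  grow 1 2 p q = num≤
  grow 2 2 p q = linear (ℓ 0 ∷ []) (hyp 1 x₀ (con 0) (≤-reflexive ℓ-0) ∷ []) (x₀ ⊕ con 7200) (con 6114 ⊕ con 3292)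
  grow (suc (suc (suc o))) 2 p q =
    linear (ℓ o ∷ ℓ (suc o) ∷ []) (hyp 1 x₁ (x₀ ⊕ con 1560) (ℓ-down o) ∷ [])
    (x₁ ⊕ con 7200) (x₀ ⊕ con 7200 ⊕ con 3292)
  grow o (suc (suc (suc i))) p (s≤s (s≤s ()))

  -- The worst case is the second in-arc of (2 , 2): 6114 - 3292 = 2822.
  in-2822 : ∀ o i → 2 ≤ o → i ≤ 1 → φ o i + 2822 ≤ φ o (1 + i)
  in-2822 0 i () q
  in-2822 1 i (s≤s ()) q
  in-2822 2 0 p q = num≤
  in-2822 (suc (suc (suc o))) 0 p q = linear (ℓ o ∷ []) [] (con 2822) (x₀ ⊕ con 3729)
  in-2822 2 1 p q = num≤
  in-2822 (suc (suc (suc o))) 1 p q =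
    linear (ℓ o ∷ []) [] (x₀ ⊕ con 3729 ⊕ con 2822) (x₀ ⊕ con 7200)
  in-2822 o (suc (suc i)) p (s≤s ())

  in-3471 : ∀ o → φ (3 + o) 1 + 3471 ≤ φ (3 + o) 2
  in-3471 o = linear (ℓ o ∷ []) [] (x₀ ⊕ con 3729 ⊕ con 3471) (x₀ ⊕ con 7200)

  -- In this range the weight grows by 1560 per in-arc. What `decide` needs of it is 1545 = 8700 -
  -- 3292 - 3471 - 392.
  in-1545 : ∀ o i → 1 ≤ o → o ≤ 2 → 3 ≤ i → φ o i + 1545 ≤ φ o (1 + i)
  in-1545 1 (suc (suc (suc i))) p q r =
    linear (ℓ i ∷ ℓ (suc i) ∷ []) (hyp 1 (x₀ ⊕ con 1560) x₁ (ℓ-up i) ∷ [])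
    (x₀ ⊕ con 3729 ⊕ con 1545) (x₁ ⊕ con 3729)
  in-1545 2 (suc (suc (suc i))) p q r =
    linear (ℓ i ∷ ℓ (suc i) ∷ []) (hyp 1 (x₀ ⊕ con 1560) x₁ (ℓ-up i) ∷ [])
    (x₀ ⊕ con 7200 ⊕ con 1545) (x₁ ⊕ con 7200)
  in-1545 1 1 p q (s≤s ())
  in-1545 1 2 p q (s≤s (s≤s ()))
  in-1545 2 1 p q (s≤s ())
  in-1545 2 2 p q (s≤s (s≤s ()))
  in-1545 (suc (suc (suc o))) i p (s≤s (s≤s ())) r

  -- Losing one, two or three out-arcs lowers 3729 by 437, 829 or 3729. The smallest average per arc
  -- is 829 / 2, rounded down to 414.
  out-414 : ∀ o' m → m + o' ≡ 3 → φ o' 1 + m * 414 ≤ φ 3 1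
  out-414 o' m e = go o' m e
    where
    4+o≰3 : ∀ {o} → ¬ (4 + o ≤ 3)
    4+o≰3 (s≤s (s≤s (s≤s ())))

    go : ∀ o' m → m + o' ≡ 3 → φ o' 1 + m * 414 ≤ ℓ 0 + 3729
    go 0 3 e = linear (ℓ 0 ∷ []) [] (con 1242) (x₀ ⊕ con 3729)
    go 1 2 e = linear (ℓ 0 ∷ []) [] (con 2900 ⊕ con 828) (x₀ ⊕ con 3729)
    go 2 1 e = linear (ℓ 0 ∷ []) [] (con 3292 ⊕ con 414) (x₀ ⊕ con 3729)
    go 3 0 e = linear (ℓ 0 ∷ []) [] (x₀ ⊕ con 3729 ⊕ con 0) (x₀ ⊕ con 3729)
    go 0 0 ()
    go 0 1 ()
    go 0 2 ()
    go 0 (suc (suc (suc (suc m)))) ()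
    go 1 0 ()
    go 1 1 ()
    go 1 (suc (suc (suc m))) e = ⊥-elim (4+o≰3 {0} (subst (4 ≤_) e (s≤s (s≤s (s≤s (m≤n+m 1 m))))))
    go 2 0 ()
    go 2 (suc (suc m)) e = ⊥-elim (4+o≰3 {0} (subst (4 ≤_) e (s≤s (s≤s (m≤n+m 2 m)))))
    go 3 (suc m) e = ⊥-elim (4+o≰3 {0} (subst (4 ≤_) e (s≤s (m≤n+m 3 m))))
    go (suc (suc (suc (suc o')))) m e = ⊥-elim (4+o≰3 (≤-trans (m≤n+m _ m) (≤-reflexive e)))

  -- The worst case is the step from (2 , 2) to (3 , 2): 7200 - 6114 = 1086.
  out-step-1086 : ∀ o → φ (1 + o) 2 + 1086 ≤ φ (2 + o) 2
  out-step-1086 0 = num≤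
  out-step-1086 1 = linear (ℓ 0 ∷ []) [] (con 6114 ⊕ con 1086) (x₀ ⊕ con 7200)
  out-step-1086 (suc (suc o)) =
    linear (ℓ o ∷ ℓ (suc o) ∷ []) (hyp 1 (x₀ ⊕ con 1560) x₁ (ℓ-up o) ∷ [])
    (x₀ ⊕ con 7200 ⊕ con 1086) (x₁ ⊕ con 7200)

  φ-≥1086 : ∀ o → (3 + o) * 1086 ≤ φ (3 + o) 2
  φ-≥1086 o = linear (o ∷ ℓ o ∷ []) (hyp 1 (x₀ ⊛ 1560) x₁ (ℓ-≥ o) ∷ []) ((con 3 ⊕ x₀) ⊛ 1086) (x₁ ⊕ con 7200)

  φ-≥5289 : ∀ o → 5289 ≤ φ (4 + o) 1
  φ-≥5289 o = linear (ℓ o ∷ ℓ (suc o) ∷ []) (hyp 1 (x₀ ⊕ con 1560) x₁ (ℓ-up o) ∷ [])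
    (con 5289) (x₁ ⊕ con 3729)

  φ-31 : φ 3 1 ≡ 3729
  φ-31 = cong (_+ 3729) ℓ-0

  φ-≥7200 : ∀ o → 7200 ≤ φ (3 + o) 2
  φ-≥7200 o = linear (ℓ o ∷ []) [] (con 7200) (x₀ ⊕ con 7200)

drop-out : ∀ q o i → Thin (q + suc o) (1 + i) → φ (1 + o) (1 + i) + q * 392 ≤ φ (q + suc o) (1 + i)
drop-out zero    o i t = ≤-reflexive (+-identityʳ _)
drop-out (suc q) o i t = linear (φ (1 + o) (1 + i) ∷ q ∷ φ (q + suc o) (1 + i) ∷ φ (suc q + suc o) (1 + i) ∷ [])
  ( hyp 1 (x₀ ⊕ x₁ ⊛ 392) x₂ (drop-out q o i (thin-mono (n≤1+n _) ≤-refl t))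
  ∷ hyp 1 (x₂ ⊕ con 392) x₃ (step q o i t) ∷ [])
  (x₀ ⊕ (con 1 ⊕ x₁) ⊛ 392) x₃
  where
  step : ∀ q o i → Thin (suc q + suc o) (1 + i) → φ (q + suc o) (1 + i) + 392 ≤ φ (suc q + suc o) (1 + i)
  step q o i t rewrite +-suc q o = step-out (q + o) i t

drop-in : ∀ p o i → Thin (1 + o) (p + suc i) → φ (1 + o) (1 + i) + p * 392 ≤ φ (1 + o) (p + suc i)
drop-in p o i t rewrite φ-sym (1 + o) (1 + i) | φ-sym (1 + o) (p + suc i) = drop-out p i o (thin-sym t)

φ-≥deg : ∀ {o i} → 1 ≤ o → 1 ≤ i → Thin o i → (o + i) * 392 ≤ φ o i
φ-≥deg {suc o} {suc i} p q t = φ-≥degree o i t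

φ-small : ∀ {o i} o' i' q p → q + o' ≡ o → p + i' ≡ i → 1 ≤ o → 1 ≤ i → Thin o i →
          φ o' i' + (q + p) * 392 ≤ φ o i
φ-small zero i' q p refl refl x y t rewrite φ-0ˡ i' = ≤-trans
  (*-monoˡ-≤ 392 (+-mono-≤ (m≤m+n q 0) (m≤m+n p i'))) (φ-≥deg x y t)
φ-small o'@(suc _) zero q p refl refl x y t rewrite φ-0ʳ o' = ≤-trans
  (*-monoˡ-≤ 392 (+-mono-≤ (m≤m+n q o') (m≤m+n p 0))) (φ-≥deg x y t)
φ-small (suc o) (suc i) q p refl refl x y t = linear
  (φ (1 + o) (1 + i) ∷ q ∷ p ∷ φ (q + suc o) (1 + i) ∷ φ (q + suc o) (p + suc i) ∷ [])
  ( hyp 1 (x₀ ⊕ x₁ ⊛ 392) x₃ (drop-out q o i (thin-mono ≤-refl (m≤n+m _ p) t))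
  ∷ hyp 1 (x₃ ⊕ x₂ ⊛ 392) x₄ (lem (subst (λ z → Thin z (p + suc i)) (+-suc q o) t)) ∷ [])
  (x₀ ⊕ (x₁ ⊕ x₂) ⊛ 392) x₄
  where
  lem : Thin (1 + (q + o)) (p + suc i) → φ (q + suc o) (1 + i) + p * 392 ≤ φ (q + suc o) (p + suc i)
  lem t rewrite +-suc q o = drop-in p (q + o) i t

-- Thinness of the larger type matters: the dummy weight 0 of (3 , 3) lies below the weight of (2 ,
-- 3).
φ-mono : ∀ {o i o' i'} → Thin o i → o' ≤ o → i' ≤ i → φ o' i' ≤ φ o i
φ-mono {zero} {i} {zero} {i'} t z≤n q = ≤-reflexive (trans (φ-0ˡ i') (sym (φ-0ˡ i)))
φ-mono {suc o} {zero} {o'} {zero} t p z≤n = ≤-reflexive (trans (φ-0ʳ o') (sym (φ-0ʳ (suc o))))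
φ-mono {o@(suc _)} {i@(suc _)} {o'} {i'} t p q = ≤-trans (m≤m+n (φ o' i') _)
  (φ-small o' i' (o ∸ o') (i ∸ i') (m∸n+n≡m p) (m∸n+n≡m q) (s≤s z≤n) (s≤s z≤n) t)

out-1086 : ∀ o' m {o} → m + o' ≡ 3 + o → φ o' 2 + m * 1086 ≤ φ (3 + o) 2
out-1086 zero m {o} e rewrite φ-0ˡ 2 | trans (sym (+-identityʳ m)) e = φ-≥1086 o
out-1086 (suc o') m {o} e rewrite sym e = go m
  where
  go : ∀ m → φ (suc o') 2 + m * 1086 ≤ φ (m + suc o') 2
  go zero    = ≤-reflexive (+-identityʳ _)
  go (suc m) = linear (φ (1 + o') 2 ∷ m ∷ φ (m + suc o') 2 ∷ φ (suc m + suc o') 2 ∷ [])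
    ( hyp 1 (x₀ ⊕ x₁ ⊛ 1086) x₂ (go m) ∷ hyp 1 (x₂ ⊕ con 1086) x₃ step ∷ [])
    (x₀ ⊕ (con 1 ⊕ x₁) ⊛ 1086) x₃
    where
    step : φ (m + suc o') 2 + 1086 ≤ φ (suc m + suc o') 2
    step rewrite +-suc m o' = out-step-1086 (m + o')

-- Sums over Fin

sum-mono : ∀ {n} {f g : Fin n → ℕ} → (∀ x → f x ≤ g x) → sum f ≤ sum g
sum-mono {zero}  h = z≤n
sum-mono {suc n} h = +-mono-≤ (h zero) (sum-mono (h ∘ suc))

sum-zero : ∀ {n} {f : Fin n → ℕ} → (∀ x → f x ≡ 0) → sum f ≡ 0
sum-zero {zero}  h = refl
sum-zero {suc n} h = cong₂ _+_ (h zero) (sum-zero (h ∘ suc))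

sum-* : ∀ {n} (f : Fin n → ℕ) c → sum (λ x → f x * c) ≡ sum f * c
sum-* {zero}  f c = refl
sum-* {suc n} f c = trans (cong (f zero * c +_) (sum-* (f ∘ suc) c)) (sym (*-distribʳ-+ c (f zero) _))

term≤sum : ∀ {n} (f : Fin n → ℕ) x → f x ≤ sum f
term≤sum f zero    = m≤m+n _ _
term≤sum f (suc x) = ≤-trans (term≤sum (f ∘ suc) x) (m≤n+m _ _)

δ : ∀ {n} → Fin n → ℕ → Fin n → ℕ
δ u c x = if does (x ≟ u) then c else 0

δ-same : ∀ {n} (u : Fin n) c → δ u c u ≡ c
δ-same u c rewrite dec-true (u ≟ u) refl = refl

δ-diff : ∀ {n} {u x : Fin n} c → x ≢ u → δ u c x ≡ 0
δ-diff {u = u} {x} c p rewrite dec-false (x ≟ u) p = refl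

sum-δ : ∀ {n} (u : Fin n) c → sum (δ u c) ≡ c
sum-δ {suc n} zero c =
  trans (cong (c +_) (sum-zero {n} {λ _ → 0} (λ _ → refl))) (+-identityʳ c)
sum-δ {suc n} (suc u) c = trans (sum-cong-≗ lem) (sum-δ u c)
  where
  lem : ∀ x → δ (suc u) c (suc x) ≡ δ u c x
  lem x = refl

except : ∀ {n} → Fin n → (Fin n → ℕ) → Fin n → ℕ
except u f x = if does (x ≟ u) then 0 else f x

except-same : ∀ {n} (u : Fin n) f → except u f u ≡ 0
except-same u f rewrite dec-true (u ≟ u) refl = refl

except-diff : ∀ {n} {u x : Fin n} f → x ≢ u → except u f x ≡ f x
except-diff {u = u} {x} f p rewrite dec-false (x ≟ u) p = refl

sum-except : ∀ {n} (f : Fin n → ℕ) u → sum (except u f) + f u ≡ sum f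
sum-except f u = trans (cong (sum (except u f) +_) (sym (sum-δ u (f u))))
  (trans (sym (∑-distrib-+ (except u f) (δ u (f u)))) (sum-cong-≗ lem))
  where
  lem : ∀ x → except u f x + δ u (f u) x ≡ f x
  lem x with x ≟ u
  ... | yes refl = refl
  ... | no p     = +-identityʳ _

sum-≡0 : ∀ {n} (f : Fin n → ℕ) → sum f ≡ 0 → ∀ x → f x ≡ 0
sum-≡0 f e x = n≤0⇒n≡0 (≤-trans (term≤sum f x) (≤-reflexive e))

sum-pos : ∀ {n} (f : Fin n → ℕ) → 1 ≤ sum f → ∃ λ x → 1 ≤ f x
sum-pos {suc n} f p with f zero in eq
... | suc k = zero , subst (1 ≤_) (sym eq) (s≤s z≤n)
... | zero with sum-pos (f ∘ suc) p
...   | x , q = suc x , q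

others-zero : ∀ {n} (f : Fin n → ℕ) u → sum (except u f) ≡ 0 → ∀ x → x ≢ u → f x ≡ 0
others-zero f u e x p = trans (sym (except-diff f p)) (sum-≡0 (except u f) e x)

sum-one : ∀ {n} (f : Fin n → ℕ) → sum f ≡ 1 → ∃ λ u → f u ≡ 1 × (∀ x → x ≢ u → f x ≡ 0)
sum-one f e with sum-pos f (≤-reflexive (sym e))
... | u , p = u , fu≡1 , others-zero f u rest≡0
  where
  fu≡1 : f u ≡ 1
  fu≡1 = ≤-antisym (≤-trans (term≤sum f u) (≤-reflexive e)) p
  rest≡0 : sum (except u f) ≡ 0
  rest≡0 = +-cancelʳ-≡ 1 _ 0 (trans (cong (sum (except u f) +_) (sym fu≡1)) (trans (sum-except f u) e))

sum-two : ∀ {n} (f : Fin n → ℕ) → sum f ≡ 2 →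
          (∃ λ u → f u ≡ 2 × (∀ x → x ≢ u → f x ≡ 0)) ⊎
          (∃₂ λ u w → u ≢ w × f u ≡ 1 × f w ≡ 1 × (∀ x → x ≢ u → x ≢ w → f x ≡ 0))
sum-two f e with sum-pos f (≤-trans (s≤s z≤n) (≤-reflexive (sym e)))
... | u , p with f u in eq | ≤-trans (term≤sum f u) (≤-reflexive e) | sum-except f u
...   | 1 | _ | q with sum-one (except u f) (+-cancelʳ-≡ 1 _ 1 (trans q e))
...     | w , r , s = inj₂ (u , w , u≢w , eq , trans (sym (except-diff f (u≢w ∘ sym))) r ,
                        λ x x≢u x≢w → trans (sym (except-diff f x≢u)) (s x x≢w))
  where
  u≢w : u ≢ w
  u≢w refl with () ← trans (sym r) (except-same u f)
sum-two f e | u , p | 2 | _ | q = inj₁ (u , eq , others-zero f u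
  (+-cancelʳ-≡ 2 _ 0 (trans q e)))
sum-two f e | u , p | suc (suc (suc k)) | s≤s (s≤s ()) | q

when : Bool → ℕ → ℕ
when b k = if b then k else 0

when-mono : ∀ b {k l} → k ≤ l → when b k ≤ when b l
when-mono false p = z≤n
when-mono true  p = p

when-≤ : ∀ b k → when b k ≤ k
when-≤ false k = z≤n
when-≤ true  k = ≤-refl

when-imp : ∀ {b c} k → (T b → T c) → when b k ≤ when c k
when-imp {false}         k f = z≤n
when-imp {true}  {true}  k f = ≤-refl
when-imp {true}  {false} k f = ⊥-elim (f _)

-- Multigraphs, given by their matrix of multiplicities

Graph : ℕ → Set
Graph n = Fin n → Fin n → ℕ

module _ {n : ℕ} where

  out inn : Graph n → Fin n → ℕ
  out M x = sum (M x)
  inn M x = sum (λ y → M y x)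

  Φ size : Graph n → ℕ
  Φ M    = sum (λ x → φ (out M x) (inn M x))
  size M = sum (out M)

  rev : Graph n → Graph n
  rev M x y = M y x

  -- The vertex stays behind, isolated and of weight 0, so that the vertex set is `Fin n` throughout
  -- the induction.
  del : Fin n → Graph n → Graph n
  del v M x y = except v (λ _ → except v (M x) y) x

  -- `u` inherits the out-arcs of `v`, while the in-arcs of `v` are dropped. This is the contraction
  -- when every in-arc of `v` comes from `u`.
  contract : Fin n → Fin n → Graph n → Graph n
  contract u v M x y = del v M x y + δ u (M v y) x

  single : Fin n → Fin n → Graph n
  single u w x y = δ u (δ w 1 y) x

  dec : Fin n → Fin n → Graph n → Graph n
  dec u w M x y = M x y ∸ δ u (δ w 1 y) x

  cancel : Fin n → Fin n → Graph n → Graph n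
  cancel u w M = dec w u (dec u w M)

  del-off : ∀ {v x y} M → x ≢ v → y ≢ v → del v M x y ≡ M x y
  del-off {v} {x} {y} M p q = trans (except-diff (λ _ → except v (M x) y) p) (except-diff (M x) q)

  del-row : ∀ {v} M y → del v M v y ≡ 0
  del-row {v} M y = except-same v (λ _ → except v (M v) y)

  del-col : ∀ {v} M x → del v M x v ≡ 0
  del-col {v} M x with x ≟ v
  ... | yes _ = refl
  ... | no _  = except-same v (M x)

  del-≤ : ∀ v M x y → del v M x y ≤ M x y
  del-≤ v M x y with x ≟ v
  ... | yes _ = z≤n
  ... | no _ with y ≟ v
  ...   | yes _ = z≤n
  ...   | no _  = ≤-refl

  out-del : ∀ {v x} M → x ≢ v → out (del v M) x + M x v ≡ out M x
  out-del {v} {x} M p =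
    trans (cong (_+ M x v) (sum-cong-≗ (λ y → except-diff (λ _ → except v (M x) y) p))) (sum-except (M x) v)

  inn-del : ∀ {v x} M → x ≢ v → inn (del v M) x + M v x ≡ inn M x
  inn-del {v} {x} M p = trans (cong (_+ M v x) (sum-cong-≗ lem)) (sum-except (λ y → M y x) v)
    where
    lem : ∀ y → del v M y x ≡ except v (λ y → M y x) y
    lem y with y ≟ v
    ... | yes _ = refl
    ... | no _  = except-diff (M y) p

  out-del-self : ∀ v M → out (del v M) v ≡ 0
  out-del-self v M = sum-zero {n} {del v M v} (del-row {v} M)

  out-contract-u : ∀ {u v} M → u ≢ v → out (contract u v M) u + M u v ≡ out M u + out M v
  out-contract-u {u} {v} M p = begin
    out (contract u v M) u + M u v
      ≡⟨ cong (_+ M u v) (∑-distrib-+ (del v M u) (λ y → δ u (M v y) u)) ⟩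
    out (del v M) u + sum (λ y → δ u (M v y) u) + M u v
      ≡⟨ cong (λ z → out (del v M) u + z + M u v) (sum-cong-≗ (λ y → δ-same u (M v y))) ⟩
    out (del v M) u + out M v + M u v ≡⟨ +-assoc (out (del v M) u) _ _ ⟩
    out (del v M) u + (out M v + M u v) ≡⟨ cong (out (del v M) u +_) (+-comm (out M v) _) ⟩
    out (del v M) u + (M u v + out M v) ≡⟨ +-assoc (out (del v M) u) _ _ ⟨
    out (del v M) u + M u v + out M v ≡⟨ cong (_+ out M v) (out-del M p) ⟩
    out M u + out M v ∎
    where open ≡-Reasoning

  contract-off : ∀ {u v x} M y → x ≢ u → contract u v M x y ≡ del v M x y
  contract-off {u} {v} {x} M y p = trans (cong (del v M x y +_) (δ-diff (M v y) p)) (+-identityʳ _)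

  contract-u : ∀ {u v y} M → u ≢ v → y ≢ v → contract u v M u y ≡ M u y + M v y
  contract-u {u} {v} {y} M p q = cong₂ _+_ (del-off M p q) (δ-same u _)

  out-contract : ∀ {u v x} M → x ≢ u → out (contract u v M) x ≡ out (del v M) x
  out-contract M p = sum-cong-≗ (λ y → contract-off M y p)

  inn-contract : ∀ u {v} x M → inn (contract u v M) x ≡ inn (del v M) x + M v x
  inn-contract u {v} x M =
    trans (∑-distrib-+ (λ y → del v M y x) (δ u (M v x))) (cong (inn (del v M) x +_) (sum-δ u (M v x)))

  dec-≤ : ∀ u w M x y → dec u w M x y ≤ M x y
  dec-≤ u w M x y = m∸n≤m (M x y) (δ u (δ w 1 y) x)

  dec-row : ∀ {u w x} M y → x ≢ u → dec u w M x y ≡ M x y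
  dec-row {u} {w} {x} M y p = cong (M x y ∸_) (δ-diff (δ w 1 y) p)

  dec-col : ∀ {u w y} M x → y ≢ w → dec u w M x y ≡ M x y
  dec-col {u} {w} {y} M x p with x ≟ u
  ... | yes _ = cong (M x y ∸_) (δ-diff 1 p)
  ... | no _  = refl

  dec-hit : ∀ u w M → dec u w M u w ≡ M u w ∸ 1
  dec-hit u w M = cong (M u w ∸_) (trans (δ-same u _) (δ-same w 1))

  δ-≤ : ∀ {u w : Fin n} {f : Fin n → ℕ} → 1 ≤ f w → ∀ y → δ u (δ w 1 y) u ≤ f y
  δ-≤ {u} {w} {f} p y with y ≟ w
  ... | yes refl rewrite δ-same u 1 = p
  ... | no _     rewrite δ-same u 0 = z≤n

  out-dec-u : ∀ {u w} M → 1 ≤ M u w → out (dec u w M) u + 1 ≡ out M u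
  out-dec-u {u} {w} M p = begin
    out (dec u w M) u + 1
      ≡⟨ cong (out (dec u w M) u +_) (trans (sum-cong-≗ (λ y → δ-same u (δ w 1 y))) (sum-δ w 1)) ⟨
    out (dec u w M) u + sum (λ y → δ u (δ w 1 y) u)
      ≡⟨ ∑-distrib-+ (dec u w M u) (λ y → δ u (δ w 1 y) u) ⟨
    sum (λ y → dec u w M u y + δ u (δ w 1 y) u)
      ≡⟨ sum-cong-≗ {n} {λ y → dec u w M u y + δ u (δ w 1 y) u} (λ y → m∸n+n≡m (δ-≤ {u} {w} {M u} p y)) ⟩
    out M u ∎
    where open ≡-Reasoning

  inn-dec-w : ∀ {u w} M → 1 ≤ M u w → inn (dec u w M) w + 1 ≡ inn M w
  inn-dec-w {u} {w} M p = begin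
    inn (dec u w M) w + 1
      ≡⟨ cong (inn (dec u w M) w +_) (trans (sum-δ u (δ w 1 w)) (δ-same w 1)) ⟨
    inn (dec u w M) w + sum (δ u (δ w 1 w))
      ≡⟨ ∑-distrib-+ (λ y → dec u w M y w) (δ u (δ w 1 w)) ⟨
    sum (λ y → dec u w M y w + δ u (δ w 1 w) y)
      ≡⟨ sum-cong-≗ (λ y → m∸n+n≡m (lem y)) ⟩
    inn M w ∎
    where
    open ≡-Reasoning
    lem : ∀ y → δ u (δ w 1 w) y ≤ M y w
    lem y with y ≟ u
    ... | yes refl rewrite δ-same w 1 = p
    ... | no _     = z≤n

  out-dec : ∀ {u w x} M → x ≢ u → out (dec u w M) x ≡ out M x
  out-dec M p = sum-cong-≗ (λ y → dec-row M y p)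

  inn-dec : ∀ {u w x} M → x ≢ w → inn (dec u w M) x ≡ inn M x
  inn-dec M p = sum-cong-≗ (λ y → dec-col M y p)

  module Cancel {u w} (M : Graph n) (u≢w : u ≢ w) (p : 1 ≤ M u w) (q : 1 ≤ M w u) where

    M₁ : Graph n
    M₁ = dec u w M

    q₁ : 1 ≤ M₁ w u
    q₁ = subst (1 ≤_) (sym (dec-row {u} {w} M u (u≢w ∘ sym))) q

    out-u : out (cancel u w M) u + 1 ≡ out M u
    out-u = trans (cong (_+ 1) (out-dec {w} {u} M₁ u≢w)) (out-dec-u {u} {w} M p)

    inn-u : inn (cancel u w M) u + 1 ≡ inn M u
    inn-u = trans (inn-dec-w {w} {u} M₁ q₁) (inn-dec {u} {w} M u≢w)

    out-w : out (cancel u w M) w + 1 ≡ out M w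
    out-w = trans (out-dec-u {w} {u} M₁ q₁) (out-dec {u} {w} M (u≢w ∘ sym))

    inn-w : inn (cancel u w M) w + 1 ≡ inn M w
    inn-w = trans (cong (_+ 1) (inn-dec {w} {u} M₁ (u≢w ∘ sym))) (inn-dec-w {u} {w} M p)

    out-other : ∀ {x} → x ≢ u → x ≢ w → out (cancel u w M) x ≡ out M x
    out-other x≢u x≢w = trans (out-dec {w} {u} M₁ x≢w) (out-dec {u} {w} M x≢u)

    inn-other : ∀ {x} → x ≢ u → x ≢ w → inn (cancel u w M) x ≡ inn M x
    inn-other x≢u x≢w = trans (inn-dec {w} {u} M₁ x≢u) (inn-dec {u} {w} M x≢w)

    cancel-≤ : ∀ x y → cancel u w M x y ≤ M x y
    cancel-≤ x y = ≤-trans (dec-≤ w u M₁ x y) (dec-≤ u w M x y)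

    cancel-uw : cancel u w M u w ≡ M u w ∸ 1
    cancel-uw = trans (dec-row {w} {u} M₁ w u≢w) (dec-hit u w M)

  -- Rankings and backward arcs: undoing deletion, contraction and cancellation

  Injective : (Fin n → ℕ) → Set
  Injective π = ∀ {x y} → π x ≡ π y → x ≡ y

  -- For injective `π` the non-strict comparison differs from the strict one only in counting loops
  -- as backward.
  back : (Fin n → ℕ) → Graph n → ℕ
  back π M = sum (λ x → sum (λ y → when (π y ≤ᵇ π x) (M x y)))

  Good : Graph n → ℕ → Set
  Good M B = Σ (Fin n → ℕ) λ π → Injective π × back π M * 8700 ≤ B

  good-≤ : ∀ {M B B'} → B ≤ B' → Good M B → Good M B'
  good-≤ p (π , inj , h) = π , inj , ≤-trans h p

  good-mono : ∀ {M N B} → (∀ x y → M x y ≤ N x y) → Good N B → Good M B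
  good-mono p (π , inj , h) = π , inj , ≤-trans
    (*-monoˡ-≤ 8700 (sum-mono (λ x → sum-mono (λ y → when-mono (π y ≤ᵇ π x) (p x y))))) h

  -- Ranks are subtracted from `sum π`, which bounds every rank, so truncated subtraction stays
  -- injective and reverses the order.
  good-rev : ∀ {M B} → Good M B → Good (rev M) B
  good-rev {M} (π , inj , h) = π' , inj' , ≤-trans (*-monoˡ-≤ 8700 le) h
    where
    π' : Fin n → ℕ
    π' x = sum π ∸ π x
    inj' : Injective π'
    inj' {x} {y} e = inj (∸-cancelˡ-≡ (term≤sum π x) (term≤sum π y) e)
    flip≤ : ∀ x y → T (π' y ≤ᵇ π' x) → T (π x ≤ᵇ π y)
    flip≤ x y t = ≤⇒≤ᵇ (≮⇒≥ (λ πy<πx →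
      <⇒≱ (∸-monoʳ-< πy<πx (term≤sum π x)) (≤ᵇ⇒≤ (π' y) (π' x) t)))
    le : back π' (rev M) ≤ back π M
    le = ≤-trans
      (sum-mono (λ x → sum-mono (λ y → when-imp (M y x) (flip≤ x y))))
      (≤-reflexive (∑-comm (λ x y → when (π x ≤ᵇ π y) (M y x))))

  -- `v` takes rank 0 and all other ranks move up by one, so of the arcs at `v` only those entering
  -- it go back.
  good-del-in : ∀ {v M B} → Good (del v M) B → Good M (B + inn M v * 8700)
  good-del-in {v} {M} (π , inj , h) = π' , inj' , ≤-trans (*-monoˡ-≤ 8700 le)
    (≤-trans (≤-reflexive (*-distribʳ-+ 8700 (back π (del v M)) (inn M v))) (+-monoˡ-≤ _ h))
    where
    π' : Fin n → ℕ
    π' = except v (λ x → suc (π x))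
    inj' : Injective π'
    inj' {x} {y} e with x ≟ v | y ≟ v
    ... | yes refl | yes refl = refl
    ... | no _ | no _ = inj (cong pred e)
    entry : ∀ x y → when (π' y ≤ᵇ π' x) (M x y) ≤ when (π y ≤ᵇ π x) (del v M x y) + δ v (M x v) y
    entry x y with y ≟ v
    ... | yes refl = ≤-trans (when-≤ _ (M x y)) (m≤n+m _ _)
    ... | no _ with x ≟ v
    ...   | yes refl = z≤n
    ...   | no _ = ≤-trans (when-imp {suc (π y) ≤ᵇ suc (π x)} {π y ≤ᵇ π x} (M x y) (λ t → ≤⇒≤ᵇ (s≤s⁻¹ (≤ᵇ⇒≤ (suc (π y)) (suc (π x)) t)))) (m≤m+n _ _)
    le : back π' M ≤ back π (del v M) + inn M v
    le = ≤-trans (sum-mono (λ x → ≤-trans (sum-mono (entry x)) (≤-reflexive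
           (trans (∑-distrib-+ (λ y → when (π y ≤ᵇ π x) (del v M x y)) (δ v (M x v)))
                  (cong (sum (λ y → when (π y ≤ᵇ π x) (del v M x y)) +_) (sum-δ v (M x v)))))))
         (≤-reflexive (∑-distrib-+ (λ x → sum (λ y → when (π y ≤ᵇ π x) (del v M x y))) (λ x → M x v)))

  good-del-out : ∀ {v M B} → Good (del v M) B → Good M (B + out M v * 8700)
  good-del-out {v} {M} g = good-rev (good-del-in {v} {rev M} (good-mono swap≤ (good-rev g)))
    where
    swap≤ : ∀ x y → del v (rev M) x y ≤ rev (del v M) x y
    swap≤ x y with x ≟ v | y ≟ v
    ... | yes _ | _     = z≤n
    ... | no _  | yes _ = z≤n
    ... | no _  | no _  = ≤-refl

  good-del : ∀ {v M B} → Good (del v M) B → Good M (B + (out M v ⊓ inn M v) * 8700)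
  good-del {v} {M} {B} g with ≤-total (out M v) (inn M v)
  ... | inj₁ p = subst (λ k → Good M (B + k * 8700)) (sym (m≤n⇒m⊓n≡m p)) (good-del-out g)
  ... | inj₂ p = subst (λ k → Good M (B + k * 8700)) (sym (m≥n⇒m⊓n≡n p)) (good-del-in g)

  -- The contracted vertex v is placed immediately after u.
  good-contract : ∀ {u v M B} → u ≢ v → (∀ x → x ≢ u → M x v ≡ 0) →
                  Good (contract u v M) B → Good M B
  good-contract {u} {v} {M} u≢v only-u (π , inj , h) = π' , inj' , ≤-trans (*-monoˡ-≤ 8700 le) h
    where
    π' : Fin n → ℕ
    -- Doubling frees the odd ranks, one of which is given to `v`.
    π' x = except v (λ x → π x + π x) x + δ v (suc (π u + π u)) x
    π'-v : π' v ≡ suc (π u + π u)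
    π'-v = cong₂ _+_ (except-same v (λ x → π x + π x)) (δ-same v (suc (π u + π u)))
    π'-x : ∀ {x} → x ≢ v → π' x ≡ π x + π x
    π'-x p = trans (cong₂ _+_ (except-diff (λ x → π x + π x) p) (δ-diff (suc (π u + π u)) p)) (+-identityʳ _)
    double-≤ : ∀ k l → k + k ≤ suc (l + l) → k ≤ l
    double-≤ zero    l p = z≤n
    double-≤ (suc k) zero (s≤s p) rewrite +-suc k k with () ← p
    double-≤ (suc k) (suc l) (s≤s p) rewrite +-suc k k | +-suc l l = s≤s (double-≤ k l (s≤s⁻¹ p))
    double-≢ : ∀ k l → k + k ≢ suc (l + l)
    double-≢ (suc k) zero e rewrite +-suc k k with () ← e
    double-≢ (suc k) (suc l) e rewrite +-suc k k | +-suc l l = double-≢ k l (cong (pred ∘ pred) e)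
    inj' : Injective π'
    inj' {x} {y} e with x ≟ v | y ≟ v
    ... | yes refl | yes refl = refl
    ... | yes refl | no q = ⊥-elim (double-≢ (π y) (π u) (sym (trans e (+-identityʳ _))))
    ... | no p | yes refl = ⊥-elim (double-≢ (π x) (π u) (trans (sym (+-identityʳ _)) e))
    ... | no p | no q = inj (≤-antisym (half (π x) (π y) e') (half (π y) (π x) (sym e')))
      where
      e' : π x + π x ≡ π y + π y
      e' = trans (sym (+-identityʳ _)) (trans e (+-identityʳ _))
      half : ∀ k l → k + k ≡ l + l → k ≤ l
      half k l e = double-≤ k l (≤-trans (≤-reflexive e) (n≤1+n _))
    row row' : Fin n → ℕ
    row  x = sum (λ y → when (π' y ≤ᵇ π' x) (M x y))
    row' x = sum (λ y → when (π y ≤ᵇ π x) (contract u v M x y))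
    R : ℕ
    R = sum (λ y → when (π y ≤ᵇ π u) (M v y))
    row-v : row v ≤ R
    row-v = sum-mono entry
      where
      entry : ∀ y → when (π' y ≤ᵇ π' v) (M v y) ≤ when (π y ≤ᵇ π u) (M v y)
      entry y = by (y ≟ v)
        where
        by : Dec (y ≡ v) → when (π' y ≤ᵇ π' v) (M v y) ≤ when (π y ≤ᵇ π u) (M v y)
        by (yes refl) rewrite only-u v (u≢v ∘ sym) = ≤-trans (when-≤ _ 0) z≤n
        by (no p) = when-imp (M v y) (λ t → ≤⇒≤ᵇ (double-≤ (π y) (π u)
          (subst₂ _≤_ (π'-x p) π'-v (≤ᵇ⇒≤ _ _ t))))
    plain : ∀ x → x ≢ v → ∀ y → when (π' y ≤ᵇ π' x) (M x y) ≤ when (π y ≤ᵇ π x) (del v M x y)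
    plain x p y = by (y ≟ v)
      where
      by : Dec (y ≡ v) → when (π' y ≤ᵇ π' x) (M x y) ≤ when (π y ≤ᵇ π x) (del v M x y)
      by (no q) rewrite del-off M p q = when-imp (M x y) (λ t → ≤⇒≤ᵇ (double-≤ (π y) (π x)
          (≤-trans (subst₂ _≤_ (π'-x q) (π'-x p) (≤ᵇ⇒≤ _ _ t)) (n≤1+n _))))
      by (yes refl) with x ≟ u
      ... | no x≢u rewrite only-u x x≢u = ≤-trans (when-≤ _ 0) z≤n
      ... | yes refl = ≤-trans (when-imp {c = false} (M x y)
              (λ t → 1+n≰n (subst₂ _≤_ π'-v (π'-x p) (≤ᵇ⇒≤ _ _ t)))) z≤n
    rows : ∀ x → except v row x + δ u R x ≤ row' x
    rows x = by (x ≟ v) (x ≟ u)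
      where
      merge : ∀ b y → when b (del v M x y) + when b (M v y) ≤ when b (del v M x y + M v y)
      merge false y = z≤n
      merge true  y = ≤-refl
      by : Dec (x ≡ v) → Dec (x ≡ u) → except v row x + δ u R x ≤ row' x
      by (yes refl) _ = subst₂ (λ k l → k + l ≤ row' x)
        (sym (except-same v row)) (sym (δ-diff R (u≢v ∘ sym))) z≤n
      by (no p) (no q) = subst₂ (λ k l → k + l ≤ row' x)
        (sym (except-diff row p)) (sym (δ-diff R q)) (≤-trans (≤-reflexive (+-identityʳ _))
          (sum-mono (λ y → ≤-trans (plain x p y) (when-mono (π y ≤ᵇ π x) (m≤m+n _ _)))))
      by (no p) (yes refl) = subst₂ (λ k l → k + l ≤ row' x)
        (sym (except-diff row p)) (sym (δ-same u R)) (≤-trans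
          (≤-reflexive (sym (∑-distrib-+ (λ y → when (π' y ≤ᵇ π' x) (M x y)) (λ y → when (π y ≤ᵇ π x) (M v y)))))
          (sum-mono (λ y → ≤-trans (+-monoˡ-≤ _ (plain x p y)) (≤-trans (merge (π y ≤ᵇ π x) y)
            (≤-reflexive (cong (λ k → when (π y ≤ᵇ π x) (del v M x y + k)) (sym (δ-same u (M v y)))))))))
    le : back π' M ≤ back π (contract u v M)
    le = begin
      sum row                          ≡⟨ sum-except row v ⟨
      sum (except v row) + row v       ≤⟨ +-monoʳ-≤ _ row-v ⟩
      sum (except v row) + R           ≡⟨ cong (sum (except v row) +_) (sum-δ u R) ⟨
      sum (except v row) + sum (δ u R) ≡⟨ ∑-distrib-+ (except v row) (δ u R) ⟨
      sum (λ x → except v row x + δ u R x) ≤⟨ sum-mono rows ⟩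
      sum row'                         ∎
      where open ≤-Reasoning

  sum-single : ∀ (β : Fin n → Fin n → Bool) a b →
               sum (λ x → sum (λ y → when (β x y) (single a b x y))) ≡ when (β a b) 1
  sum-single β a b = trans (sum-cong-≗ row) (sum-δ a (when (β a b) 1))
    where
    when-0 : ∀ b → when b 0 ≡ 0
    when-0 true  = refl
    when-0 false = refl
    entry : ∀ y → when (β a y) (δ b 1 y) ≡ δ b (when (β a b) 1) y
    entry y with y ≟ b
    ... | yes refl = refl
    ... | no _     = when-0 (β a y)
    row : ∀ x → sum (λ y → when (β x y) (single a b x y)) ≡ δ a (when (β a b) 1) x
    row x with x ≟ a
    ... | yes refl = trans (sum-cong-≗ entry) (sum-δ b (when (β a b) 1))
    ... | no _     = sum-zero (λ y → when-0 (β x y))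

  -- Exactly one arc of a 2-cycle goes back in an injective ranking.
  good-cancel : ∀ {u w M B} → u ≢ w → Good (cancel u w M) B → Good M (B + 8700)
  good-cancel {u} {w} {M} {B} u≢w (π , inj , h) = π , inj , ≤-trans (*-monoˡ-≤ 8700 le)
    (≤-trans (≤-reflexive (*-distribʳ-+ 8700 (back π (cancel u w M)) 1)) (+-monoˡ-≤ 8700 h))
    where
    E : Fin n → Fin n → Fin n → Fin n → ℕ
    E = single
    β : Fin n → Fin n → Bool
    β x y = π y ≤ᵇ π x
    split : ∀ b k e f → when b k ≤ when b (k ∸ e ∸ f) + (when b e + when b f)
    split false k e f = z≤n
    split true  k e f = ≤-trans (m≤n+m∸n k (e + f)) (≤-reflexive
      (trans (cong (e + f +_) (sym (∸-+-assoc k e f))) (+-comm (e + f) _)))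
    one : when (β u w) 1 + when (β w u) 1 ≤ 1
    one with π w ≤ᵇ π u in p | π u ≤ᵇ π w in q
    ... | false | false = z≤n
    ... | false | true  = ≤-refl
    ... | true  | false = ≤-refl
    ... | true  | true  = ⊥-elim (u≢w (inj (≤-antisym
            (≤ᵇ⇒≤ _ _ (subst T (sym q) _)) (≤ᵇ⇒≤ _ _ (subst T (sym p) _)))))
    le : back π M ≤ back π (cancel u w M) + 1
    le = begin
      back π M
        ≤⟨ sum-mono (λ x → sum-mono (λ y → split (β x y) (M x y) (E u w x y) (E w u x y))) ⟩
      sum (λ x → sum (λ y → C x y + (W u w x y + W w u x y)))
        ≡⟨ sum-cong-≗ (λ x → trans (∑-distrib-+ (C x) _) (cong (sum (C x) +_) (∑-distrib-+ (W u w x) (W w u x)))) ⟩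
      sum (λ x → sum (C x) + (sum (W u w x) + sum (W w u x)))
        ≡⟨ trans (∑-distrib-+ (λ x → sum (C x)) _)
             (cong (back π (cancel u w M) +_) (∑-distrib-+ (λ x → sum (W u w x)) (λ x → sum (W w u x)))) ⟩
      back π (cancel u w M) + (sum (λ x → sum (W u w x)) + sum (λ x → sum (W w u x)))
        ≡⟨ cong (back π (cancel u w M) +_) (cong₂ _+_ (sum-single β u w) (sum-single β w u)) ⟩
      back π (cancel u w M) + (when (β u w) 1 + when (β w u) 1)
        ≤⟨ +-monoʳ-≤ _ one ⟩
      back π (cancel u w M) + 1 ∎
      where
      open ≤-Reasoning
      C : Fin n → Fin n → ℕ
      C x y = when (β x y) (cancel u w M x y)
      W : Fin n → Fin n → Fin n → Fin n → ℕ
      W a b x y = when (β x y) (E a b x y)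

-- Weight bookkeeping and the contraction of a vertex with a single in-arc

sum-strict : ∀ {n} {f g : Fin n → ℕ} → (∀ x → f x ≤ g x) → ∀ x → f x < g x → sum f < sum g
sum-strict h zero    p = +-mono-<-≤ p (sum-mono (h ∘ suc))
sum-strict h (suc x) p = +-mono-≤-< (h zero) (sum-strict (h ∘ suc) x p)

module _ {n : ℕ} where

  Gains : (f g : Fin n → ℕ) → List (Fin n × ℕ) → Set
  Gains f g []            = ⊤
  Gains f g ((u , c) ∷ L) = f u + c ≤ g u × All (λ p → proj₁ p ≢ u) L × Gains f g L

  total : List (Fin n × ℕ) → ℕ
  total []            = 0
  total ((u , c) ∷ L) = total L + c

  -- Each credit is absorbed into `f` as a spike `δ u c`. Since no vertex occurs twice in `L`, the
  -- remaining credits are unaffected by the spike.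
  gains : ∀ {f g} L → (∀ x → f x ≤ g x) → Gains f g L → sum f + total L ≤ sum g
  gains {f} [] f≤g _ = ≤-trans (≤-reflexive (+-identityʳ (sum f))) (sum-mono f≤g)
  gains {f} {g} ((u , c) ∷ L) f≤g (p , fresh , rest) = begin
    sum f + (total L + c)                   ≡⟨ cong (sum f +_) (+-comm (total L) c) ⟩
    sum f + (c + total L)                   ≡⟨ +-assoc (sum f) c _ ⟨
    sum f + c + total L                     ≡⟨ cong (λ k → sum f + k + total L) (sum-δ u c) ⟨
    sum f + sum (δ u c) + total L           ≡⟨ cong (_+ total L) (∑-distrib-+ f (δ u c)) ⟨
    sum f' + total L                        ≤⟨ gains L f'≤g (shift L fresh rest) ⟩
    sum g                                   ∎
    where
    open ≤-Reasoning
    f' : Fin n → ℕ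
    f' x = f x + δ u c x
    f'≤g : ∀ x → f' x ≤ g x
    f'≤g x with x ≟ u
    ... | yes refl = p
    ... | no _     = ≤-trans (≤-reflexive (+-identityʳ _)) (f≤g x)
    shift : ∀ L → All (λ p → proj₁ p ≢ u) L → Gains f g L → Gains f' g L
    shift [] _ _ = tt
    shift ((w , d) ∷ L) (w≢u ∷ fr) (q , fr' , r) =
      ≤-trans (≤-reflexive (cong (λ k → k + d) (trans (cong (f w +_) (δ-diff c w≢u)) (+-identityʳ _)))) q
      , fr' , shift L fr r

  -- The case x = y of `oriented` also excludes loops.
  record State (M : Graph n) : Set where
    field
      oriented : ∀ {x y} → 1 ≤ M x y → M y x ≡ 0
      thin     : ∀ x → Thin (out M x) (inn M x)

    oriented′ : ∀ {x y} → M x y ≡ 1 → M y x ≡ 0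
    oriented′ e = oriented (≤-reflexive (sym e))

    loopless : ∀ x → M x x ≡ 0
    loopless x with M x x in e
    ... | zero  = refl
    ... | suc k = trans (sym e) (oriented (subst (1 ≤_) (sym e) (s≤s z≤n)))

    arc-≢ : ∀ {x y} → 1 ≤ M x y → x ≢ y
    arc-≢ {x} p refl with () ← subst (1 ≤_) (loopless x) p

  open State

  state-mono : ∀ {M N} → (∀ x y → N x y ≤ M x y) → State M → State N
  state-mono p s .oriented {x} {y} q = n≤0⇒n≡0 (≤-trans (p y x) (≤-reflexive (oriented s (≤-trans q (p x y)))))
  state-mono p s .thin x = thin-mono (sum-mono (p x)) (sum-mono (λ y → p y x)) (thin s x)

  state-rev : ∀ {M} → State M → State (rev M)
  state-rev s .oriented = oriented s
  state-rev s .thin x   = thin-sym (thin s x)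

  state-del : ∀ {M} v → State M → State (del v M)
  state-del {M} v = state-mono (del-≤ v M)

  ω : Graph n → Fin n → ℕ
  ω M x = φ (out M x) (inn M x)

  ω-mono : ∀ {M N} → State M → (∀ x y → N x y ≤ M x y) → ∀ x → ω N x ≤ ω M x
  ω-mono s p x = φ-mono (thin s x) (sum-mono (p x)) (sum-mono (λ y → p y x))

  Φ-rev : ∀ (M : Graph n) → Φ (rev M) ≡ Φ M
  Φ-rev M = sum-cong-≗ (λ x → φ-sym (inn M x) (out M x))

  size-rev : ∀ (M : Graph n) → size (rev M) ≡ size M
  size-rev M = ∑-comm (λ x y → M y x)

  size-< : ∀ {M N : Graph n} → (∀ x y → N x y ≤ M x y) → ∀ x y → N x y < M x y → size N < size M
  size-< p x y q = sum-strict (λ x → sum-mono (p x)) x (sum-strict (p x) y q)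

  size-del : ∀ {M v} x → 1 ≤ M x v → size (del v M) < size M
  size-del {M} {v} x p = size-< (del-≤ v M) x v (subst (_< M x v) (sym (del-col {v = v} M x)) p)

  size-del′ : ∀ {M v} y → 1 ≤ M v y → size (del v M) < size M
  size-del′ {M} {v} y p = size-< (del-≤ v M) v y (subst (_< M v y) (sym (del-row {v = v} M y)) p)

  out-pos : ∀ {M : Graph n} {x y} → 1 ≤ M x y → 1 ≤ out M x
  out-pos {M} {x} {y} p = ≤-trans p (term≤sum (M x) y)

  inn-pos : ∀ {M : Graph n} {x y} → 1 ≤ M x y → 1 ≤ inn M y
  inn-pos {M} {x} {y} p = ≤-trans p (term≤sum (λ z → M z y) x)

  module Contract {M : Graph n} (s : State M) {u v} (uv : M u v ≡ 1)
                  (only-u : ∀ x → x ≢ u → M x v ≡ 0) where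

    C : Graph n
    C = contract u v M

    u≢v : u ≢ v
    u≢v = arc-≢ s (≤-reflexive (sym uv))

    vu : M v u ≡ 0
    vu = oriented′ s uv

    innv : inn M v ≡ 1
    innv = trans (sym (sum-except (λ x → M x v) u)) (cong₂ _+_ (sum-zero lem) uv)
      where
      lem : ∀ x → except u (λ x → M x v) x ≡ 0
      lem x with x ≟ u
      ... | yes _ = refl
      ... | no p  = only-u x p

    out-u : out C u + 1 ≡ out M u + out M v
    out-u = trans (cong (out C u +_) (sym uv)) (out-contract-u M u≢v)

    out-v : out C v ≡ 0
    out-v = trans (out-contract {u = u} {v = v} M (u≢v ∘ sym)) (out-del-self v M)

    out-x : ∀ {x} → x ≢ u → x ≢ v → out C x ≡ out M x
    out-x {x} p q = trans (out-contract {u = u} {v = v} M p) (trans (sym (+-identityʳ _))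
      (trans (cong (out (del v M) x +_) (sym (only-u x p))) (out-del M q)))

    inn-x : ∀ {x} → x ≢ v → inn C x ≡ inn M x
    inn-x {x} q = trans (inn-contract u x M) (inn-del M q)

    ω-v : ω C v ≡ 0
    ω-v = trans (cong (λ k → φ k (inn C v)) out-v) (φ-0ˡ _)

    -- The out-arcs of `v` only change their source to `u`, and the arc from `u` to `v` disappears.
    size-C : size C < size M
    size-C = begin-strict
      sum (out C)                                ≤⟨ sum-mono lem ⟩
      sum (λ x → (out (del v M) x) + δ u (out M v) x) ≡⟨ ∑-distrib-+ (out (del v M)) (δ u (out M v)) ⟩
      size (del v M) + sum (δ u (out M v))       ≡⟨ cong (size (del v M) +_) (sum-δ u (out M v)) ⟩
      size (del v M) + out M v                   <⟨ n<1+n _ ⟩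
      1 + (size (del v M) + out M v)             ≡⟨ +-comm 1 _ ⟩
      size (del v M) + out M v + 1               ≡⟨ +-assoc (size (del v M)) _ 1 ⟩
      size (del v M) + (out M v + 1)             ≡⟨ cong₂ (λ k l → size (del v M) + (k + l)) (sum-δ v (out M v)) (sum-δ u 1) ⟨
      size (del v M) + (sum (δ v (out M v)) + sum (δ u 1)) ≡⟨ cong (size (del v M) +_) (∑-distrib-+ (δ v (out M v)) (δ u 1)) ⟨
      size (del v M) + sum (λ x → δ v (out M v) x + δ u 1 x) ≡⟨ ∑-distrib-+ (out (del v M)) _ ⟨
      sum (λ x → out (del v M) x + (δ v (out M v) x + δ u 1 x)) ≤⟨ sum-mono (λ x → lem₂ x (x ≟ v) (x ≟ u)) ⟩
      sum (out M)                                ∎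
      where
      open ≤-Reasoning
      lem : ∀ x → out C x ≤ out (del v M) x + δ u (out M v) x
      lem x = ≤-reflexive (trans (∑-distrib-+ (del v M x) (λ y → δ u (M v y) x)) (cong (out (del v M) x +_) (inner (x ≟ u))))
        where
        inner : Dec (x ≡ u) → sum (λ y → δ u (M v y) x) ≡ δ u (out M v) x
        inner (yes refl) = trans (sum-cong-≗ (λ y → δ-same u (M v y))) (sym (δ-same u (out M v)))
        inner (no p) = trans (sum-zero (λ y → δ-diff (M v y) p)) (sym (δ-diff (out M v) p))
      lem₂ : ∀ x → Dec (x ≡ v) → Dec (x ≡ u) → out (del v M) x + (δ v (out M v) x + δ u 1 x) ≤ out M x
      lem₂ x (yes refl) _ = ≤-reflexive (cong₂ _+_ (out-del-self v M)
        (trans (cong₂ _+_ (δ-same v (out M v)) (δ-diff 1 (u≢v ∘ sym))) (+-identityʳ _)))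
      lem₂ x (no p) (yes refl) = ≤-reflexive (trans (cong (out (del v M) x +_)
        (trans (cong₂ _+_ (δ-diff (out M v) p) (δ-same u 1)) (sym uv))) (out-del M p))
      lem₂ x (no p) (no q) = ≤-trans (≤-reflexive (trans (cong (out (del v M) x +_)
        (cong₂ _+_ (δ-diff (out M v) p) (δ-diff 1 q))) (+-identityʳ _))) (sum-mono (del-≤ v M x))

    -- A 2-cycle u ⇄ y of C comes from a triangle u → v → y → u of M.
    orient : ∀ {P : Fin n → Set} → (∀ y → 1 ≤ M v y → P y ⊎ M y u ≡ 0) →
             ∀ {x y} → 1 ≤ C x y → (x ≡ u × P y) ⊎ (y ≡ u × P x) ⊎ C y x ≡ 0
    orient {P} tri {x} {y} h = split (x ≟ v) (y ≟ v) (x ≟ u) (y ≟ u)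
      where
      entry : ∀ {x y} → x ≢ u → C x y ≡ del v M x y
      entry {x} {y} p = contract-off {u = u} {v = v} M y p
      pos : ∀ k → 1 ≤ k ⊎ k ≡ 0
      pos zero    = inj₂ refl
      pos (suc k) = inj₁ (s≤s z≤n)
      Goal : Set
      Goal = (x ≡ u × P y) ⊎ (y ≡ u × P x) ⊎ C y x ≡ 0
      split : Dec (x ≡ v) → Dec (y ≡ v) → Dec (x ≡ u) → Dec (y ≡ u) → Goal
      split (yes refl) _ _ _ with () ← subst (1 ≤_) (trans (entry (u≢v ∘ sym)) (del-row {v = v} M y)) h
      split (no p) (yes refl) (yes refl) _
        with () ← subst (1 ≤_) (cong₂ _+_ (del-col {v = v} M u) (trans (δ-same u (M v v)) (loopless s v))) h
      split (no p) (yes refl) (no q) _ with () ← subst (1 ≤_) (trans (entry q) (del-col {v = v} M x)) h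
      split (no p) (no q) (yes refl) (yes refl)
        with () ← subst (1 ≤_) (trans (contract-u M u≢v p) (cong₂ _+_ (loopless s u) vu)) h
      split (no p) (no q) (yes refl) (no y≢u) with pos (M u y) | pos (M v y)
      ... | inj₁ uy | _ = inj₂ (inj₂ (trans (entry y≢u) (trans (del-off M q p) (oriented s uy))))
      ... | inj₂ uy | inj₂ vy with () ← subst (1 ≤_) (trans (contract-u M u≢v q) (cong₂ _+_ uy vy)) h
      split (no p) (no q) (yes refl) (no y≢u) | inj₂ uy | inj₁ vy with tri y vy
      ... | inj₁ py = inj₁ (refl , py)
      ... | inj₂ yu = inj₂ (inj₂ (trans (entry y≢u) (trans (del-off M q p) yu)))
      split (no p) (no q) (no x≢u) (no y≢u) = inj₂ (inj₂ (trans (entry y≢u) (trans (del-off M q p)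
        (oriented s (subst (1 ≤_) (trans (entry x≢u) (del-off M p q)) h)))))
      split (no p) (no q) (no x≢u) (yes refl) with pos (M v x) | subst (1 ≤_) (trans (entry x≢u) (del-off M p q)) h
      ... | inj₂ vx | xu = inj₂ (inj₂ (trans (contract-u M u≢v p) (cong₂ _+_ (oriented s xu) vx)))
      ... | inj₁ vx | xu with tri x vx
      ...   | inj₁ px = inj₂ (inj₁ (refl , px))
      ...   | inj₂ xu≡0 with () ← subst (1 ≤_) xu≡0 xu

    good-C : ∀ {B} → Good C B → Good M B
    good-C = good-contract u≢v only-u

    module NoTriangle (tri : ∀ y → 1 ≤ M v y → M y u ≡ 0) (thin-u : Thin (out C u) (inn M u)) where

      state-C : State C
      state-C .oriented {x} {y} h with orient {λ _ → ⊥} (λ y p → inj₂ (tri y p)) {x} {y} h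
      ... | inj₂ (inj₂ e) = e
      state-C .thin x = by (x ≟ v) (x ≟ u)
        where
        by : Dec (x ≡ v) → Dec (x ≡ u) → Thin (out C x) (inn C x)
        by (yes refl) _ = inj₁ (≤-trans (≤-reflexive out-v) z≤n)
        by (no p) (yes refl) = subst (Thin (out C u)) (sym (inn-x u≢v)) thin-u
        by (no p) (no q) = subst₂ Thin (sym (out-x q p)) (sym (inn-x p)) (thin s x)

    module Triangle {w} (vw : M v w ≡ 1) (wu : 1 ≤ M w u)
                    (tri : ∀ y → y ≢ w → 1 ≤ M v y → M y u ≡ 0) where

      u≢w : u ≢ w
      u≢w = arc-≢ s wu ∘ sym

      v≢w : v ≢ w
      v≢w = arc-≢ s (≤-reflexive (sym vw))

      -- The triangle excludes arcs from `u` to `w` in `M`, so the contraction creates exactly one.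
      -- Hence a single cancellation, at cost 1, removes every 2-cycle on `u` and `w`.
      C-uw : C u w ≡ 1
      C-uw = trans (contract-u M u≢v (v≢w ∘ sym)) (cong₂ _+_ (oriented s wu) vw)

      C-wu : C w u ≡ M w u
      C-wu = trans (contract-off {u = u} {v = v} M u (u≢w ∘ sym)) (del-off M (v≢w ∘ sym) u≢v)

      open Cancel C u≢w (≤-reflexive (sym C-uw)) (subst (1 ≤_) (sym C-wu) wu) public
        using (cancel-≤; cancel-uw)
        renaming (out-u to out-u′; inn-u to inn-u′; out-w to out-w′; inn-w to inn-w′;
                  out-other to out-o; inn-other to inn-o)

      K : Graph n
      K = cancel u w C

      K-out-u : out K u + 2 ≡ out M u + out M v
      K-out-u = trans (sym (+-assoc (out K u) 1 1)) (trans (cong (_+ 1) out-u′) out-u)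

      K-inn-u : inn K u + 1 ≡ inn M u
      K-inn-u = trans inn-u′ (inn-x u≢v)

      K-out-w : out K w + 1 ≡ out M w
      K-out-w = trans out-w′ (out-x (u≢w ∘ sym) (v≢w ∘ sym))

      K-inn-w : inn K w + 1 ≡ inn M w
      K-inn-w = trans inn-w′ (inn-x (v≢w ∘ sym))

      K-out : ∀ {x} → x ≢ u → x ≢ v → x ≢ w → out K x ≡ out M x
      K-out p q r = trans (out-o p r) (out-x p q)

      K-inn : ∀ {x} → x ≢ u → x ≢ v → x ≢ w → inn K x ≡ inn M x
      K-inn p q r = trans (inn-o p r) (inn-x q)

      ω-K-v : ω K v ≡ 0
      ω-K-v = trans (cong (λ k → φ k (inn K v)) (trans (out-o (u≢v ∘ sym) v≢w) out-v)) (φ-0ˡ _)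

      size-K : size K < size M
      size-K = ≤-<-trans (sum-mono (λ x → sum-mono (cancel-≤ x))) size-C

      good-K : ∀ {B} → Good K B → Good M (B + 8700)
      good-K = good-C ∘ good-cancel u≢w

      ω-K-≤ : out K u ≤ out M u → ∀ x → ω K x ≤ ω M x
      ω-K-≤ out≤ x = by (x ≟ u) (x ≟ v) (x ≟ w)
        where
        by : Dec (x ≡ u) → Dec (x ≡ v) → Dec (x ≡ w) → ω K x ≤ ω M x
        by (yes refl) _ _ = φ-mono (thin s u) out≤ (m+n≤o⇒m≤o _ (≤-reflexive K-inn-u))
        by (no _) (yes refl) _ = ≤-trans (≤-reflexive ω-K-v) z≤n
        by (no _) (no _) (yes refl) = φ-mono (thin s w)
          (m+n≤o⇒m≤o _ (≤-reflexive K-out-w)) (m+n≤o⇒m≤o _ (≤-reflexive K-inn-w))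
        by (no p) (no q) (no r) = φ-mono (thin s x) (≤-reflexive (K-out p q r)) (≤-reflexive (K-inn p q r))

      -- By `orient`, 2-cycles of `C` can occur only between `u` and `w`, and the cancellation
      -- leaves no arc from `u` to `w`.
      state-K : out K u ≤ out M u → State K
      state-K out≤ .thin x = by (x ≟ u) (x ≟ v) (x ≟ w)
        where
        by : Dec (x ≡ u) → Dec (x ≡ v) → Dec (x ≡ w) → Thin (out K x) (inn K x)
        by (yes refl) _ _ = thin-mono out≤ (m+n≤o⇒m≤o _ (≤-reflexive K-inn-u)) (thin s u)
        by (no p) (yes refl) _ = inj₁ (≤-trans (≤-reflexive (trans (out-o p v≢w) out-v)) z≤n)
        by (no _) (no _) (yes refl) = thin-mono
          (m+n≤o⇒m≤o _ (≤-reflexive K-out-w)) (m+n≤o⇒m≤o _ (≤-reflexive K-inn-w)) (thin s w)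
        by (no p) (no q) (no r) = thin-mono (≤-reflexive (K-out p q r)) (≤-reflexive (K-inn p q r)) (thin s x)
      state-K out≤ .oriented {x} {y} h = finish (orient {_≡ w} tri′ {x} {y} (≤-trans h (cancel-≤ x y)))
        where
        tri′ : ∀ y → 1 ≤ M v y → y ≡ w ⊎ M y u ≡ 0
        tri′ y p with y ≟ w
        ... | yes q = inj₁ q
        ... | no q  = inj₂ (tri y q p)
        K-uw : K u w ≡ 0
        K-uw = trans cancel-uw (cong (_∸ 1) C-uw)
        finish : (x ≡ u × y ≡ w) ⊎ (y ≡ u × x ≡ w) ⊎ C y x ≡ 0 → K y x ≡ 0
        finish (inj₁ (refl , refl)) with () ← subst (1 ≤_) K-uw h
        finish (inj₂ (inj₁ (refl , refl))) = K-uw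
        finish (inj₂ (inj₂ e)) = n≤0⇒n≡0 (≤-trans (cancel-≤ y x) (≤-reflexive e))

-- Weight drops by class of types

weaken : ∀ {x y} c d → {_ : T (d ≤ᵇ c)} → x + c ≤ y → x + d ≤ y
weaken {x} c d {h} p = ≤-trans (+-monoʳ-≤ x (≤ᵇ⇒≤ d c h)) p

pos : ∀ k → k ≡ 0 ⊎ 1 ≤ k
pos zero    = inj₁ refl
pos (suc k) = inj₂ (s≤s z≤n)

two-terms : ∀ {n} (f : Fin n → ℕ) {u w} → u ≢ w → f u + f w ≤ sum f
two-terms f {u} {w} u≢w = begin
  f u + f w                ≡⟨ +-comm (f u) (f w) ⟩
  f w + f u                ≡⟨ cong (_+ f u) (except-diff f (u≢w ∘ sym)) ⟨
  except u f w + f u       ≤⟨ +-monoˡ-≤ (f u) (term≤sum (except u f) w) ⟩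
  sum (except u f) + f u   ≡⟨ sum-except f u ⟩
  sum f                    ∎
  where open ≤-Reasoning

<-from-+ : ∀ {a b c} → a + b ≡ c → 1 ≤ b → a < c
<-from-+ {a} refl p = ≤-trans (≤-reflexive (+-comm 1 a)) (+-monoʳ-≤ a p)

≤-from-+ : ∀ {a b c} → a + b ≡ c → a ≤ c
≤-from-+ {a} refl = m≤m+n a _

pred≤ : ∀ {a b} → a < b → ∃ λ k → b ≡ suc k × a ≤ k
pred≤ {b = suc k} (s≤s p) = k , refl , p

φ-diag : ∀ {o i o' i'} → Thin o i → o' < o → i' < i → φ o' i' + 2900 ≤ φ o i
φ-diag t p q with pred≤ p | pred≤ q
... | o , refl , p' | i , refl , q' =
  ≤-trans (+-monoˡ-≤ 2900 (φ-mono (thin-mono (n≤1+n _) (n≤1+n _) t) p' q')) (diag o i t)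

φ-diag-3214 : ∀ {o i o' i'} → Thin o i → (o ≡ 1 → i ≡ 1 → ⊥) → o' < o → i' < i → φ o' i' + 3214 ≤ φ o i
φ-diag-3214 t ne p q with pred≤ p | pred≤ q
... | o , refl , p' | i , refl , q' =
  ≤-trans (+-monoˡ-≤ 3214 (φ-mono (thin-mono (n≤1+n _) (n≤1+n _) t) p' q')) (diag-3214 o i t (lem o i ne))
  where
  lem : ∀ o i → (suc o ≡ 1 → suc i ≡ 1 → ⊥) → 1 ≤ o + i
  lem zero    zero    ne = ⊥-elim (ne refl refl)
  lem zero    (suc i) ne = s≤s z≤n
  lem (suc o) i       ne = s≤s z≤n

φ-1≥3′ : ∀ {i} → 3 ≤ i → 3729 ≤ φ 1 i
φ-1≥3′ (s≤s (s≤s (s≤s {n = i} z≤n))) = φ-1≥3 i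

φ-2≥3′ : ∀ {i} → 3 ≤ i → 7200 ≤ φ 2 i
φ-2≥3′ (s≤s (s≤s (s≤s {n = i} z≤n))) = φ-2≥3 i

φ-≥7200′ : ∀ {o} → 3 ≤ o → 7200 ≤ φ o 2
φ-≥7200′ (s≤s (s≤s (s≤s {n = o} z≤n))) = φ-≥7200 o

-- The thin types with 1 ≤ o < i, split according to the formula for their weight.
data Small : ℕ → ℕ → Set where
  ⟨1,2⟩   : Small 1 2
  ⟨1,3+_⟩ : ∀ i → Small 1 (3 + i)
  ⟨2,3+_⟩ : ∀ i → Small 2 (3 + i)

small : ∀ {o i} → Thin o i → 1 ≤ o → o < i → Small o i
small {1} {1} t p (s≤s ())
small {1} {2} t p q = ⟨1,2⟩
small {1} {suc (suc (suc i))} t p q = ⟨1,3+ i ⟩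
small {2} {suc (suc (suc i))} t p q = ⟨2,3+ i ⟩
small {2} {1} t p (s≤s ())
small {2} {2} t p (s≤s (s≤s ()))
small {suc (suc (suc o))} {suc (suc (suc i))} t p q = ¬thin t
small {suc (suc (suc o))} {suc (suc zero)} t p (s≤s (s≤s ()))
small {suc (suc (suc o))} {suc zero} t p (s≤s ())

small-out : ∀ {o i} → Small o i → o ≤ 2
small-out ⟨1,2⟩     = s≤s z≤n
small-out ⟨1,3+ i ⟩ = s≤s z≤n
small-out ⟨2,3+ i ⟩ = ≤-refl

-- Exactly the types (1 , 2), (1 , 3) and (2 , 3), the ones that resist the local moves.
Small3 : ℕ → ℕ → Set
Small3 o i = Small o i × i ≤ 3

φ-diag-3729 : ∀ {o i o' i'} → Small o i → (o ≡ 1 → i ≡ 2 → ⊥) → o' < o → i' < i → φ o' i' + 3729 ≤ φ o i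
φ-diag-3729 ⟨1,2⟩ ne p q = ⊥-elim (ne refl refl)
φ-diag-3729 ⟨1,3+ i ⟩ ne (s≤s p) (s≤s q) = ≤-trans (+-monoˡ-≤ 3729 (φ-mono (inj₁ z≤n) p q)) (diag-1≥3 i)
φ-diag-3729 ⟨2,3+ i ⟩ ne (s≤s p) (s≤s q) = weaken 3908 3729 (≤-trans
  (+-monoˡ-≤ 3908 (φ-mono (inj₁ (s≤s z≤n)) p q)) (diag-2≥3 i))

φ-diag-3292 : ∀ {o i o' i'} → Small o i → o' < o → i' < i → φ o' i' + 3292 ≤ φ o i
φ-diag-3292 {o' = zero} {i'} ⟨1,2⟩ p q = ≤-reflexive (trans (cong (_+ 3292) (φ-0ˡ i')) (sym φ-12))
φ-diag-3292 {o' = suc o'} ⟨1,2⟩ (s≤s ()) q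
φ-diag-3292 ⟨1,3+ i ⟩ p q = weaken 3729 3292 (φ-diag-3729 ⟨1,3+ i ⟩ (λ _ ()) p q)
φ-diag-3292 ⟨2,3+ i ⟩ p q = weaken 3729 3292 (φ-diag-3729 ⟨2,3+ i ⟩ (λ ()) p q)

φ-in-2822 : ∀ {o i i'} → Thin o i → (o ≡ 1 → i ≡ 1 → ⊥) → 1 ≤ i → i ≤ o → i' < i → φ o i' + 2822 ≤ φ o i
φ-in-2822 {o} {suc i} {i'} t ne p q (s≤s r) = ≤-trans
  (+-monoˡ-≤ 2822 (φ-mono (thin-mono ≤-refl (n≤1+n i) t) ≤-refl r)) (in-2822 o i (2≤o o i ne q) (i≤1 o i t q))
  where
  2≤o : ∀ o i → (o ≡ 1 → suc i ≡ 1 → ⊥) → suc i ≤ o → 2 ≤ o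
  2≤o 1 zero ne q = ⊥-elim (ne refl refl)
  2≤o 1 (suc i) ne (s≤s ())
  2≤o (suc (suc o)) i ne q = s≤s (s≤s z≤n)
  i≤1 : ∀ o i → Thin o (suc i) → suc i ≤ o → i ≤ 1
  i≤1 o i (inj₁ o≤2) q = s≤s⁻¹ (≤-trans q o≤2)
  i≤1 o i (inj₂ i≤2) q = s≤s⁻¹ i≤2

-- If i ≤ o, an in-arc is already worth 2822. If o < i, then exclusion from `Small3` gives i ≥ 4,
-- where the weight has slope 1560.
φ-in-1545 : ∀ {o i i'} → Thin o i → (o ≡ 1 → i ≡ 1 → ⊥) → 1 ≤ o → 1 ≤ i → ¬ Small3 o i → i' < i → φ o i' + 1545 ≤ φ o i
φ-in-1545 {o} {i} {i'} t ne p q ns r with o <? i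
... | no o≮i = weaken 2822 1545 (φ-in-2822 t ne q (≮⇒≥ o≮i) r)
... | yes o<i with small t p o<i | i ℕ.≤? 3
...   | sm | yes i≤3 = ⊥-elim (ns (sm , i≤3))
φ-in-1545 {o} {suc i} {i'} t ne p q ns (s≤s r) | yes o<i | sm | no i≰3 = ≤-trans
  (+-monoˡ-≤ 1545 (φ-mono (thin-mono ≤-refl (n≤1+n i) t) ≤-refl r)) (in-1545 o i p (small-out sm) (s≤s⁻¹ (≰⇒> i≰3)))

small3? : ∀ {o i} → Thin o i → 1 ≤ o → Dec (Small3 o i)
small3? {o} {i} t p with o <? i | i ℕ.≤? 3
... | yes q | yes r = yes (small t p q , r)
... | _     | no r  = no (r ∘ proj₂)
... | no q  | yes _ = no (q ∘ lem ∘ proj₁)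
  where
  lem : ∀ {o i} → Small o i → o < i
  lem ⟨1,2⟩     = ≤-refl
  lem ⟨1,3+ i ⟩ = s≤s (s≤s z≤n)
  lem ⟨2,3+ i ⟩ = s≤s (s≤s (s≤s z≤n))

-- Local moves around a vertex of type (2 , 1)

module _ {n : ℕ} where

  open State

  ω-dead : ∀ {N : Graph n} {x} → out N x ≡ 0 → ω N x ≡ 0
  ω-dead {N} {x} e = trans (cong (λ k → φ k (inn N x)) e) (φ-0ˡ _)

  dead-gain : ∀ {N M : Graph n} {x c} → out N x ≡ 0 → c ≤ ω M x → ω N x + c ≤ ω M x
  dead-gain {N} {M} {x} {c} e p = ≤-trans (≤-reflexive (cong (_+ c) (ω-dead {N} {x} e))) p

  del-≤-out : ∀ {N : Graph n} {v x} → out N x ≡ 0 → out (del v N) x ≡ 0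
  del-≤-out {N} {v} {x} e = n≤0⇒n≡0 (≤-trans (sum-mono (del-≤ v N x)) (≤-reflexive e))

  IH : Graph n → Set
  IH M = ∀ (N : Graph n) → size N < size M → State N → Good N (Φ N)

  -- The balance of one move from `M` to `N`: `c` is its cost in backward arcs, `e` the credit
  -- spread over arcs at 392 each, `L` the credit of named vertices. The function `f` holds the
  -- weights of `N` with the arc credits already added.
  settle : ∀ {M N : Graph n} {f : Fin n → ℕ} (L : List (Fin n × ℕ)) {c e} → Φ N + e ≤ sum f → sum f + total L ≤ Φ M →
           c ≤ e + total L → Good M (Φ N + c) → Good M (Φ M)
  settle {M} {N} {f} L {c} {e} p q r = good-≤ {M = M} (begin
    Φ N + c             ≤⟨ +-monoʳ-≤ (Φ N) r ⟩
    Φ N + (e + total L) ≡⟨ +-assoc (Φ N) e _ ⟨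
    Φ N + e + total L   ≤⟨ +-monoˡ-≤ (total L) p ⟩
    sum f + total L     ≤⟨ q ⟩
    Φ M                 ∎)
    where open ≤-Reasoning

  -- Contraction followed by cancellation keeps the out-degree of `u`, which gains two arcs and
  -- loses two, and takes one in-arc from it. The gains 2822 + 3292 + 2900 = 9014 exceed the cost
  -- 8700.
  single-triangle : ∀ {M : Graph n} (s : State M) → IH M → ∀ {u v} (uv : M u v ≡ 1)
    (only-u : ∀ x → x ≢ u → M x v ≡ 0) → out M v ≡ 2 → 2 ≤ out M u → inn M u ≤ 2 →
    ∀ {w} (vw : M v w ≡ 1) (wu : 1 ≤ M w u) → (∀ y → y ≢ w → 1 ≤ M v y → M y u ≡ 0) → Good M (Φ M)
  single-triangle {M} s ih {u} {v} uv only-u ov 2≤o i≤2 {w} vw wu tri =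
    settle {M} {K} {ω K} L (≤-reflexive (+-identityʳ (Φ K)))
      (gains L (ω-K-≤ (≤-reflexive out-eq)) (gu , ((u≢v ∘ sym) ∷ (u≢w ∘ sym) ∷ []) , gv , ((v≢w ∘ sym) ∷ []) , gw , [] , tt))
      num≤ (good-K (ih K size-K (state-K (≤-reflexive out-eq))))
    where
    open Contract s uv only-u
    open Triangle vw wu tri
    L : List (Fin n × ℕ)
    L = (u , 2822) ∷ (v , 3292) ∷ (w , 2900) ∷ []
    out-eq : out K u ≡ out M u
    out-eq = +-cancelʳ-≡ 2 _ _ (trans K-out-u (cong (out M u +_) ov))
    gu : ω K u + 2822 ≤ ω M u
    gu rewrite out-eq | sym K-inn-u | +-comm (inn K u) 1 = in-2822 (out M u) (inn K u) 2≤o (s≤s⁻¹ i≤2)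
    gv : ω K v + 3292 ≤ ω M v
    gv rewrite ω-K-v | ov | innv | φ-21 = ≤-refl
    gw : ω K w + 2900 ≤ ω M w
    gw = φ-diag (thin s w) (<-from-+ K-out-w ≤-refl) (<-from-+ K-inn-w ≤-refl)

  module Kill {M : Graph n} (s : State M) {u v} (uv : M u v ≡ 1) (iv : inn M v ≡ 1) where

    u≢v : u ≢ v
    u≢v = arc-≢ s (≤-reflexive (sym uv))

    only-u : ∀ x → x ≢ u → M x v ≡ 0
    only-u = others-zero (λ x → M x v) u (+-cancelʳ-≡ 1 _ 0
      (trans (cong (sum (except u (λ x → M x v)) +_) (sym uv)) (trans (sum-except (λ x → M x v) u) iv)))

    N : Graph n
    N = del v (del u M)

    N-≤ : ∀ x y → N x y ≤ M x y
    N-≤ x y = ≤-trans (del-≤ v (del u M) x y) (del-≤ u M x y)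

    state-N : State N
    state-N = state-mono N-≤ s

    size-N : size N < size M
    size-N = ≤-<-trans (sum-mono (λ x → sum-mono (del-≤ v (del u M) x))) (size-del′ {M = M} v (≤-reflexive (sym uv)))

    out-N-u : out N u ≡ 0
    out-N-u = del-≤-out {del u M} {v} {u} (out-del-self u M)

    out-N-v : out N v ≡ 0
    out-N-v = out-del-self v (del u M)

    out-N : ∀ {x} → x ≢ u → x ≢ v → out N x + (M x u + M x v) ≡ out M x
    out-N {x} p q = begin
      out N x + (M x u + M x v)         ≡⟨ cong (out N x +_) (+-comm (M x u) _) ⟩
      out N x + (M x v + M x u)         ≡⟨ +-assoc (out N x) _ _ ⟨
      out N x + M x v + M x u           ≡⟨ cong (λ k → out N x + k + M x u) (del-off M p (u≢v ∘ sym)) ⟨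
      out N x + del u M x v + M x u     ≡⟨ cong (_+ M x u) (out-del (del u M) q) ⟩
      out (del u M) x + M x u           ≡⟨ out-del M p ⟩
      out M x ∎
      where open ≡-Reasoning

    inn-N : ∀ {x} → x ≢ u → x ≢ v → inn N x + (M u x + M v x) ≡ inn M x
    inn-N {x} p q = begin
      inn N x + (M u x + M v x)         ≡⟨ cong (inn N x +_) (+-comm (M u x) _) ⟩
      inn N x + (M v x + M u x)         ≡⟨ +-assoc (inn N x) _ _ ⟨
      inn N x + M v x + M u x           ≡⟨ cong (λ k → inn N x + k + M u x) (del-off M (u≢v ∘ sym) p) ⟨
      inn N x + del u M v x + M u x     ≡⟨ cong (_+ M u x) (inn-del (del u M) q) ⟩
      inn (del u M) x + M u x           ≡⟨ inn-del M p ⟩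
      inn M x ∎
      where open ≡-Reasoning

    -- Only `v` is paid for, by its single in-arc. Without `v`, the vertex `u` is a sink and costs
    -- nothing.
    good-kill₁ : ∀ {B} → out M u ≡ 1 → Good N B → Good M (B + 8700)
    good-kill₁ {B} ou g = subst (λ k → Good M (B + k * 8700)) iv (good-del-in
      (subst (Good (del v M)) (trans (cong (λ k → B + k * 8700) out0) (+-identityʳ B))
        (good-del-out (good-mono {N = N} comm g))))
      where
      comm : ∀ x y → del u (del v M) x y ≤ N x y
      comm x y with x ≟ u | x ≟ v | y ≟ u | y ≟ v
      ... | yes _ | _     | _     | _     = z≤n
      ... | no _  | yes _ | yes _ | _     = z≤n
      ... | no _  | yes _ | no _  | _     = z≤n
      ... | no _  | no _  | yes _ | _     = z≤n
      ... | no _  | no _  | no _  | yes _ = z≤n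
      ... | no _  | no _  | no _  | no _  = ≤-refl
      out0 : out (del v M) u ≡ 0
      out0 = +-cancelʳ-≡ 1 _ 0 (trans (cong (out (del v M) u +_) (sym uv)) (trans (out-del M u≢v) ou))

    -- Only `u` is paid for. Without `u`, the vertex `v` is a source and costs nothing.
    good-kill₂ : ∀ {B} → out M u ⊓ inn M u ≤ 2 → Good N B → Good M (B + 17400)
    good-kill₂ {B} mu g = good-≤ {M = M} (+-monoʳ-≤ B (*-monoˡ-≤ 8700 mu)) (good-del
      (subst (Good (del u M)) (trans (cong (λ k → B + k * 8700) inn0) (+-identityʳ B)) (good-del-in g)))
      where
      inn0 : inn (del u M) v ≡ 0
      inn0 = +-cancelʳ-≡ 1 _ 0 (trans (cong (inn (del u M) v +_) (sym uv)) (trans (inn-del M (u≢v ∘ sym)) iv))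

    module Third {w} (ow : out M w ≡ 1) (wu : 1 ≤ M w u) where

      u≢w : u ≢ w
      u≢w = arc-≢ s wu ∘ sym

      wu≡1 : M w u ≡ 1
      wu≡1 = ≤-antisym (≤-trans (term≤sum (M w) u) (≤-reflexive ow)) wu

      v≢w : v ≢ w
      v≢w refl with () ← subst (1 ≤_) (oriented′ s uv) wu

      N₃ : Graph n
      N₃ = del w N

      N₃-≤N : ∀ x y → N₃ x y ≤ N x y
      N₃-≤N = del-≤ w N

      N₃-≤ : ∀ x y → N₃ x y ≤ M x y
      N₃-≤ x y = ≤-trans (N₃-≤N x y) (N-≤ x y)

      state-N₃ : State N₃
      state-N₃ = state-mono N₃-≤ s

      size-N₃ : size N₃ < size M
      size-N₃ = ≤-<-trans (sum-mono (λ x → sum-mono (N₃-≤N x))) size-N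

      out-N₃-u : out N₃ u ≡ 0
      out-N₃-u = del-≤-out {N} {w} {u} out-N-u

      out-N₃-v : out N₃ v ≡ 0
      out-N₃-v = del-≤-out {N} {w} {v} out-N-v

      out-N₃-w : out N₃ w ≡ 0
      out-N₃-w = out-del-self w N

      out-N-w : out N w ≡ 0
      out-N-w = n≤0⇒n≡0 (+-cancelʳ-≤ 1 _ 0 (≤-trans (+-monoʳ-≤ (out N w)
        (≤-trans (≤-reflexive (sym wu≡1)) (m≤m+n _ (M w v)))) (≤-reflexive (trans (out-N (u≢w ∘ sym) (v≢w ∘ sym)) ow))))

      -- The only out-arc of `w` leads to `u`, so `w` is a sink in `N` and is deleted for free.
      good-kill₃ : ∀ {B} → out M u ⊓ inn M u ≤ 2 → Good N₃ B → Good M (B + 17400)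
      good-kill₃ {B} mu g = good-kill₂ mu (subst (Good N)
        (trans (cong (λ k → B + k * 8700) out-N-w) (+-identityʳ B)) (good-del-out g))

  module Step {M : Graph n} (s : State M) (ih : IH M)
              (live-out : ∀ x → 1 ≤ inn M x → 1 ≤ out M x) (live-in : ∀ x → 1 ≤ out M x → 1 ≤ inn M x)
              (no11 : ∀ x → out M x ≡ 1 → inn M x ≡ 1 → ⊥) where

    -- In the absence of sinks and sources a vertex is either isolated, with nothing to lose, or has
    -- both degrees positive, as `φ-small` demands.
    drop : ∀ {N : Graph n} x q p → out N x + q ≡ out M x → inn N x + p ≡ inn M x →
           ω N x + (q + p) * 392 ≤ ω M x
    drop {N} x q p eo ei with pos (out M x)
    ... | inj₂ o≥1 = φ-small (out N x) (inn N x) q p (trans (+-comm q _) eo) (trans (+-comm p _) ei)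
                       o≥1 (live-in x o≥1) (thin s x)
    ... | inj₁ o≡0 = ≤-trans (≤-reflexive (cong₂ (λ k l → k + l * 392) (ω-dead {N} {x} oN≡0)
                       (cong₂ _+_ q≡0 p≡0))) z≤n
      where
      oN≡0 : out N x ≡ 0
      oN≡0 = m+n≡0⇒m≡0 _ (trans eo o≡0)
      q≡0 : q ≡ 0
      q≡0 = m+n≡0⇒n≡0 (out N x) (trans eo o≡0)
      i≡0 : inn M x ≡ 0
      i≡0 with pos (inn M x)
      ... | inj₁ e = e
      ... | inj₂ i≥1 with () ← subst (1 ≤_) o≡0 (live-out x i≥1)
      p≡0 : p ≡ 0
      p≡0 = m+n≡0⇒n≡0 (inn N x) (trans ei i≡0)

    record Site (u v w₁ w₂ : Fin n) : Set where
      field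
        uv    : M u v ≡ 1
        iv    : inn M v ≡ 1
        ov    : out M v ≡ 2
        vw₁   : M v w₁ ≡ 1
        vw₂   : M v w₂ ≡ 1
        w₁≢w₂ : w₁ ≢ w₂
        only-w : ∀ x → x ≢ w₁ → x ≢ w₂ → M v x ≡ 0

    flip : ∀ {u v w₁ w₂} → Site u v w₁ w₂ → Site u v w₂ w₁
    flip S = record { uv = uv ; iv = iv ; ov = ov ; vw₁ = vw₂ ; vw₂ = vw₁ ; w₁≢w₂ = w₁≢w₂ ∘ sym
                    ; only-w = λ x p q → only-w x q p }
      where open Site S

    module AtSite {u v w₁ w₂} (S : Site u v w₁ w₂) where
      open Site S public
      open Kill s uv iv public

      v≢w₁ : v ≢ w₁
      v≢w₁ = arc-≢ s (≤-reflexive (sym vw₁))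

      u≢w₁ : u ≢ w₁
      u≢w₁ refl with () ← trans (sym vw₁) (oriented′ s uv)

      w₁v : M w₁ v ≡ 0
      w₁v = only-u w₁ (u≢w₁ ∘ sym)

      ou≥1 : 1 ≤ out M u
      ou≥1 = out-pos {M = M} (≤-reflexive (sym uv))

      iu≥1 : 1 ≤ inn M u
      iu≥1 = live-in u ou≥1

      iw₁≥1 : 1 ≤ inn M w₁
      iw₁≥1 = inn-pos {M = M} (≤-reflexive (sym vw₁))

      ow₁≥1 : 1 ≤ out M w₁
      ow₁≥1 = live-out w₁ iw₁≥1

      ωv : ω M v ≡ 3292
      ωv = trans (cong₂ φ ov iv) φ-21

      D : Graph n
      D = del v M

      D-out-u : out D u + 1 ≡ out M u
      D-out-u = trans (cong (out D u +_) (sym uv)) (out-del M u≢v)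

      D-inn-u : inn D u ≡ inn M u
      D-inn-u = trans (sym (+-identityʳ _)) (trans (cong (inn D u +_) (sym (oriented′ s uv))) (inn-del M u≢v))

      D-out-w : out D w₁ ≡ out M w₁
      D-out-w = trans (sym (+-identityʳ _)) (trans (cong (out D w₁ +_) (sym w₁v)) (out-del M (v≢w₁ ∘ sym)))

      D-inn-w : inn D w₁ + 1 ≡ inn M w₁
      D-inn-w = trans (cong (inn D w₁ +_) (sym vw₁)) (inn-del M (v≢w₁ ∘ sym))

      D-w-392 : ω D w₁ + 392 ≤ ω M w₁
      D-w-392 = drop {D} w₁ 0 1 (trans (+-identityʳ _) D-out-w) D-inn-w

      D-w-1545 : ¬ Small3 (out M w₁) (inn M w₁) → ω D w₁ + 1545 ≤ ω M w₁
      D-w-1545 ns rewrite D-out-w = φ-in-1545 (thin s w₁) (no11 w₁) ow₁≥1 iw₁≥1 ns (<-from-+ D-inn-w ≤-refl)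

      D-w-2822 : inn M w₁ ≤ out M w₁ → ω D w₁ + 2822 ≤ ω M w₁
      D-w-2822 le rewrite D-out-w = φ-in-2822 (thin s w₁) (no11 w₁) iw₁≥1 le (<-from-+ D-inn-w ≤-refl)

      N-out-w : 1 ≤ M w₁ u → out N w₁ < out M w₁
      N-out-w t = <-from-+ (out-N (u≢w₁ ∘ sym) (v≢w₁ ∘ sym)) (≤-trans t (m≤m+n _ _))

      N-inn-w : inn N w₁ < inn M w₁
      N-inn-w = <-from-+ (inn-N (u≢w₁ ∘ sym) (v≢w₁ ∘ sym)) (≤-trans (≤-reflexive (sym vw₁)) (m≤n+m _ _))

      no-uw : 1 ≤ M w₁ u → M u w₁ ≡ 0
      no-uw t = oriented s t

      remove : ∀ cu c₁ c₂ → ω D u + cu ≤ ω M u → ω D w₁ + c₁ ≤ ω M w₁ → ω D w₂ + c₂ ≤ ω M w₂ →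
               8700 ≤ 0 + c₂ + c₁ + cu + 3292 → Good M (Φ M)
      remove cu c₁ c₂ gu g₁ g₂ le = settle {M} {D} {ω D} L (≤-reflexive (+-identityʳ (Φ D)))
        (gains L (ω-mono s (del-≤ v M))
          ( dead-gain {D} {M} (out-del-self v M) (≤-reflexive (sym ωv)) , (u≢v ∷ (v≢w₁ ∘ sym) ∷ v≢w₂ ∷ [])
          , gu , ((u≢w₁ ∘ sym) ∷ u≢w₂ ∷ []) , g₁ , ((w₁≢w₂ ∘ sym) ∷ []) , g₂ , [] , tt))
        le (subst (λ k → Good M (Φ D + k * 8700)) iv (good-del-in (ih D (size-del {M = M} u (≤-reflexive (sym uv))) (state-del v s))))
        where
        L : List (Fin n × ℕ)
        L = (v , 3292) ∷ (u , cu) ∷ (w₁ , c₁) ∷ (w₂ , c₂) ∷ []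
        v≢w₂ : w₂ ≢ v
        v≢w₂ = arc-≢ s (≤-reflexive (sym vw₂)) ∘ sym
        u≢w₂ : w₂ ≢ u
        u≢w₂ refl with () ← trans (sym vw₂) (oriented′ s uv)

    module Analyse {u v w₁ w₂} (S : Site u v w₁ w₂) where

      open AtSite S
      module F = AtSite (flip S)

      -- Any selection `h` of the arcs joining `x` to `u` or `v` may be credited at 392 each. It
      -- vanishes at `u` and `v`, whose entire weights are credited separately.
      below : (h : Fin n → ℕ) → h u ≡ 0 → h v ≡ 0 → (∀ x → h x ≤ (M x u + M x v) + (M u x + M v x)) →
              ∀ x → ω N x + h x * 392 ≤ ω M x
      below h hu hv le x = by (x ≟ u) (x ≟ v)
        where
        by : Dec (x ≡ u) → Dec (x ≡ v) → ω N x + h x * 392 ≤ ω M x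
        by (yes refl) _ = ≤-trans (≤-reflexive (cong₂ (λ k l → k + l * 392) (ω-dead {N} {u} out-N-u) hu)) z≤n
        by (no _) (yes refl) = ≤-trans (≤-reflexive (cong₂ (λ k l → k + l * 392) (ω-dead {N} {v} out-N-v) hv)) z≤n
        by (no p) (no q) = ≤-trans (+-monoʳ-≤ (ω N x) (*-monoˡ-≤ 392 (le x)))
          (drop {N} x (M x u + M x v) (M u x + M v x) (out-N p q) (inn-N p q))

      h-sum : ∀ (K : Graph n) (h : Fin n → ℕ) → Φ K + sum h * 392 ≤ sum (λ x → ω K x + h x * 392)
      h-sum K h = ≤-reflexive (trans (cong (Φ K +_) (sym (sum-* h 392))) (sym (∑-distrib-+ (ω K) (λ x → h x * 392))))

      h-gain : ∀ {K : Graph n} {h : Fin n → ℕ} {x c} → h x ≡ 0 → ω K x + c ≤ ω M x → ω K x + h x * 392 + c ≤ ω M x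
      h-gain {K} {h} {x} {c} e p = ≤-trans (≤-reflexive (cong (_+ c)
        (trans (cong (λ k → ω K x + k * 392) e) (+-identityʳ _)))) p

      -- Cutting the arc from u to v turns u into a sink and v into a source.
      series : out M u ≡ 1 → 3 ≤ inn M u → Good M (Φ M)
      series ou i≥3 = settle {M} {N} {λ x → ω N x + h x * 392} L (h-sum N h)
        (gains L (below h hu hv le)
          ( h-gain {N} {h} hu (dead-gain {N} {M} out-N-u gu) , ((u≢v ∘ sym) ∷ [])
          , h-gain {N} {h} hv (dead-gain {N} {M} out-N-v (≤-reflexive (sym ωv))) , [] , tt))
        (linear (sum h ∷ []) (hyp 392 (con 5) x₀ h≥5 ∷ []) (con 8700) (x₀ ⊛ 392 ⊕ con 7021))
        (good-kill₁ ou (ih N size-N state-N))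
        where
        L : List (Fin n × ℕ)
        L = (u , 3729) ∷ (v , 3292) ∷ []
        h : Fin n → ℕ
        h x = M v x + M x u
        hu : h u ≡ 0
        hu = cong₂ _+_ (oriented′ s uv) (loopless s u)
        hv : h v ≡ 0
        hv = cong₂ _+_ (loopless s v) (oriented′ s uv)
        le : ∀ x → h x ≤ (M x u + M x v) + (M u x + M v x)
        le x = linear (M v x ∷ M x u ∷ M x v ∷ M u x ∷ []) [] (x₀ ⊕ x₁) ((x₁ ⊕ x₂) ⊕ (x₃ ⊕ x₀))
        gu : 3729 ≤ ω M u
        gu = subst (λ k → 3729 ≤ φ k (inn M u)) (sym ou) (φ-1≥3′ i≥3)
        h≥5 : 5 ≤ sum h
        h≥5 = ≤-trans (+-mono-≤ (≤-reflexive (sym ov)) i≥3) (≤-reflexive (sym (∑-distrib-+ (M v) (λ x → M x u))))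

      series₂ : out M u ≡ 1 → inn M u ≡ 2 → 1 ≤ M w₁ u → Good M (Φ M)
      series₂ ou iu t = settle {M} {N} {ω N} L (≤-reflexive (+-identityʳ (Φ N)))
        (gains L (ω-mono s N-≤)
          ( dead-gain {N} {M} out-N-u (≤-reflexive (sym (trans (cong₂ φ ou iu) φ-12))) , ((u≢v ∘ sym) ∷ (u≢w₁ ∘ sym) ∷ [])
          , dead-gain {N} {M} out-N-v (≤-reflexive (sym ωv)) , ((v≢w₁ ∘ sym) ∷ [])
          , φ-diag (thin s w₁) (N-out-w t) N-inn-w , [] , tt))
        num≤ (good-kill₁ ou (ih N size-N state-N))
        where
        L : List (Fin n × ℕ)
        L = (u , 3292) ∷ (v , 3292) ∷ (w₁ , 2900) ∷ []

      -- The weight 3292 released by `v` pays for the growth of `u` by one out-arc, and the bound on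
      -- the in-degree keeps `u` thin.
      merge : inn M u ≤ 2 → M w₁ u ≡ 0 → M w₂ u ≡ 0 → Good M (Φ M)
      merge iu≤2 t₁ t₂ = good-≤ {M = M} (+-cancelʳ-≤ 3292 _ _ (≤-trans (gains L up (gv , [] , tt))
          (≤-reflexive (trans (∑-distrib-+ (ω M) (δ u 3292)) (cong (Φ M +_) (sum-δ u 3292))))))
        (good-C (ih C size-C state-C))
        where
        open Contract s uv only-u hiding (u≢v)
        tri : ∀ y → 1 ≤ M v y → M y u ≡ 0
        tri y p with y ≟ w₁ | y ≟ w₂
        ... | yes refl | _ = t₁
        ... | no _ | yes refl = t₂
        ... | no a | no b with () ← subst (1 ≤_) (only-w y a b) p
        open NoTriangle tri (inj₂ iu≤2)
        L : List (Fin n × ℕ)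
        L = (v , 3292) ∷ []
        out-eq : out C u ≡ 1 + out M u
        out-eq = +-cancelʳ-≡ 1 _ _ (trans out-u (trans (cong (out M u +_) ov) (+-suc (out M u) 1)))
        up : ∀ x → ω C x ≤ ω M x + δ u 3292 x
        up x = by (x ≟ u) (x ≟ v)
          where
          by : Dec (x ≡ u) → Dec (x ≡ v) → ω C x ≤ ω M x + δ u 3292 x
          by (yes refl) _ rewrite out-eq | inn-x u≢v | δ-same u 3292 = grow (out M u) (inn M u) ou≥1 iu≤2
          by (no _) (yes refl) rewrite ω-v = z≤n
          by (no p) (no q) rewrite out-x p q | inn-x q = m≤m+n _ _
        gv : ω C v + 3292 ≤ ω M v + δ u 3292 v
        gv rewrite ω-v = ≤-trans (≤-reflexive (sym ωv)) (m≤m+n _ _)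

      one-triangle : 2 ≤ out M u → inn M u ≤ 2 → 1 ≤ M w₁ u → M w₂ u ≡ 0 → Good M (Φ M)
      one-triangle ou iu≤2 t₁ t₂ = single-triangle s ih uv only-u ov ou iu≤2 vw₁ t₁ tri
        where
        tri : ∀ y → y ≢ w₁ → 1 ≤ M v y → M y u ≡ 0
        tri y a p with y ≟ w₂
        ... | yes refl = t₂
        ... | no b with () ← subst (1 ≤_) (only-w y a b) p

      -- Here `k` bounds from below the out-arcs of `u` that avoid `v`. Because of the two triangles
      -- none of them ends in `w₁` or `w₂`, so their 392 credits do not overlap with `c₁` and `c₂`.
      kill-uv : ∀ cu c₁ c₂ k → out M u ⊓ inn M u ≤ 2 → 1 ≤ M w₁ u → 1 ≤ M w₂ u → k + 1 ≤ out M u →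
                cu ≤ ω M u → ω N w₁ + c₁ ≤ ω M w₁ → ω N w₂ + c₂ ≤ ω M w₂ →
                17400 ≤ k * 392 + (0 + c₂ + c₁ + 3292 + cu) → Good M (Φ M)
      kill-uv cu c₁ c₂ k mu t₁ t₂ k≤ gu g₁ g₂ num = settle {M} {N} {λ x → ω N x + h x * 392} L (h-sum N h)
        (gains L (below h hu hv le)
          ( h-gain {N} {h} hu (dead-gain {N} {M} out-N-u gu) , ((u≢v ∘ sym) ∷ (u≢w₁ ∘ sym) ∷ (F.u≢w₁ ∘ sym) ∷ [])
          , h-gain {N} {h} hv (dead-gain {N} {M} out-N-v (≤-reflexive (sym ωv))) , ((v≢w₁ ∘ sym) ∷ (F.v≢w₁ ∘ sym) ∷ [])
          , h-gain {N} {h} (trans (except-diff (M u) (v≢w₁ ∘ sym)) (no-uw t₁)) g₁ , ((w₁≢w₂ ∘ sym) ∷ [])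
          , h-gain {N} {h} (trans (except-diff (M u) (F.v≢w₁ ∘ sym)) (F.no-uw t₂)) g₂ , [] , tt))
        (≤-trans num (+-monoˡ-≤ _ (*-monoˡ-≤ 392 k≤h)))
        (good-kill₂ mu (ih N size-N state-N))
        where
        L : List (Fin n × ℕ)
        L = (u , cu) ∷ (v , 3292) ∷ (w₁ , c₁) ∷ (w₂ , c₂) ∷ []
        h : Fin n → ℕ
        h = except v (M u)
        hu : h u ≡ 0
        hu = trans (except-diff (M u) u≢v) (loopless s u)
        hv : h v ≡ 0
        hv = except-same v (M u)
        le : ∀ x → h x ≤ (M x u + M x v) + (M u x + M v x)
        le x with x ≟ v
        ... | yes _ = z≤n
        ... | no _  = linear (M u x ∷ M x u ∷ M x v ∷ M v x ∷ []) [] x₀ ((x₁ ⊕ x₂) ⊕ (x₀ ⊕ x₃))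
        k≤h : k ≤ sum h
        k≤h = +-cancelʳ-≤ 1 _ _ (≤-trans k≤ (≤-reflexive (trans (sym (sum-except (M u) v)) (cong (sum h +_) uv))))

      two-triangles-≥3 : 3 ≤ out M u → inn M u ≡ 2 → 1 ≤ M w₁ u → 1 ≤ M w₂ u → Good M (Φ M)
      two-triangles-≥3 ou iu t₁ t₂ = kill-uv 7200 3214 3214 2 (≤-trans (m⊓n≤n _ _) (≤-reflexive iu)) t₁ t₂ ou gu
        (φ-diag-3214 (thin s w₁) (no11 w₁) (N-out-w t₁) N-inn-w)
        (φ-diag-3214 (thin s w₂) (no11 w₂) (F.N-out-w t₂) F.N-inn-w) num≤
        where
        gu : 7200 ≤ ω M u
        gu = subst (λ k → 7200 ≤ φ (out M u) k) (sym iu) (φ-≥7200′ ou)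

      D-u-2822 : out M u ≡ 2 → inn M u ≡ 2 → ω D u + 2822 ≤ ω M u
      D-u-2822 ou iu = subst₂ (λ k l → k + 2822 ≤ l)
        (trans (φ-sym 2 1) (sym (cong₂ φ (+-cancelʳ-≡ 1 _ 1 (trans D-out-u ou)) (trans D-inn-u iu))))
        (sym (cong₂ φ ou iu)) (in-2822 2 1 ≤-refl ≤-refl)

      ωu-22 : out M u ≡ 2 → inn M u ≡ 2 → 6114 ≤ ω M u
      ωu-22 ou iu = ≤-reflexive (sym (trans (cong₂ φ ou iu) φ-22))

      -- In the reversed graph `w₁` has type (2 , 1) and in-neighbour `u`, so `single-triangle`
      -- applies there, unless `u` and `w₁` lie on a second triangle u → x → w₁ → u. In that case
      -- deleting `u`, `v` and `w₁` costs 2, while `x` and `w₂` each lose an arc on both sides: 6114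
      -- + 2 * 3292 + 2 * 2900 = 18498.
      two-triangles-12 : out M u ≡ 2 → inn M u ≡ 2 → 1 ≤ M w₁ u → 1 ≤ M w₂ u →
                         out M w₁ ≡ 1 → inn M w₁ ≡ 2 → Good M (Φ M)
      two-triangles-12 ou iu t₁ t₂ ow iw with any? (λ x → ¬? (x ≟ v) ×-dec (1 ℕ.≤? M x w₁) ×-dec (1 ℕ.≤? M u x))
      ... | no none = good-≤ {M = M} (≤-reflexive (Φ-rev M)) (good-rev
              (single-triangle {rev M} (state-rev s)
                (λ N p t → ih N (subst (size N <_) (size-rev M) p) t)
                wu≡1 only-w₁ iw (≤-reflexive (sym iu)) (≤-reflexive ou) vw₁ (≤-reflexive (sym uv)) tri))
        where
        open Third ow t₁
        only-w₁ : ∀ x → x ≢ u → M w₁ x ≡ 0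
        only-w₁ = others-zero (M w₁) u (+-cancelʳ-≡ 1 _ 0
          (trans (cong (sum (except u (M w₁)) +_) (sym wu≡1)) (trans (sum-except (M w₁) u) ow)))
        tri : ∀ y → y ≢ v → 1 ≤ M y w₁ → M u y ≡ 0
        tri y p q with pos (M u y)
        ... | inj₁ e = e
        ... | inj₂ r = ⊥-elim (none (y , p , q , r))
      ... | yes (x , x≢v , xw , ux) = settle {M} {N₃} {ω N₃} L (≤-reflexive (+-identityʳ (Φ N₃)))
              (gains L (ω-mono s N₃-≤)
                ( dead-gain {N₃} {M} out-N₃-u (ωu-22 ou iu)
                , ((u≢v ∘ sym) ∷ (u≢w₁ ∘ sym) ∷ (x≢u) ∷ (F.u≢w₁ ∘ sym) ∷ [])
                , dead-gain {N₃} {M} out-N₃-v (≤-reflexive (sym ωv)) , ((v≢w₁ ∘ sym) ∷ x≢v ∷ (F.v≢w₁ ∘ sym) ∷ [])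
                , dead-gain {N₃} {M} out-N₃-w (≤-reflexive (sym (trans (cong₂ φ ow iw) φ-12))) , (x≢w₁ ∷ (w₁≢w₂ ∘ sym) ∷ [])
                , φ-diag (thin s x) out-x inn-x , ((x≢w₂ ∘ sym) ∷ [])
                , φ-diag (thin s w₂) (≤-<-trans (sum-mono (N₃-≤N w₂)) (F.N-out-w t₂))
                    (≤-<-trans (sum-mono (λ y → N₃-≤N y w₂)) F.N-inn-w) , [] , tt))
              num≤ (good-kill₃ (≤-trans (m⊓n≤n _ _) (≤-reflexive iu)) (ih N₃ size-N₃ state-N₃))
        where
        open Third ow t₁ hiding (u≢w; v≢w)
        L : List (Fin n × ℕ)
        L = (u , 6114) ∷ (v , 3292) ∷ (w₁ , 3292) ∷ (x , 2900) ∷ (w₂ , 2900) ∷ []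
        x≢u : x ≢ u
        x≢u = arc-≢ s ux ∘ sym
        x≢w₁ : x ≢ w₁
        x≢w₁ = arc-≢ s xw
        x≢w₂ : x ≢ w₂
        x≢w₂ refl with () ← subst (1 ≤_) (oriented s ux) t₂
        Nxw : N x w₁ ≡ M x w₁
        Nxw = trans (del-off (del u M) x≢v (v≢w₁ ∘ sym)) (del-off M x≢u (u≢w₁ ∘ sym))
        out-x : out N₃ x < out M x
        out-x = <-≤-trans (<-from-+ (out-del N x≢w₁) (subst (1 ≤_) (sym Nxw) xw)) (sum-mono (N-≤ x))
        inn-x : inn N₃ x < inn M x
        inn-x = ≤-<-trans (sum-mono (λ y → N₃-≤N y x)) (<-from-+ (inn-N x≢u x≢v) (≤-trans ux (m≤m+n _ _)))

      -- Deleting `u`, `v` and `w₁` costs 17400. The named vertices give 6114 + 3292 + 2 * 3729 =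
      -- 16864, and at least two arcs enter `w₁` from vertices other than `v`, at 392 each.
      two-triangles-13 : out M u ≡ 2 → inn M u ≡ 2 → 1 ≤ M w₁ u → 1 ≤ M w₂ u → out M w₁ ≡ 1 → 3 ≤ inn M w₁ →
                         Small (out M w₂) (inn M w₂) → (out M w₂ ≡ 1 → inn M w₂ ≡ 2 → ⊥) → Good M (Φ M)
      two-triangles-13 ou iu t₁ t₂ ow iw≥3 sm ne = settle {M} {N₃} {f} L (h-sum N₃ h)
        (gains L below₃
          ( h-gain {N₃} {h} hu (dead-gain {N₃} {M} out-N₃-u (ωu-22 ou iu)) , ((u≢v ∘ sym) ∷ (u≢w₁ ∘ sym) ∷ (F.u≢w₁ ∘ sym) ∷ [])
          , h-gain {N₃} {h} hv (dead-gain {N₃} {M} out-N₃-v (≤-reflexive (sym ωv))) , ((v≢w₁ ∘ sym) ∷ (F.v≢w₁ ∘ sym) ∷ [])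
          , h-gain {N₃} {h} hw (dead-gain {N₃} {M} out-N₃-w (subst (λ k → 3729 ≤ φ k (inn M w₁)) (sym ow) (φ-1≥3′ iw≥3)))
          , ((w₁≢w₂ ∘ sym) ∷ []) , gw₂ , [] , tt))
        (linear (sum h ∷ []) (hyp 392 (con 2) x₀ h≥2 ∷ []) (con 17400) (x₀ ⊛ 392 ⊕ con 16864))
        (good-kill₃ (≤-trans (m⊓n≤n _ _) (≤-reflexive iu)) (ih N₃ size-N₃ state-N₃))
        where
        open Third ow t₁ hiding (u≢w; v≢w)
        L : List (Fin n × ℕ)
        L = (u , 6114) ∷ (v , 3292) ∷ (w₁ , 3729) ∷ (w₂ , 3729) ∷ []
        h f : Fin n → ℕ
        h = except v (λ x → M x w₁)
        f x = ω N₃ x + h x * 392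
        hv : h v ≡ 0
        hv = except-same v (λ x → M x w₁)
        hu : h u ≡ 0
        hu = trans (except-diff (λ x → M x w₁) u≢v) (oriented s t₁)
        hw : h w₁ ≡ 0
        hw = trans (except-diff (λ x → M x w₁) (v≢w₁ ∘ sym)) (loopless s w₁)
        h≥2 : 2 ≤ sum h
        h≥2 = +-cancelʳ-≤ 1 _ _ (≤-trans iw≥3 (≤-reflexive
          (trans (sym (sum-except (λ x → M x w₁) v)) (cong (sum h +_) vw₁))))
        out₃ : ∀ {x} → x ≢ u → x ≢ v → x ≢ w₁ → out N₃ x + (M x w₁ + (M x u + M x v)) ≡ out M x
        out₃ {x} p q r = trans (sym (+-assoc (out N₃ x) _ _)) (trans (cong (λ k → out N₃ x + k + (M x u + M x v))
          (sym (trans (del-off (del u M) q (v≢w₁ ∘ sym)) (del-off M p (u≢w₁ ∘ sym)))))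
          (trans (cong (_+ (M x u + M x v)) (out-del N r)) (out-N p q)))
        inn₃ : ∀ {x} → x ≢ u → x ≢ v → x ≢ w₁ → inn N₃ x + (N w₁ x + (M u x + M v x)) ≡ inn M x
        inn₃ {x} p q r = trans (sym (+-assoc (inn N₃ x) _ _)) (trans (cong (_+ (M u x + M v x)) (inn-del N r)) (inn-N p q))
        below₃ : ∀ x → f x ≤ ω M x
        below₃ x = by (x ≟ u) (x ≟ v) (x ≟ w₁)
          where
          dead : out N₃ x ≡ 0 → h x ≡ 0 → f x ≤ ω M x
          dead p q = ≤-trans (≤-reflexive (cong₂ (λ k l → k + l * 392) (ω-dead {N₃} {x} p) q)) z≤n
          by : Dec (x ≡ u) → Dec (x ≡ v) → Dec (x ≡ w₁) → f x ≤ ω M x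
          by (yes refl) _ _ = dead out-N₃-u hu
          by (no _) (yes refl) _ = dead out-N₃-v hv
          by (no _) (no _) (yes refl) = dead out-N₃-w hw
          by (no p) (no q) (no r) = ≤-trans (+-monoʳ-≤ (ω N₃ x) (*-monoˡ-≤ 392
              (≤-trans (≤-reflexive (except-diff (λ x → M x w₁) q)) (≤-trans (m≤m+n _ (M x u + M x v)) (m≤m+n _ _)))))
            (drop {N₃} x _ _ (out₃ p q r) (inn₃ p q r))
        gw₂ : f w₂ + 3729 ≤ ω M w₂
        gw₂ with pos (M w₂ w₁)
        ... | inj₁ e = h-gain {N₃} {h} (trans (except-diff (λ x → M x w₁) (F.v≢w₁ ∘ sym)) e)
                (φ-diag-3729 sm ne (≤-<-trans (sum-mono (N₃-≤N w₂)) (F.N-out-w t₂))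
                  (≤-<-trans (sum-mono (λ y → N₃-≤N y w₂)) F.N-inn-w))
        -- With arcs to both `u` and `w₁`, the vertex `w₂` has out-degree 2 and loses all its
        -- out-arcs. Its weight of at least 7200 covers 3729 and the 392 for the arc to `w₁`,
        -- together 4121.
        ... | inj₂ p = lem (out M w₂) (inn M w₂) sm (out₃ (F.u≢w₁ ∘ sym) (F.v≢w₁ ∘ sym) (w₁≢w₂ ∘ sym)) refl
          where
          lem : ∀ o i → Small o i → out N₃ w₂ + (M w₂ w₁ + (M w₂ u + M w₂ v)) ≡ o → φ o i ≡ ω M w₂ → f w₂ + 3729 ≤ ω M w₂
          lem o i sm e eq = ≤-trans (≤-reflexive (cong₂ (λ k l → k + l * 392 + 3729) (ω-dead {N₃} {w₂} out0)
              (trans (except-diff (λ x → M x w₁) (F.v≢w₁ ∘ sym)) one))) (≤-trans (big sm 2≤o) (≤-reflexive eq))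
            where
            2≤o : 2 ≤ o
            2≤o = ≤-trans (+-mono-≤ p t₂) (≤-trans (+-monoʳ-≤ (M w₂ w₁) (m≤m+n (M w₂ u) (M w₂ v))) (≤-trans (m≤n+m _ (out N₃ w₂)) (≤-reflexive e)))
            big : Small o i → 2 ≤ o → 4121 ≤ φ o i
            big ⟨1,2⟩ (s≤s ())
            big ⟨1,3+ i ⟩ (s≤s ())
            big ⟨2,3+ i ⟩ _ = ≤-trans num≤ (φ-2≥3 i)
            sum2 : out N₃ w₂ + (M w₂ w₁ + (M w₂ u + M w₂ v)) ≤ 2
            sum2 = ≤-trans (≤-reflexive e) (small-out sm)
            out0 : out N₃ w₂ ≡ 0
            out0 = n≤0⇒n≡0 (linear (out N₃ w₂ ∷ M w₂ w₁ ∷ M w₂ u ∷ M w₂ v ∷ [])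
              (hyp 1 (x₀ ⊕ (x₁ ⊕ (x₂ ⊕ x₃))) (con 2) sum2 ∷ hyp 1 (con 1) x₁ p ∷ hyp 1 (con 1) x₂ t₂ ∷ []) x₀ (con 0))
            one : M w₂ w₁ ≡ 1
            one = ≤-antisym (linear (out N₃ w₂ ∷ M w₂ w₁ ∷ M w₂ u ∷ M w₂ v ∷ [])
              (hyp 1 (x₀ ⊕ (x₁ ⊕ (x₂ ⊕ x₃))) (con 2) sum2 ∷ hyp 1 (con 1) x₂ t₂ ∷ []) x₁ (con 1)) p

    module Decide {u v w₁ w₂} (S : Site u v w₁ w₂) where

      open AtSite S
      module A  = Analyse S
      module A′ = Analyse (flip S)
      module F  = AtSite (flip S)

      -- What is left when no local move pays off.
      record Stuck : Set where
        field
          ou     : out M u ≡ 2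
          iu     : 3 ≤ inn M u
          small₁ : Small3 (out M w₁) (inn M w₁)
          small₂ : Small3 (out M w₂) (inn M w₂)
          tri    : M w₁ u ≡ 0 ⊎ M w₂ u ≡ 0

      two-triangles-22 : out M u ≡ 2 → inn M u ≡ 2 → 1 ≤ M w₁ u → 1 ≤ M w₂ u → Good M (Φ M)
      two-triangles-22 ou iu t₁ t₂ with out M w₁ ℕ.<? inn M w₁ | out M w₂ ℕ.<? inn M w₂
      -- An out-neighbour with in-degree at most its out-degree loses 2822 with an in-arc, so
      -- deleting `v` alone pays: 3292 + 2 * 2822 + 392 = 9328.
      ... | no p | _ = remove 2822 2822 392 (A.D-u-2822 ou iu) (D-w-2822 (≮⇒≥ p)) F.D-w-392 num≤
      ... | yes _ | no q = remove 2822 392 2822 (A.D-u-2822 ou iu) D-w-392 (F.D-w-2822 (≮⇒≥ q)) num≤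
      ... | yes p | yes q = cases (small (thin s w₁) ow₁≥1 p) (small (thin s w₂) F.ow₁≥1 q) refl refl refl refl
        where
        2∸ : out M u ⊓ inn M u ≤ 2
        2∸ = ≤-trans (m⊓n≤n _ _) (≤-reflexive iu)
        cases : ∀ {o₁ i₁ o₂ i₂} → Small o₁ i₁ → Small o₂ i₂ →
                out M w₁ ≡ o₁ → inn M w₁ ≡ i₁ → out M w₂ ≡ o₂ → inn M w₂ ≡ i₂ → Good M (Φ M)
        cases ⟨1,2⟩ _ a b _ _ = A.two-triangles-12 ou iu t₁ t₂ a b
        cases _ ⟨1,2⟩ _ _ c d = A′.two-triangles-12 ou iu t₂ t₁ c d
        cases ⟨1,3+ i ⟩ sm@(⟨1,3+ j ⟩) a b c d = A.two-triangles-13 ou iu t₁ t₂ a (≤-trans (m≤m+n 3 i) (≤-reflexive (sym b)))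
          (subst₂ Small (sym c) (sym d) sm) (λ _ e → 1+n≢0 (cong (pred ∘ pred) (trans (sym d) e)))
        cases ⟨1,3+ i ⟩ sm@(⟨2,3+ j ⟩) a b c d = A.two-triangles-13 ou iu t₁ t₂ a (≤-trans (m≤m+n 3 i) (≤-reflexive (sym b)))
          (subst₂ Small (sym c) (sym d) sm) (λ e _ → 1+n≢n (trans (sym c) e))
        cases sm@(⟨2,3+ j ⟩) ⟨1,3+ i ⟩ c d a b = A′.two-triangles-13 ou iu t₂ t₁ a (≤-trans (m≤m+n 3 i) (≤-reflexive (sym b)))
          (subst₂ Small (sym c) (sym d) sm) (λ e _ → 1+n≢n (trans (sym c) e))
        cases ⟨2,3+ i ⟩ ⟨2,3+ j ⟩ a b c d = A.kill-uv 6114 3908 3908 1 2∸ t₁ t₂ (≤-reflexive (sym ou)) (A.ωu-22 ou iu)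
          (gw i a b (N-out-w t₁) N-inn-w) (gw j c d (F.N-out-w t₂) F.N-inn-w) num≤
          where
          gw : ∀ {x} i → out M x ≡ 2 → inn M x ≡ 3 + i → out N x < out M x → inn N x < inn M x → ω N x + 3908 ≤ ω M x
          gw i a b p q = ≤-trans (+-monoˡ-≤ 3908 (φ-mono (inj₁ (s≤s z≤n)) (s≤s⁻¹ (≤-trans p (≤-reflexive a))) (s≤s⁻¹ (≤-trans q (≤-reflexive b)))))
            (≤-trans (diag-2≥3 i) (≤-reflexive (sym (cong₂ φ a b))))

      D-u-3471 : out M u ≡ 2 → 3 ≤ inn M u → ω D u + 3471 ≤ ω M u
      D-u-3471 ou iu≥3 = subst₂ (λ k l → k + 3471 ≤ l)
        (trans (φ-sym _ 1) (sym (cong₂ φ (+-cancelʳ-≡ 1 _ 1 (trans D-out-u ou)) D-inn-u)))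
        (trans (φ-sym _ 2) (sym (cong₂ φ ou refl))) (lem iu≥3)
        where
        lem : ∀ {k} → 3 ≤ k → φ k 1 + 3471 ≤ φ k 2
        lem (s≤s (s≤s (s≤s {n = k} z≤n))) = in-3471 k

      -- If the in-degree of `u` is at most 2, contraction is available and triangles are the only
      -- complication. Otherwise contraction would destroy thinness when the out-degree of `u` is 2,
      -- and only deletions remain.
      decide : Good M (Φ M) ⊎ Stuck
      decide with inn M u ℕ.≤? 2 | pos (M w₁ u) | pos (M w₂ u)
      ... | yes i≤2 | inj₁ t₁ | inj₁ t₂ = inj₁ (A.merge i≤2 t₁ t₂)
      ... | yes i≤2 | inj₂ t₁ | inj₁ t₂ with out M u ℕ.≤? 1
      ...   | yes o≤1 = inj₁ (A.series₂ o≡1 (two o≡1) t₁)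
        where
        o≡1 : out M u ≡ 1
        o≡1 = ≤-antisym o≤1 ou≥1
        two : out M u ≡ 1 → inn M u ≡ 2
        two e = ≤-antisym i≤2 (≤∧≢⇒< iu≥1 (no11 u e ∘ sym))
      ...   | no o≰1 = inj₁ (A.one-triangle (≰⇒> o≰1) i≤2 t₁ t₂)
      decide | yes i≤2 | inj₁ t₁ | inj₂ t₂ with out M u ℕ.≤? 1
      ...   | yes o≤1 = inj₁ (A′.series₂ o≡1 (two o≡1) t₂)
        where
        o≡1 : out M u ≡ 1
        o≡1 = ≤-antisym o≤1 ou≥1
        two : out M u ≡ 1 → inn M u ≡ 2
        two e = ≤-antisym i≤2 (≤∧≢⇒< iu≥1 (no11 u e ∘ sym))
      ...   | no o≰1 = inj₁ (A′.one-triangle (≰⇒> o≰1) i≤2 t₂ t₁)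
      decide | yes i≤2 | inj₂ t₁ | inj₂ t₂ = inj₁ (by (<-cmp (out M u) 2))
        where
        i≡2 : inn M u ≡ 2
        i≡2 = ≤-antisym i≤2 (≤-trans (+-mono-≤ t₁ t₂) (two-terms (λ x → M x u) w₁≢w₂))
        by : _ → Good M (Φ M)
        by (tri< o<2 _ _) = A.series₂ (≤-antisym (s≤s⁻¹ o<2) ou≥1) i≡2 t₁
        by (tri≈ _ o≡2 _) = two-triangles-22 o≡2 i≡2 t₁ t₂
        by (tri> _ _ o>2) = A.two-triangles-≥3 o>2 i≡2 t₁ t₂
      decide | no i≰2 | t₁ | t₂ with out M u ℕ.≤? 1
      ... | yes o≤1 = inj₁ (A.series (≤-antisym o≤1 ou≥1) (≰⇒> i≰2))
      ... | no o≰1 = by (thin s u)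
        where
        by : Thin (out M u) (inn M u) → Good M (Φ M) ⊎ Stuck
        by (inj₂ i≤2) = ⊥-elim (i≰2 i≤2)
        by (inj₁ o≤2) with ≤-antisym o≤2 (≰⇒> o≰1)
                         | small3? (thin s w₁) ow₁≥1 | small3? (thin s w₂) F.ow₁≥1
        ... | o≡2 | no p | _ = inj₁ (remove 3471 1545 392 (D-u-3471 o≡2 (≰⇒> i≰2)) (D-w-1545 p) F.D-w-392 num≤)
        ... | o≡2 | yes _ | no q = inj₁ (remove 3471 392 1545 (D-u-3471 o≡2 (≰⇒> i≰2)) D-w-392 (F.D-w-1545 q) num≤)
        ... | o≡2 | yes p | yes q = last t₁ t₂
          where
          last : M w₁ u ≡ 0 ⊎ 1 ≤ M w₁ u → M w₂ u ≡ 0 ⊎ 1 ≤ M w₂ u → Good M (Φ M) ⊎ Stuck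
          last (inj₁ t) _ = inj₂ (record { ou = o≡2 ; iu = ≰⇒> i≰2 ; small₁ = p ; small₂ = q ; tri = inj₁ t })
          last (inj₂ _) (inj₁ t) = inj₂ (record { ou = o≡2 ; iu = ≰⇒> i≰2 ; small₁ = p ; small₂ = q ; tri = inj₂ t })
          -- With both triangles present, 7200 + 3 * 3292 + 392 = 17468 covers the cost 17400.
          last (inj₂ a) (inj₂ b) = inj₁ (A.kill-uv 7200 3292 3292 1 (≤-trans (m⊓n≤m _ _) (≤-reflexive o≡2)) a b
            (≤-reflexive (sym o≡2)) (subst (λ k → 7200 ≤ φ k (inn M u)) (sym o≡2) (φ-2≥3′ (≰⇒> i≰2)))
            (φ-diag-3292 (proj₁ p) (N-out-w a) N-inn-w) (φ-diag-3292 (proj₁ q) (F.N-out-w b) F.N-inn-w) num≤)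

-- Discharging rules and loss rates

κ : ℕ → ℕ → ℕ
κ o zero    = 0
κ o (suc i) = if does (o <? suc i) then 6 / suc i else 0

-- A vertex gives only along its majority side, so at most one summand is nonzero. The scale 6 makes
-- the division exact for the in-degrees 2 and 3 of `Small3`.
κ-bound : ∀ o i → i * κ o i + o * κ i o ≤ 6
κ-bound zero zero = z≤n
κ-bound zero (suc i) = ≤-trans (≤-reflexive (trans (+-identityʳ _) (*-comm (suc i) _))) (m/n*n≤m 6 (suc i))
κ-bound (suc o) zero = ≤-trans (≤-reflexive (*-comm (suc o) _)) (m/n*n≤m 6 (suc o))
κ-bound (suc o) (suc i) with <-cmp (suc o) (suc i)
... | tri< p _ q rewrite dec-true (suc o <? suc i) p | dec-false (suc i <? suc o) q | *-zeroʳ o | +-identityʳ (suc i * (6 / suc i)) =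
        ≤-trans (≤-reflexive (*-comm (suc i) _)) (m/n*n≤m 6 (suc i))
... | tri≈ p _ q rewrite dec-false (suc o <? suc i) p | dec-false (suc i <? suc o) q | *-zeroʳ o | *-zeroʳ i = z≤n
... | tri> p _ q rewrite dec-false (suc o <? suc i) p | dec-true (suc i <? suc o) q | *-zeroʳ i =
        ≤-trans (≤-reflexive (*-comm (suc o) _)) (m/n*n≤m 6 (suc o))

κ-small : ∀ {o i} → Small3 o i → 2 ≤ κ o i
κ-small (⟨1,2⟩ , _)            = num≤
κ-small (⟨1,3+ zero ⟩ , _)     = num≤
κ-small (⟨1,3+ suc i ⟩ , s≤s (s≤s (s≤s ())))
κ-small (⟨2,3+ zero ⟩ , _)     = num≤
κ-small (⟨2,3+ suc i ⟩ , s≤s (s≤s (s≤s ())))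

-- A vertex contributes its whole weight to its own deletion, and at least `α` or `β` per arc to the
-- deletion of an out- or in-neighbour. The field `enough` says that these contributions cover the
-- cost of its own deletion.
record Rate (o i α β : ℕ) : Set where
  field
    out-rate : ∀ o' m → m + o' ≡ o → φ o' i + m * α ≤ φ o i
    inn-rate : ∀ i' m → m + i' ≡ i → φ o i' + m * β ≤ φ o i
    enough   : (o ⊓ i) * 8700 ≤ φ o i + o * α + i * β

rate-sym : ∀ {o i α β} → Rate o i α β → Rate i o β α
rate-sym {o} {i} {α} {β} r = record
  { out-rate = λ o' m e → subst₂ (λ k l → k + m * β ≤ l) (φ-sym o o') (φ-sym o i) (inn-rate o' m e)
  ; inn-rate = λ i' m e → subst₂ (λ k l → k + m * α ≤ l) (φ-sym i' i) (φ-sym o i) (out-rate i' m e)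
  ; enough = subst₂ _≤_ (cong (_* 8700) (⊓-comm o i))
      (trans (+-assoc (φ o i) _ _) (trans (cong₂ _+_ (φ-sym o i) (+-comm (o * α) _)) (sym (+-assoc (φ i o) _ _)))) enough
  }
  where open Rate r

rate-21+ : ∀ o → Rate (4 + o) 1 0 5289
rate-21+ o = record
  { out-rate = λ o' m e → ≤-trans (≤-reflexive (trans (cong (φ o' 1 +_) (*-zeroʳ m)) (+-identityʳ _)))
      (φ-mono (inj₂ (s≤s z≤n)) (≤-trans (m≤n+m o' m) (≤-reflexive e)) ≤-refl)
  ; inn-rate = lose
  ; enough = linear (φ (4 + o) 1 ∷ (4 + o) * 0 ∷ []) (hyp 1 (con 5289) x₀ (φ-≥5289 o) ∷ []) (con 8700) (x₀ ⊕ x₁ ⊕ con 5289)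
  }
  where
  lose : ∀ i' m → m + i' ≡ 1 → φ (4 + o) i' + m * 5289 ≤ φ (4 + o) 1
  lose 0 1 e rewrite φ-0ʳ (4 + o) = φ-≥5289 o
  lose 1 0 e = ≤-reflexive (+-identityʳ _)
  lose 0 0 ()
  lose 0 (suc (suc m)) ()
  lose (suc i') (suc m) e with () ← trans (sym (+-suc m i')) (cong pred e)
  lose (suc (suc i')) 0 ()

rate-31 : Rate 3 1 414 3729
rate-31 = record { out-rate = out-414 ; inn-rate = lose
  ; enough = linear (φ 3 1 ∷ []) (hyp 1 (con 3729) x₀ (≤-reflexive (sym φ-31)) ∷ []) (con 8700) (x₀ ⊕ con 1242 ⊕ con 3729) }
  where
  lose : ∀ i' m → m + i' ≡ 1 → φ 3 i' + m * 3729 ≤ φ 3 1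
  lose 0 1 e rewrite φ-0ʳ 3 | φ-31 = ≤-refl
  lose 1 0 e = ≤-reflexive (+-identityʳ _)
  lose 0 0 ()
  lose 0 (suc (suc m)) ()
  lose (suc i') (suc m) e with () ← trans (sym (+-suc m i')) (cong pred e)
  lose (suc (suc i')) 0 ()

rate-22 : Rate 2 2 2822 2822
rate-22 = record
  { out-rate = λ o' m e → subst (λ k → k + m * 2822 ≤ φ 2 2) (φ-sym 2 o') (lose o' m e)
  ; inn-rate = lose
  ; enough = linear (φ 2 2 ∷ []) (hyp 1 (con 6114) x₀ (≤-reflexive (sym φ-22)) ∷ []) (con 17400) (x₀ ⊕ con 5644 ⊕ con 5644) }
  where
  lose : ∀ i' m → m + i' ≡ 2 → φ 2 i' + m * 2822 ≤ φ 2 2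
  lose 0 2 e rewrite φ-0ʳ 2 | φ-22 = num≤
  lose 1 1 e = in-2822 2 1 ≤-refl ≤-refl
  lose 2 0 e = ≤-reflexive (+-identityʳ _)
  lose 0 0 ()
  lose 0 1 ()
  lose 0 (suc (suc (suc m))) ()
  lose 1 0 ()
  lose 1 (suc (suc m)) e with () ← trans (sym (+-suc m 0)) (cong (pred ∘ pred) e)
  lose (suc (suc i')) (suc m) e with () ← trans (sym (+-suc m i')) (cong pred (trans (sym (+-suc m (suc i'))) (cong pred e)))
  lose (suc (suc (suc i'))) 0 ()

-- Since 1086 = 7200 - 6114 and 3471 = 7200 - 3729, the balance 7200 + 3 * 1086 + 2 * 3471 = 17400
-- of type (3 , 2) determines 7200 from the weights of (2 , 2) and (3 , 1).
rate-32+ : ∀ o → Rate (3 + o) 2 1086 3471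
rate-32+ o = record { out-rate = λ o' m → out-1086 o' m ; inn-rate = lose
  ; enough = linear (φ (3 + o) 2 ∷ o ∷ []) (hyp 1 (con 7200) x₀ (φ-≥7200 o) ∷ []) (con 17400) (x₀ ⊕ (con 3 ⊕ x₁) ⊛ 1086 ⊕ con 6942) }
  where
  lose : ∀ i' m → m + i' ≡ 2 → φ (3 + o) i' + m * 3471 ≤ φ (3 + o) 2
  lose 0 2 e rewrite φ-0ʳ (3 + o) = ≤-trans num≤ (φ-≥7200 o)
  lose 1 1 e = in-3471 o
  lose 2 0 e = ≤-reflexive (+-identityʳ _)
  lose 0 0 ()
  lose 0 1 ()
  lose 0 (suc (suc (suc m))) ()
  lose 1 0 ()
  lose 1 (suc (suc m)) e with () ← trans (sym (+-suc m 0)) (cong (pred ∘ pred) e)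
  lose (suc (suc i')) (suc m) e with () ← trans (sym (+-suc m i')) (cong pred (trans (sym (+-suc m (suc i'))) (cong pred e)))
  lose (suc (suc (suc i'))) 0 ()

-- The arcs between two vertices of an oriented graph all have the same direction, so deleting a
-- neighbour touches one side only and the one-sided rates suffice.
via-in : ∀ {o i o' i' a b α β} → a ≡ 0 → o' + a ≡ o → i' + b ≡ i → Rate o i α β →
         φ o' i' + (a * α + b * β) ≤ φ o i
via-in {o' = o'} {b = b} refl refl refl r rewrite +-identityʳ o' = Rate.inn-rate r _ b (+-comm b _)

via-out : ∀ {o i o' i' a b α β} → b ≡ 0 → o' + a ≡ o → i' + b ≡ i → Rate o i α β →
          φ o' i' + (a * α + b * β) ≤ φ o i
via-out {i' = i'} {a = a} {α = α} refl refl refl r rewrite +-identityʳ i' | +-identityʳ (a * α) =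
  Rate.out-rate r _ a (+-comm a _)

-- Eliminating type (1 , 1), and how far deletions fall short

module _ {n : ℕ} where

  open State

  del-rev : ∀ w (M : Graph n) x y → del w (rev M) x y ≡ del w M y x
  del-rev w M x y with x ≟ w | y ≟ w
  ... | yes _ | yes _ = refl
  ... | yes _ | no _  = refl
  ... | no _  | yes _ = refl
  ... | no _  | no _  = refl

  ω-del-rev : ∀ w (M : Graph n) x → ω (del w (rev M)) x ≡ ω (del w M) x
  ω-del-rev w M x = trans (cong₂ φ (sum-cong-≗ (λ y → del-rev w M x y)) (sum-cong-≗ (λ y → del-rev w M y x)))
    (φ-sym (inn (del w M) x) (out (del w M) x))

  module Elim11 {M : Graph n} (s : State M) {u v w} (uv : M u v ≡ 1) (only-u : ∀ x → x ≢ u → M x v ≡ 0)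
                (ov : out M v ≡ 1) (vw : M v w ≡ 1) where

    open Contract s uv only-u public

    only-w : ∀ x → x ≢ w → M v x ≡ 0
    only-w = others-zero (M v) w (+-cancelʳ-≡ 1 _ 0
      (trans (cong (sum (except w (M v)) +_) (sym vw)) (trans (sum-except (M v) w) ov)))

    v-2900 : 2900 ≤ ω M v
    v-2900 = subst (2900 ≤_) (sym (cong₂ φ ov innv)) (φ-≥2900 0 0 (inj₁ (s≤s z≤n)))

    module Free (wu : M w u ≡ 0) where

      tri : ∀ y → 1 ≤ M v y → M y u ≡ 0
      tri y p with y ≟ w
      ... | yes refl = wu
      ... | no q with () ← subst (1 ≤_) (only-w y q) p

      out-eq : out C u ≡ out M u
      out-eq = +-cancelʳ-≡ 1 _ _ (trans out-u (cong (out M u +_) ov))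

      open NoTriangle tri (subst (λ k → Thin k (inn M u)) (sym out-eq) (thin s u)) public

      Φ-C : Φ C + 2900 ≤ Φ M
      Φ-C = gains ((v , 2900) ∷ []) le (subst (λ k → k + 2900 ≤ ω M v) (sym ω-v) v-2900 , [] , tt)
        where
        le : ∀ x → ω C x ≤ ω M x
        le x = by (x ≟ u) (x ≟ v)
          where
          by : Dec (x ≡ u) → Dec (x ≡ v) → ω C x ≤ ω M x
          by (yes refl) _ = ≤-reflexive (cong₂ φ out-eq (inn-x u≢v))
          by (no _) (yes refl) = ≤-trans (≤-reflexive ω-v) z≤n
          by (no p) (no q) = ≤-reflexive (cong₂ φ (out-x p q) (inn-x q))

    module Blocked (wu : 1 ≤ M w u) where

      tri : ∀ y → y ≢ w → 1 ≤ M v y → M y u ≡ 0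
      tri y q p with () ← subst (1 ≤_) (only-w y q) p

      open Triangle vw wu tri public

      K-u : out K u + 1 ≡ out M u
      K-u = +-cancelʳ-≡ 1 _ _ (trans (+-assoc (out K u) 1 1) (trans K-out-u (cong (out M u +_) ov)))

      open-K : out K u ≤ out M u
      open-K = ≤-from-+ K-u

      Φ-K : ∀ cu cw → ω K u + cu ≤ ω M u → ω K w + cw ≤ ω M w → Φ K + (0 + cw + 2900 + cu) ≤ Φ M
      Φ-K cu cw gu gw = gains ((u , cu) ∷ (v , 2900) ∷ (w , cw) ∷ []) (ω-K-≤ open-K)
        ( gu , ((u≢v ∘ sym) ∷ (u≢w ∘ sym) ∷ [])
        , subst (λ k → k + 2900 ≤ ω M v) (sym ω-K-v) v-2900 , ((v≢w ∘ sym) ∷ [])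
        , gw , [] , tt)

  -- Contraction alone is free. If it closes a triangle, each of the three vertices gives 2900,
  -- which pays for the cancellation exactly.
  eliminate-11 : ∀ {M : Graph n} (s : State M) → IH M → ∀ v → out M v ≡ 1 → inn M v ≡ 1 → Good M (Φ M)
  eliminate-11 {M} s ih v ov iv with sum-one (λ x → M x v) iv | sum-one (M v) ov
  ... | u , uv , only-u | w , vw , _ = by (pos (M w u))
    where
    open Elim11 s uv only-u ov vw
    by : M w u ≡ 0 ⊎ 1 ≤ M w u → Good M (Φ M)
    by (inj₁ e) = good-≤ {M = M} (≤-trans (m≤m+n (Φ C) 2900) Φ-C) (good-C (ih C size-C state-C))
      where open Free e
    by (inj₂ t) = good-≤ {M = M}
      (Φ-K 2900 2900 (φ-diag (thin s u) (<-from-+ K-u ≤-refl) (<-from-+ K-inn-u ≤-refl))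
                     (φ-diag (thin s w) (<-from-+ K-out-w ≤-refl) (<-from-+ K-inn-w ≤-refl)))
      (good-K (ih K size-K (state-K open-K)))
      where open Blocked t

  -- X M w bounds what deleting w achieves, e M w by how much it falls short.
  X e : Graph n → Fin n → ℕ
  X M w = Φ (del w M) + (out M w ⊓ inn M w) * 8700
  e M w = X M w ∸ (Φ M + 1)

  X-rev : ∀ M w → X (rev M) w ≡ X M w
  X-rev M w = cong₂ (λ k l → k + l * 8700) (sum-cong-≗ (ω-del-rev w M)) (⊓-comm (inn M w) (out M w))

  e-rev : ∀ M w → e (rev M) w ≡ e M w
  e-rev M w = cong₂ (λ k l → k ∸ (l + 1)) (X-rev M w) (Φ-rev M)

  -- If X M w > Φ M + c, the excess is at least c + 1. The definition of `e` sets aside the extra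
  -- unit, which makes the final count strict.
  shortfall : ∀ {M : Graph n} w c → (X M w ≤ Φ M + c → Good M (Φ M)) → Good M (Φ M) ⊎ c ≤ e M w
  shortfall {M} w c f with X M w ℕ.≤? Φ M + c
  ... | yes p = inj₁ (f p)
  ... | no p  = inj₂ (m+n≤o⇒m≤o∸n c (≤-trans (≤-reflexive (trans (+-comm c _) (trans (+-assoc (Φ M) 1 c)
                  (+-suc (Φ M) c)))) (≰⇒> p)))

  -- If `del w M` beats its weight by `c`, then deleting `w` may miss the target by as much as `c`.
  bonus : ∀ {M : Graph n} {w c B} → Good (del w M) B → B + c ≤ Φ (del w M) → X M w ≤ Φ M + c → Good M (Φ M)
  bonus {M} {w} {c} {B} g p q = good-≤ {M = M} (+-cancelʳ-≤ c _ _ (begin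
    B + cost + c           ≡⟨ +-assoc B cost c ⟩
    B + (cost + c)         ≡⟨ cong (B +_) (+-comm cost c) ⟩
    B + (c + cost)         ≡⟨ +-assoc B c cost ⟨
    B + c + cost           ≤⟨ +-monoˡ-≤ cost p ⟩
    Φ (del w M) + cost     ≤⟨ q ⟩
    Φ M + c                ∎)) (good-del g)
    where
    open ≤-Reasoning
    cost : ℕ
    cost = (out M w ⊓ inn M w) * 8700

  d : Graph n → Fin n → Fin n → ℕ
  d M x w = ω M x ∸ ω (del w M) x

  d-≥ : ∀ {M : Graph n} {x w c} → ω (del w M) x + c ≤ ω M x → c ≤ d M x w
  d-≥ {M} {x} {w} {c} p = m+n≤o⇒m≤o∸n c (≤-trans (≤-reflexive (+-comm c _)) p)

  d-rev : ∀ M x w → d (rev M) x w ≡ d M x w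
  d-rev M x w = cong₂ _∸_ (φ-sym (inn M x) (out M x)) (ω-del-rev w M x)

  module Links {M : Graph n} (s : State M) (ih : IH M)
               (live-out : ∀ x → 1 ≤ inn M x → 1 ≤ out M x) (live-in : ∀ x → 1 ≤ out M x → 1 ≤ inn M x)
               (no11 : ∀ x → out M x ≡ 1 → inn M x ≡ 1 → ⊥) where

    open Step s ih live-out live-in no11

    module Link {u v w₁ w₂} (S : Site u v w₁ w₂) where

      open AtSite S
      module F = AtSite (flip S)

      -- Without w₁, the vertex v has type (1 , 1).
      M′ : Graph n
      M′ = del w₁ M

      s′ : State M′
      s′ = state-del w₁ s

      uv′ : M′ u v ≡ 1
      uv′ = trans (del-off M u≢w₁ v≢w₁) uv

      vw′ : M′ v w₂ ≡ 1
      vw′ = trans (del-off M v≢w₁ (w₁≢w₂ ∘ sym)) vw₂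

      only-u′ : ∀ x → x ≢ u → M′ x v ≡ 0
      only-u′ x p = n≤0⇒n≡0 (≤-trans (del-≤ w₁ M x v) (≤-reflexive (only-u x p)))

      ov′ : out M′ v ≡ 1
      ov′ = +-cancelʳ-≡ 1 _ 1 (trans (cong (out M′ v +_) (sym vw₁)) (trans (out-del M v≢w₁) ov))

      M′-wu : M′ w₂ u ≡ M w₂ u
      M′-wu = del-off M (w₁≢w₂ ∘ sym) u≢w₁

      size′ : size M′ < size M
      size′ = size-del {M = M} v (≤-reflexive (sym vw₁))

      open Elim11 s′ uv′ only-u′ ov′ vw′

      -- The saving is the weight of `v`, which has type (1 , 1) once `w₁` is gone and is contracted
      -- for free.
      contract-link : M w₂ u ≡ 0 → Good M (Φ M) ⊎ 2900 ≤ e M w₁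
      contract-link t = shortfall w₁ 2900 (bonus {M} {w₁} {2900} (good-C (ih C (<-trans size-C size′) state-C)) Φ-C)
        where open Free (trans M′-wu t)

      -- Here the contraction needs a cancellation. The gains at `u`, `v` and `w₂` leave 3729 + 2900
      -- + 3214 - 8700 = 1143.
      triangle-link : 1 ≤ M w₂ u → M w₁ u ≡ 0 → out M u ≡ 2 → 3 ≤ inn M u →
                      (out M′ w₂ ≡ 1 → inn M′ w₂ ≡ 1 → ⊥) → Good M (Φ M) ⊎ 1143 ≤ e M w₁
      triangle-link t t₁ ou iu ne = shortfall w₁ 1143 (bonus {M} {w₁} {1143}
        (good-K (ih K (<-trans size-K size′) (state-K open-K)))
        (≤-trans (≤-reflexive (+-assoc (Φ K) 8700 1143)) (Φ-K 3729 3214 gu gw)))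
        where
        open Blocked (subst (1 ≤_) (sym M′-wu) t)
        inn-u≥3 : 3 ≤ inn M′ u
        inn-u≥3 = ≤-trans iu (≤-reflexive (trans (sym (inn-del M u≢w₁)) (trans (cong (inn M′ u +_) t₁) (+-identityʳ _))))
        out-u≥1 : 1 ≤ out M′ u
        out-u≥1 = out-pos {M = M′} {u} {v} (≤-reflexive (sym uv′))
        out-u≤2 : out M′ u ≤ 2
        out-u≤2 = ≤-trans (sum-mono (del-≤ w₁ M u)) (≤-reflexive ou)
        gu : ω K u + 3729 ≤ ω M′ u
        gu = φ-diag-3729 (small (inj₁ out-u≤2) out-u≥1 (≤-trans (s≤s out-u≤2) inn-u≥3))
          (λ _ e₂ → <⇒≢ inn-u≥3 (sym e₂)) (<-from-+ K-u ≤-refl) (<-from-+ K-inn-u ≤-refl)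
        gw : ω K w₂ + 3214 ≤ ω M′ w₂
        gw = φ-diag-3214 (thin s′ w₂) ne (<-from-+ K-out-w ≤-refl) (<-from-+ K-inn-w ≤-refl)

  -- By κ-bound, the shares that w gives away add up to at most 6 * e M w.
  share : Graph n → Fin n → Fin n → ℕ
  share M x w = (M x w * κ (out M w) (inn M w) + M w x * κ (inn M w) (out M w)) * e M w

  -- The local balance of `x` multiplied by 6, the scale of `κ`: 52200 = 6 * 8700. The sum over
  -- `d M x` is what `x` loses in all deletions together.
  Claim : Graph n → Fin n → Set
  Claim M x = (out M x ⊓ inn M x) * 52200 ≤ sum (d M x) * 6 + sum (share M x)

  claim-rev : ∀ {M : Graph n} {x} → Claim (rev M) x → Claim M x
  claim-rev {M} {x} = subst₂ _≤_ (cong (_* 52200) (⊓-comm (inn M x) (out M x)))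
    (cong₂ (λ k l → k * 6 + l) (sum-cong-≗ (d-rev M x))
      (sum-cong-≗ (λ w → cong₂ _*_ (+-comm (M w x * κ (inn M w) (out M w)) _) (e-rev M w))))

  claim-from : ∀ {M : Graph n} {x} → (out M x ⊓ inn M x) * 8700 ≤ sum (d M x) → Claim M x
  claim-from {M} {x} p = linear (out M x ⊓ inn M x ∷ sum (d M x) ∷ sum (share M x) ∷ [])
    (hyp 6 (x₀ ⊛ 8700) x₁ p ∷ []) (x₀ ⊛ 52200) (x₁ ⊛ 6 ⊕ x₂)

  -- The function `g` spreads the right-hand side of `enough` over the deleted vertices `w`: the
  -- full weight for w = x, and `α` or `β` for each arc between `x` and `w`.
  claim-rate : ∀ {M : Graph n} (s : State M) {x α β} → Rate (out M x) (inn M x) α β → Claim M x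
  claim-rate {M} s {x} {α} {β} r = claim-from {M} {x} (≤-trans enough (≤-trans (≤-reflexive total-g) (sum-mono (λ w → le w (w ≟ x)))))
    where
    open Rate r
    g : Fin n → ℕ
    g w = δ x (ω M x) w + M x w * α + M w x * β
    total-g : ω M x + out M x * α + inn M x * β ≡ sum g
    total-g = sym (trans (∑-distrib-+ (λ w → δ x (ω M x) w + M x w * α) (λ w → M w x * β))
      (cong₂ _+_ (trans (∑-distrib-+ (δ x (ω M x)) (λ w → M x w * α)) (cong₂ _+_ (sum-δ x (ω M x)) (sum-* (M x) α)))
                 (sum-* (λ w → M w x) β)))
    le : ∀ w → Dec (w ≡ x) → g w ≤ d M x w
    le w (yes refl) = d-≥ {M} {w} {w} (≤-reflexive (trans
      (cong₂ _+_ (trans (cong (λ k → φ k (inn (del w M) w)) (out-del-self w M)) (φ-0ˡ _))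
        (cong₂ (λ k l → k + l * α + l * β) (δ-same w (ω M w)) (loopless s w)))
      (trans (+-identityʳ _) (+-identityʳ _))))
    le w (no p) = d-≥ {M} {x} {w} (≤-trans (≤-reflexive (cong (λ k → ω (del w M) x + (k + M x w * α + M w x * β)) (δ-diff (ω M x) p)))
      (by (pos (M x w)) (out-del M (p ∘ sym)) (inn-del M (p ∘ sym))))
      where
      by : M x w ≡ 0 ⊎ 1 ≤ M x w → out (del w M) x + M x w ≡ out M x → inn (del w M) x + M w x ≡ inn M x →
           ω (del w M) x + (M x w * α + M w x * β) ≤ ω M x
      by (inj₁ e) eo ei = via-in e eo ei r
      by (inj₂ q) eo ei = via-out (oriented s q) eo ei r

  module Claims {M : Graph n} (s : State M) (ih : IH M)
                (live-out : ∀ x → 1 ≤ inn M x → 1 ≤ out M x) (live-in : ∀ x → 1 ≤ out M x → 1 ≤ inn M x)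
                (no11 : ∀ x → out M x ≡ 1 → inn M x ≡ 1 → ⊥) where

    open Step s ih live-out live-in no11
    open Links s ih live-out live-in no11

    d-self : ∀ x → ω M x ≤ d M x x
    d-self x = d-≥ {M} {x} {x} (≤-reflexive (cong (_+ ω M x) (ω-dead {N = del x M} {x} (out-del-self x M))))

    d-full : ∀ {x w} → x ≢ w → out M x ≡ M x w ⊎ inn M x ≡ M w x → ω M x ≤ d M x w
    d-full {x} {w} p q = d-≥ {M} {x} {w} (≤-reflexive (cong (_+ ω M x) (zero-ω q)))
      where
      zero-ω : out M x ≡ M x w ⊎ inn M x ≡ M w x → ω (del w M) x ≡ 0
      zero-ω (inj₁ e) = ω-dead {N = del w M} {x} (+-cancelʳ-≡ (M x w) _ 0 (trans (out-del M p) e))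
      zero-ω (inj₂ e) = trans (cong (φ (out (del w M) x)) (+-cancelʳ-≡ (M w x) _ 0 (trans (inn-del M p) e))) (φ-0ʳ _)

    sum-d : ∀ {x} L → Gains (λ _ → 0) (d M x) L → total L ≤ sum (d M x)
    sum-d {x} L g = ≤-trans (m≤n+m (total L) (sum {n} (λ _ → 0))) (gains {f = λ _ → 0} {d M x} L (λ _ → z≤n) g)

    module AtStuck {u v w₁ w₂} (S : Site u v w₁ w₂) where

      open AtSite S
      module F = AtSite (flip S)
      module B₁ = Link S
      module B₂ = Link (flip S)

      k₁ k₂ : ℕ
      k₁ = κ (out M w₁) (inn M w₁)
      k₂ = κ (out M w₂) (inn M w₂)

      -- 7992 = 6 * (8700 - 7368) is the deficit of `v` in `claim-21` on the scale of `Claim`.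
      Enough : Set
      Enough = 7992 ≤ k₁ * e M w₁ + k₂ * e M w₂

      both : ∀ {b c} → Good M (Φ M) ⊎ b ≤ e M w₁ → Good M (Φ M) ⊎ c ≤ e M w₂ → 2 ≤ k₁ → 2 ≤ k₂ →
             7992 ≤ 2 * b + 2 * c → Good M (Φ M) ⊎ Enough
      both (inj₁ g) _ _ _ _ = inj₁ g
      both (inj₂ _) (inj₁ g) _ _ _ = inj₁ g
      both (inj₂ p) (inj₂ q) r₁ r₂ num = inj₂ (≤-trans num (+-mono-≤ (*-mono-≤ r₁ p) (*-mono-≤ r₂ q)))

      triple : 3 ≤ k₁ → 2900 ≤ e M w₁ → Enough
      triple p q = ≤-trans (≤-trans (num≤ {7992} {8700}) (*-mono-≤ p q)) (m≤m+n (k₁ * e M w₁) _)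

      -- Both out-arcs of `w₂` lead to `w₁`, so deleting `w₁` at cost 8700 also frees the whole
      -- weight of `w₂`: 3729 + 7200.
      doubled : out M w₁ ≡ 1 → 3 ≤ inn M w₁ → 2 ≤ M w₂ w₁ → Small3 (out M w₂) (inn M w₂) → Good M (Φ M)
      doubled ow iw≥3 ww (sm , _) = settle {M = M} {B₁.M′} {ω B₁.M′} L (≤-reflexive (+-identityʳ (Φ B₁.M′)))
        (gains L (ω-mono s (del-≤ w₁ M))
          ( dead-gain {N = B₁.M′} {M} (out-del-self w₁ M) (subst (λ k → 3729 ≤ φ k (inn M w₁)) (sym ow) (φ-1≥3′ iw≥3))
          , ((w₁≢w₂ ∘ sym) ∷ [])
          , dead-gain {N = B₁.M′} {M} out0 (big sm refl refl) , [] , tt))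
        num≤ (subst (λ k → Good M (Φ B₁.M′ + k * 8700)) ow (good-del-out (ih B₁.M′ B₁.size′ B₁.s′)))
        where
        L : List (Fin n × ℕ)
        L = (w₁ , 3729) ∷ (w₂ , 7200) ∷ []
        2≤o : 2 ≤ out M w₂
        2≤o = ≤-trans ww (term≤sum (M w₂) w₁)
        out0 : out B₁.M′ w₂ ≡ 0
        out0 = n≤0⇒n≡0 (+-cancelʳ-≤ 2 _ 0 (≤-trans (+-monoʳ-≤ (out B₁.M′ w₂) ww)
          (≤-trans (≤-reflexive (out-del M (w₁≢w₂ ∘ sym))) (small-out sm))))
        big : ∀ {o i} → Small o i → o ≡ out M w₂ → i ≡ inn M w₂ → 7200 ≤ ω M w₂
        big ⟨1,2⟩ p q with s≤s () ← ≤-trans 2≤o (≤-reflexive (sym p))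
        big ⟨1,3+ i ⟩ p q with s≤s () ← ≤-trans 2≤o (≤-reflexive (sym p))
        big ⟨2,3+ i ⟩ p q = subst₂ (λ k l → 7200 ≤ φ k l) p q (φ-2≥3 i)

      -- If `w₁` has type (1 , 2) it gives three times 2900 and suffices alone. Otherwise the two
      -- links give 2 * 2900 + 2 * 1143 = 8086, provided that deleting `w₂` does not turn `w₁` into
      -- type (1 , 1).
      one : out M u ≡ 2 → 3 ≤ inn M u → 1 ≤ M w₁ u → M w₂ u ≡ 0 →
            Small3 (out M w₁) (inn M w₁) → Small3 (out M w₂) (inn M w₂) → Good M (Φ M) ⊎ Enough
      one ou iu t₁ t₂ sm₁ sm₂ = cases (proj₁ sm₁) refl refl
        where
        e₁ : Good M (Φ M) ⊎ 2900 ≤ e M w₁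
        e₁ = B₁.contract-link t₂
        e₂ : (out B₂.M′ w₁ ≡ 1 → inn B₂.M′ w₁ ≡ 1 → ⊥) → Good M (Φ M) ⊎ Enough
        e₂ ne = both e₁ (B₂.triangle-link t₁ t₂ ou iu ne) (κ-small sm₁) (κ-small sm₂) (num≤ {7992} {8086})
        out-eq : out B₂.M′ w₁ + M w₁ w₂ ≡ out M w₁
        out-eq = out-del M w₁≢w₂
        inn-eq : inn B₂.M′ w₁ + M w₂ w₁ ≡ inn M w₁
        inn-eq = inn-del M w₁≢w₂
        cases : ∀ {o i} → Small o i → o ≡ out M w₁ → i ≡ inn M w₁ → Good M (Φ M) ⊎ Enough
        cases ⟨1,2⟩ p q = Sum.map₂ (triple (≤-reflexive (cong₂ κ p q))) e₁
        cases ⟨1,3+ i ⟩ p q = by (M w₂ w₁ ℕ.≤? 1)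
          where
          by : Dec (M w₂ w₁ ≤ 1) → Good M (Φ M) ⊎ Enough
          -- From in-degree at least 3, type (1 , 1) can be reached only through parallel arcs from
          -- `w₂` to `w₁`.
          by (no m≰1) = inj₁ (doubled (sym p) (≤-trans (m≤m+n 3 i) (≤-reflexive q)) (≰⇒> m≰1) sm₂)
          by (yes m≤1) = e₂ (λ _ i≡1 → <⇒≱ (s≤s (s≤s (s≤s z≤n))) (≤-trans (≤-reflexive (trans q (sym inn-eq)))
            (+-mono-≤ (≤-reflexive i≡1) m≤1)))
        cases ⟨2,3+ i ⟩ p q = e₂ ne
          where
          ne : out B₂.M′ w₁ ≡ 1 → inn B₂.M′ w₁ ≡ 1 → ⊥
          -- From (2 , ≥ 3), reaching (1 , 1) would require arcs in both directions between `w₁` and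
          -- `w₂`.
          ne o≡1 i≡1 = 0≢1+n (trans (sym (oriented′ s w₁w₂)) w₂w₁)
            where
            w₁w₂ : M w₁ w₂ ≡ 1
            w₁w₂ = suc-inj (trans (cong (_+ M w₁ w₂) (sym o≡1)) (trans out-eq (sym p)))
              where
              suc-inj : ∀ {k} → 1 + k ≡ 2 → k ≡ 1
              suc-inj = cong pred
            w₂w₁ : M w₂ w₁ ≡ 2 + i
            w₂w₁ = cong pred (trans (cong (_+ M w₂ w₁) (sym i≡1)) (trans inn-eq (sym q)))

      none : M w₁ u ≡ 0 → M w₂ u ≡ 0 → Small3 (out M w₁) (inn M w₁) → Small3 (out M w₂) (inn M w₂) →
             Good M (Φ M) ⊎ Enough
      none t₁ t₂ sm₁ sm₂ =
        both (B₁.contract-link t₂) (B₂.contract-link t₁) (κ-small sm₁) (κ-small sm₂) (num≤ {7992} {11600})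

    stuck : ∀ {u v w₁ w₂} (S : Site u v w₁ w₂) → Decide.Stuck S → Good M (Φ M) ⊎ AtStuck.Enough S
    stuck {u} {v} {w₁} {w₂} S K = by tri (pos (M w₁ u)) (pos (M w₂ u))
      where
      open Decide.Stuck K
      swapped : Good M (Φ M) ⊎ AtStuck.Enough (flip S) → Good M (Φ M) ⊎ AtStuck.Enough S
      swapped (inj₁ g) = inj₁ g
      swapped (inj₂ h) = inj₂ (≤-trans h (≤-reflexive (+-comm (κ (out M w₂) (inn M w₂) * e M w₂) _)))
      by : M w₁ u ≡ 0 ⊎ M w₂ u ≡ 0 → M w₁ u ≡ 0 ⊎ 1 ≤ M w₁ u → M w₂ u ≡ 0 ⊎ 1 ≤ M w₂ u →
           Good M (Φ M) ⊎ AtStuck.Enough S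
      by _ (inj₁ t₁) (inj₁ t₂) = AtStuck.none S t₁ t₂ small₁ small₂
      by _ (inj₂ t₁) (inj₁ t₂) = AtStuck.one S ou iu t₁ t₂ small₁ small₂
      by _ (inj₁ t₁) (inj₂ t₂) = swapped (AtStuck.one (flip S) ou iu t₂ t₁ small₂ small₁)
      by (inj₁ t) (inj₂ t₁) (inj₂ _) with () ← subst (1 ≤_) t t₁
      by (inj₂ t) (inj₂ _) (inj₂ t₂) with () ← subst (1 ≤_) t t₂

    -- With parallel out-arcs to one vertex, three deletions each remove all the weight of `v`, and
    -- 3 * 3292 exceeds 8700. With distinct out-neighbours, `v` collects 2 * 3292 + 2 * 392 = 7368
    -- and relies on the shares of `w₁` and `w₂` for the rest.
    claim-21 : ∀ v → out M v ≡ 2 → inn M v ≡ 1 → Good M (Φ M) ⊎ Claim M v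
    claim-21 v ov iv with sum-one (λ x → M x v) iv | sum-two (M v) ov
    ... | u , uv , only-u | inj₁ (w , vw , _) = inj₂ (claim-from {M} {v}
            (≤-trans (≤-reflexive (cong₂ (λ k l → (k ⊓ l) * 8700) ov iv)) (≤-trans num≤ (sum-d L
              ( ≤-trans ωv (d-self v) , (u≢v ∷ (w≢v ∷ []))
              , ≤-trans ωv (d-full (u≢v ∘ sym) (inj₂ (trans iv (sym uv)))) , (w≢u ∷ [])
              , ≤-trans ωv (d-full (w≢v ∘ sym) (inj₁ (trans ov (sym vw)))) , [] , tt)))))
      where
      L : List (Fin n × ℕ)
      L = (v , 3292) ∷ (u , 3292) ∷ (w , 3292) ∷ []
      vw≥1 : 1 ≤ M v w
      vw≥1 = ≤-trans (s≤s z≤n) (≤-reflexive (sym vw))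
      u≢v : u ≢ v
      u≢v = arc-≢ s (≤-reflexive (sym uv))
      w≢v : w ≢ v
      w≢v = arc-≢ s vw≥1 ∘ sym
      w≢u : w ≢ u
      w≢u refl with () ← subst (1 ≤_) (oriented′ s uv) vw≥1
      ωv : 3292 ≤ ω M v
      ωv = ≤-reflexive (sym (trans (cong₂ φ ov iv) φ-21))
    ... | u , uv , only-u | inj₂ (w₁ , w₂ , w₁≢w₂ , vw₁ , vw₂ , only-w) = by (Decide.decide S)
      where
      S : Site u v w₁ w₂
      S = record { uv = uv ; iv = iv ; ov = ov ; vw₁ = vw₁ ; vw₂ = vw₂ ; w₁≢w₂ = w₁≢w₂ ; only-w = only-w }
      open AtSite S using (u≢v; ωv; u≢w₁; v≢w₁)
      module F = AtSite (flip S)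
      L : List (Fin n × ℕ)
      L = (v , 3292) ∷ (u , 3292) ∷ (w₁ , 392) ∷ (w₂ , 392) ∷ []
      lose-out : ∀ {w} → v ≢ w → M v w ≡ 1 → 392 ≤ d M v w
      lose-out {w} v≢w vw = d-≥ {M} {v} {w} (drop {del w M} v 1 0
        (trans (cong (out (del w M) v +_) (sym vw)) (out-del M v≢w))
        (trans (cong (inn (del w M) v +_) (sym (oriented′ s vw))) (inn-del M v≢w)))
      d≥ : 7368 ≤ sum (d M v)
      d≥ = sum-d L
        ( ≤-trans (≤-reflexive (sym ωv)) (d-self v) , (u≢v ∷ (v≢w₁ ∘ sym) ∷ (F.v≢w₁ ∘ sym) ∷ [])
        , ≤-trans (≤-reflexive (sym ωv)) (d-full (u≢v ∘ sym) (inj₂ (trans iv (sym uv))))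
        , ((u≢w₁ ∘ sym) ∷ (F.u≢w₁ ∘ sym) ∷ [])
        , lose-out v≢w₁ vw₁ , ((w₁≢w₂ ∘ sym) ∷ []) , lose-out F.v≢w₁ vw₂ , [] , tt)
      share-≥ : ∀ {w} → M v w ≡ 1 → κ (out M w) (inn M w) * e M w ≤ share M v w
      share-≥ {w} vw = *-monoˡ-≤ (e M w) (≤-trans (≤-reflexive (sym (trans (cong (_* κ (out M w) (inn M w)) vw)
        (+-identityʳ _)))) (m≤m+n _ _))
      by : Good M (Φ M) ⊎ Decide.Stuck S → Good M (Φ M) ⊎ Claim M v
      by (inj₁ g) = inj₁ g
      by (inj₂ K) = Sum.map₂ (λ h → ≤-trans (≤-reflexive (cong₂ (λ k l → (k ⊓ l) * 52200) ov iv))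
              (linear (sum (d M v) ∷ sum (share M v) ∷ []) (hyp 6 (con 7368) x₀ d≥ ∷ hyp 1 (con 7992) x₁
                (≤-trans h (≤-trans (+-mono-≤ (share-≥ vw₁) (share-≥ vw₂)) (two-terms (share M v) w₁≢w₂))) ∷ [])
                (con 52200) (x₀ ⊛ 6 ⊕ x₁))) (stuck S K)

-- Averaging over all deletions, and the induction

decide-all : ∀ {m} {G : Set} {P : Fin m → Set} → (∀ x → G ⊎ P x) → G ⊎ (∀ x → P x)
decide-all {zero}  f = inj₂ (λ ())
decide-all {suc m} {G} {P} f = combine (f zero) (decide-all (f ∘ suc))
  where
  combine : G ⊎ P zero → G ⊎ (∀ x → P (suc x)) → G ⊎ (∀ x → P x)
  combine (inj₁ g) _        = inj₁ g
  combine (inj₂ _) (inj₁ g) = inj₁ g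
  combine (inj₂ p) (inj₂ q) = inj₂ (λ { zero → p ; (suc x) → q x })

module _ {n : ℕ} where

  open State

  module Averaging {M : Graph n} (s : State M) (ih : IH M)
                   (live-out : ∀ x → 1 ≤ inn M x → 1 ≤ out M x) (live-in : ∀ x → 1 ≤ out M x → 1 ≤ inn M x)
                   (no11 : ∀ x → out M x ≡ 1 → inn M x ≡ 1 → ⊥) where

    claim-12 : ∀ v → out M v ≡ 1 → inn M v ≡ 2 → Good M (Φ M) ⊎ Claim M v
    claim-12 v ov iv = Sum.map (λ g → good-≤ {M = M} (≤-reflexive (Φ-rev M)) (good-rev g)) (claim-rev {M = M} {v})
      (Claims.claim-21 (state-rev s) (λ N p t → ih N (subst (size N <_) (size-rev M) p) t)
        live-in live-out (λ x p q → no11 x q p) v iv ov)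

    claim-zero : ∀ x → out M x ⊓ inn M x ≡ 0 → Claim M x
    claim-zero x e = ≤-trans (≤-reflexive (cong (_* 52200) e)) z≤n

    claim-rate′ : ∀ {x o i α β} → out M x ≡ o → inn M x ≡ i → Rate o i α β → Good M (Φ M) ⊎ Claim M x
    claim-rate′ {x} refl refl r = inj₂ (claim-rate s {x} r)

    claim : ∀ x → Good M (Φ M) ⊎ Claim M x
    claim x = by (out M x) (inn M x) refl refl (thin s x)
      where
      by : ∀ o i → out M x ≡ o → inn M x ≡ i → Thin (out M x) (inn M x) → Good M (Φ M) ⊎ Claim M x
      by zero i p q t = inj₂ (claim-zero x (cong (_⊓ inn M x) p))
      by (suc o) zero p q t = inj₂ (claim-zero x (trans (cong (out M x ⊓_) q) (⊓-zeroʳ _)))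
      by 1 1 p q t = ⊥-elim (no11 x p q)
      by 2 1 p q t = Claims.claim-21 s ih live-out live-in no11 x p q
      by 3 1 p q t = claim-rate′ p q rate-31
      by (suc (suc (suc (suc o)))) 1 p q t = claim-rate′ p q (rate-21+ o)
      by 1 2 p q t = claim-12 x p q
      by 1 3 p q t = claim-rate′ p q (rate-sym rate-31)
      by 1 (suc (suc (suc (suc i)))) p q t = claim-rate′ p q (rate-sym (rate-21+ i))
      by 2 2 p q t = claim-rate′ p q rate-22
      by (suc (suc (suc o))) 2 p q t = claim-rate′ p q (rate-32+ o)
      by 2 (suc (suc (suc i))) p q t = claim-rate′ p q (rate-sym (rate-32+ i))
      by (suc (suc (suc o))) (suc (suc (suc i))) p q t = ¬thin (subst₂ Thin p q t)

    alive : Fin n → ℕ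
    alive x = 1 ⊓ out M x

    -- A deletion that misses does so by at least one unit, recorded by `alive`. An isolated vertex
    -- contributes no unit, since deleting it changes nothing.
    loss : ∀ w → Good M (Φ M) ⊎ (Φ M + alive w + e M w ≤ X M w)
    loss w = by (pos (out M w))
      where
      by : out M w ≡ 0 ⊎ 1 ≤ out M w → Good M (Φ M) ⊎ (Φ M + alive w + e M w ≤ X M w)
      by (inj₁ o≡0) = inj₂ (≤-trans (+-mono-≤ (≤-reflexive (trans (cong (λ k → Φ M + (1 ⊓ k)) o≡0) (+-identityʳ _)))
                                      (∸-monoʳ-≤ (X M w) (m≤m+n (Φ M) 1))) (≤-reflexive (m+[n∸m]≡n Φ≤X)))
        where
        i≡0 : inn M w ≡ 0
        i≡0 = zero-inn (pos (inn M w))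
          where
          zero-inn : inn M w ≡ 0 ⊎ 1 ≤ inn M w → inn M w ≡ 0
          zero-inn (inj₁ e) = e
          zero-inn (inj₂ p) = ⊥-elim (<⇒≢ (live-out w p) (sym o≡0))
        same : ∀ x y → del w M x y ≡ M x y
        same x y = entry (x ≟ w) (y ≟ w)
          where
          entry : Dec (x ≡ w) → Dec (y ≡ w) → del w M x y ≡ M x y
          entry (yes refl) _ = trans (del-row {v = w} M y) (sym (sum-≡0 (M w) o≡0 y))
          entry (no _) (yes refl) = trans (del-col {v = w} M x) (sym (sum-≡0 (λ z → M z w) i≡0 x))
          entry (no p) (no q) = del-off M p q
        Φ≤X : Φ M ≤ X M w
        Φ≤X = ≤-trans (≤-reflexive (sum-cong-≗ (λ x → cong₂ φ
          (sum-cong-≗ (λ y → sym (same x y))) (sum-cong-≗ (λ y → sym (same y x)))))) (m≤m+n _ _)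
      by (inj₂ o≥1) = pick (X M w ℕ.≤? Φ M)
        where
        pick : Dec (X M w ≤ Φ M) → Good M (Φ M) ⊎ (Φ M + alive w + e M w ≤ X M w)
        pick (yes p) = inj₁ (good-≤ {M = M} p (good-del
          (ih (del w M) (size-del′ {M = M} (proj₁ arc-w) (proj₂ arc-w)) (state-del w s))))
          where
          arc-w : ∃ λ y → 1 ≤ M w y
          arc-w = sum-pos (M w) o≥1
        pick (no p) = inj₂ (≤-reflexive (trans (cong (λ k → Φ M + k + e M w) (m≤n⇒m⊓n≡m o≥1))
          (m+[n∸m]≡n (≤-trans (≤-reflexive (+-comm (Φ M) 1)) (≰⇒> p)))))

    sum-share : sum (λ x → sum (share M x)) ≤ sum (e M) * 6
    sum-share = ≤-trans (≤-reflexive (∑-comm (share M)))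
      (≤-trans (sum-mono column) (≤-reflexive (sum-* (e M) 6)))
      where
      column : ∀ w → sum (λ x → share M x w) ≤ e M w * 6
      column w = begin
        sum (λ x → (M x w * kᵢ + M w x * kₒ) * e M w)         ≡⟨ sum-* (λ x → M x w * kᵢ + M w x * kₒ) (e M w) ⟩
        sum (λ x → M x w * kᵢ + M w x * kₒ) * e M w
          ≡⟨ cong (_* e M w) (∑-distrib-+ (λ x → M x w * kᵢ) (λ x → M w x * kₒ)) ⟩
        (sum (λ x → M x w * kᵢ) + sum (λ x → M w x * kₒ)) * e M w
          ≡⟨ cong (_* e M w) (cong₂ _+_ (sum-* (λ x → M x w) kᵢ) (sum-* (M w) kₒ)) ⟩
        (inn M w * kᵢ + out M w * kₒ) * e M w                 ≤⟨ *-monoˡ-≤ (e M w) (κ-bound (out M w) (inn M w)) ⟩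
        6 * e M w                                             ≡⟨ *-comm 6 (e M w) ⟩
        e M w * 6                                             ∎
        where
        open ≤-Reasoning
        kᵢ kₒ : ℕ
        kᵢ = κ (out M w) (inn M w)
        kₒ = κ (inn M w) (out M w)

    -- If every deletion fails, `losses` together with `drops` gives Σalive + Σe ≤ 8700 * Σmin - Σd.
    -- By `claims` and `sum-share` the right-hand side is at most Σe, so Σalive would be 0, although
    -- `x` has an out-arc.
    average : ∀ {x} → 1 ≤ out M x → Good M (Φ M)
    average {x} o≥1 = finish (decide-all claim) (decide-all loss)
      where
      finish : Good M (Φ M) ⊎ (∀ x → Claim M x) → Good M (Φ M) ⊎ (∀ w → Φ M + alive w + e M w ≤ X M w) → Good M (Φ M)
      finish (inj₁ g) _ = g
      finish (inj₂ _) (inj₁ g) = g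
      finish (inj₂ c) (inj₂ l) = ⊥-elim (1+n≰n (≤-trans alive-x contradictory))
        where
        Σd Σmin ΣΦ ΣΦdel Σalive Σe Σshare : ℕ
        Σd     = sum (λ x → sum (d M x))
        Σmin   = sum (λ x → out M x ⊓ inn M x)
        ΣΦ     = sum {n} (λ _ → Φ M)
        ΣΦdel  = sum (λ w → Φ (del w M))
        Σalive = sum alive
        Σe     = sum (e M)
        Σshare = sum (λ x → sum (share M x))
        claims : Σmin * 52200 ≤ Σd * 6 + Σshare
        claims = ≤-trans (≤-reflexive (sym (sum-* (λ x → out M x ⊓ inn M x) 52200))) (≤-trans (sum-mono c)
          (≤-reflexive (trans (∑-distrib-+ (λ x → sum (d M x) * 6) (λ x → sum (share M x)))
            (cong (_+ Σshare) (sum-* (λ x → sum (d M x)) 6)))))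
        drops : ΣΦdel + Σd ≤ ΣΦ
        drops = ≤-reflexive (trans (cong (ΣΦdel +_) (∑-comm (d M)))
          (trans (sym (∑-distrib-+ (λ w → Φ (del w M)) (λ w → sum (λ x → d M x w))))
            (sum-cong-≗ (λ w → trans (sym (∑-distrib-+ (ω (del w M)) (λ x → d M x w)))
              (sum-cong-≗ (λ x → m+[n∸m]≡n (ω-mono s (del-≤ w M) x)))))))
        losses : ΣΦ + Σalive + Σe ≤ ΣΦdel + Σmin * 8700
        losses = ≤-trans (≤-reflexive (sym (trans (∑-distrib-+ (λ w → Φ M + alive w) (e M))
            (cong (_+ Σe) (∑-distrib-+ (λ _ → Φ M) alive)))))
          (≤-trans (sum-mono l) (≤-reflexive (trans (∑-distrib-+ (λ w → Φ (del w M)) (λ w → (out M w ⊓ inn M w) * 8700))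
            (cong (ΣΦdel +_) (sum-* (λ w → out M w ⊓ inn M w) 8700)))))
        alive-x : 1 ≤ Σalive
        alive-x = ≤-trans (≤-reflexive (sym (m≤n⇒m⊓n≡m o≥1))) (term≤sum alive x)
        contradictory : Σalive ≤ 0
        contradictory = *-cancelʳ-≤ Σalive 0 6 (linear (Σd ∷ Σmin ∷ ΣΦ ∷ ΣΦdel ∷ Σalive ∷ Σe ∷ Σshare ∷ [])
          ( hyp 1 (x₁ ⊛ 52200) (x₀ ⊛ 6 ⊕ x₆) claims ∷ hyp 6 (x₃ ⊕ x₀) x₂ drops
          ∷ hyp 6 (x₂ ⊕ x₄ ⊕ x₅) (x₃ ⊕ x₁ ⊛ 8700) losses ∷ hyp 1 x₆ (x₅ ⊛ 6) sum-share ∷ [])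
          (x₄ ⊛ 6) (con 0))

  good-empty : ∀ {M : Graph n} {B} → size M ≡ 0 → Good M B
  good-empty {M} e = toℕ , toℕ-injective , ≤-trans (*-monoˡ-≤ 8700 (≤-reflexive (sum-zero (λ x → sum-zero (λ y →
    n≤0⇒n≡0 (≤-trans (when-≤ _ (M x y)) (≤-reflexive (sum-≡0 (M x) (sum-≡0 (out M) e x) y)))))))) z≤n

  good-sink : ∀ {M : Graph n} → State M → IH M → ∀ x → out M x ≡ 0 → 1 ≤ inn M x → Good M (Φ M)
  good-sink {M} s ih x o i = good-≤ {M = M} (sum-mono (ω-mono s (del-≤ x M)))
    (subst (Good M) (trans (cong (λ k → Φ (del x M) + k * 8700) o) (+-identityʳ _))
      (good-del-out (ih (del x M) (size-del {M = M} (proj₁ arc-x) (proj₂ arc-x)) (state-del x s))))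
    where
    arc-x : ∃ λ y → 1 ≤ M y x
    arc-x = sum-pos (λ y → M y x) i

  -- Sinks, sources and vertices of type (1 , 1) are removed with priority, so that the averaging
  -- argument may assume that none exist.
  solve : ∀ k (M : Graph n) → size M < k → State M → Good M (Φ M)
  solve (suc k) M (s≤s p) s = empty? (pos (size M))
    where
    ih : IH M
    ih N q = solve k N (≤-trans q p)

    sink? = any? (λ x → (out M x ℕ.≟ 0) ×-dec (1 ℕ.≤? inn M x))
    source? = any? (λ x → (inn M x ℕ.≟ 0) ×-dec (1 ℕ.≤? out M x))
    type11? = any? (λ x → (out M x ℕ.≟ 1) ×-dec (inn M x ℕ.≟ 1))

    nonzero : ∀ {k} → k ≢ 0 → 1 ≤ k
    nonzero {zero}  p = ⊥-elim (p refl)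
    nonzero {suc k} p = s≤s z≤n

    cases : ∀ {x} → 1 ≤ out M x → Dec _ → Dec _ → Dec _ → Good M (Φ M)
    cases _ (yes (x , o , i)) _ _ = good-sink s ih x o i
    cases _ (no _) (yes (x , i , o)) _ = good-≤ {M = M} (≤-reflexive (Φ-rev M)) (good-rev
      (good-sink (state-rev s) (λ N q t → ih N (subst (size N <_) (size-rev M) q) t) x i o))
    cases _ (no _) (no _) (yes (x , o , i)) = eliminate-11 s ih x o i
    cases o≥1 (no a) (no b) (no c) = Averaging.average s ih
      (λ x i → nonzero (λ o → a (x , o , i))) (λ x o → nonzero (λ i → b (x , i , o))) (λ x o i → c (x , o , i)) o≥1

    empty? : size M ≡ 0 ⊎ 1 ≤ size M → Good M (Φ M)
    empty? (inj₁ e) = good-empty e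
    empty? (inj₂ q) = cases (proj₂ (sum-pos (out M) q)) sink? source? type11?

-- The multiplicity matrix of a multigraph

length-filter : ∀ {m} {A : Set} {P : A → Set} (P? : ∀ a → Dec (P a)) (f : Fin m → A) →
                length (filter P? (tabulate f)) ≡ sum (λ i → when (does (P? (f i))) 1)
length-filter {zero}  P? f = refl
length-filter {suc m} P? f with does (P? (f zero))
... | true  = cong suc (length-filter P? (f ∘ suc))
... | false = length-filter P? (f ∘ suc)

when-≟ : ∀ {n} (x y : Fin n) → when (does (x ≟ y)) 1 ≡ δ x 1 y
when-≟ x y with x ≟ y
... | yes refl = sym (δ-same x 1)
... | no p     = sym (δ-diff 1 (p ∘ sym))

∣tabulate∣ : ∀ {m} (f : Fin m → Bool) → ∣ Vec.tabulate f ∣ ≡ sum (λ a → when (f a) 1)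
∣tabulate∣ {zero}  f = refl
∣tabulate∣ {suc m} f with f zero
... | true  = cong suc (∣tabulate∣ (f ∘ suc))
... | false = ∣tabulate∣ (f ∘ suc)

argmax : ∀ {k} (f : Fin (suc k) → ℕ) → ∃ λ i → ∀ j → f j ≤ f i
argmax {zero}  f = zero , λ { zero → ≤-refl }
argmax {suc k} f with argmax (f ∘ suc)
... | i , max with ≤-total (f zero) (f (suc i))
...   | inj₁ p = suc i , λ { zero → p ; (suc j) → max j }
...   | inj₂ p = zero , λ { zero → ≤-refl ; (suc j) → ≤-trans (max j) p }

when-sum : ∀ {m} b (f : Fin m → ℕ) → when b (sum f) ≡ sum (λ a → when b (f a))
when-sum true  f = refl
when-sum false f = sym (sum-zero {f = λ a → when false (f a)} (λ _ → refl))

sum-const : ∀ n c → sum {n} (λ _ → c) ≡ n * c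
sum-const zero    c = refl
sum-const (suc n) c = cong (c +_) (sum-const n c)

module _ {n m : ℕ} (D : MultiDigraph (Fin n) (Fin m)) where

  multiplicity : Graph n
  multiplicity x y = sum (λ a → single (src D a) (tgt D a) x y)

  out-multiplicity : ∀ x → out multiplicity x ≡ outDegree D x
  out-multiplicity x = trans (∑-comm (λ y a → single (src D a) (tgt D a) x y))
    (trans (sum-cong-≗ lem) (sym (length-filter (λ a → src D a ≟ x) (λ a → a))))
    where
    lem : ∀ a → sum (single (src D a) (tgt D a) x) ≡ when (does (src D a ≟ x)) 1
    lem a = trans (by (x ≟ src D a)) (sym (when-≟ (src D a) x))
      where
      by : Dec (x ≡ src D a) → sum (single (src D a) (tgt D a) x) ≡ δ (src D a) 1 x
      by (yes refl) = trans (sum-cong-≗ (λ y → δ-same x (δ (tgt D a) 1 y))) (trans (sum-δ (tgt D a) 1) (sym (δ-same x 1)))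
      by (no p) = trans (sum-zero (λ y → δ-diff (δ (tgt D a) 1 y) p)) (sym (δ-diff 1 p))

  inn-multiplicity : ∀ x → inn multiplicity x ≡ inDegree D x
  inn-multiplicity x = trans (∑-comm (λ y a → single (src D a) (tgt D a) y x))
    (trans (sum-cong-≗ lem) (sym (length-filter (λ a → tgt D a ≟ x) (λ a → a))))
    where
    lem : ∀ a → sum (λ y → single (src D a) (tgt D a) y x) ≡ when (does (tgt D a ≟ x)) 1
    lem a = trans (sum-δ (src D a) (δ (tgt D a) 1 x)) (sym (when-≟ (tgt D a) x))

  find-arc : ∀ {x y} → 1 ≤ multiplicity x y → ∃ λ a → src D a ≡ x × tgt D a ≡ y
  find-arc {x} {y} p = by (proj₂ found) (x ≟ src D (proj₁ found)) (y ≟ tgt D (proj₁ found))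
    where
    found : ∃ λ a → 1 ≤ single (src D a) (tgt D a) x y
    found = sum-pos (λ a → single (src D a) (tgt D a) x y) p
    by : ∀ {a} → 1 ≤ single (src D a) (tgt D a) x y → Dec (x ≡ src D a) → Dec (y ≡ tgt D a) →
         ∃ λ a → src D a ≡ x × tgt D a ≡ y
    by {a} q (yes e) (yes f) = a , sym e , sym f
    by {a} q (no e) _ = ⊥-elim (1+n≰n (subst (1 ≤_) (δ-diff (δ (tgt D a) 1 y) e) q))
    by {a} q (yes e) (no f) = ⊥-elim (1+n≰n (≤-trans q (≤-trans (when-≤ (does (x ≟ src D a)) (δ (tgt D a) 1 y))
      (≤-reflexive (δ-diff 1 f)))))

  two-cycle : ∀ {a b} → tgt D a ≡ src D b → tgt D b ≡ src D a → src D a ≢ src D b → DirectedCycle D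
  two-cycle {a} {b} p q r = record
    { pred-length = 1
    ; arc         = λ { zero → a ; (suc zero) → b }
    ; consecutive = λ { zero → p ; (suc zero) → q }
    ; distinct    = λ { {zero} {zero} _ → refl ; {zero} {suc zero} e → ⊥-elim (r e)
                      ; {suc zero} {zero} e → ⊥-elim (r (sym e)) ; {suc zero} {suc zero} _ → refl }
    }

  state-multiplicity : IsOriented D → IsDegree D 5 → State multiplicity
  state-multiplicity o deg = record { oriented = λ {x} {y} p → by {x} {y} p (pos (multiplicity y x)) ; thin = thin5 }
    where
    by : ∀ {x y} → 1 ≤ multiplicity x y → multiplicity y x ≡ 0 ⊎ 1 ≤ multiplicity y x → multiplicity y x ≡ 0
    by p (inj₁ e) = e
    by {x} {y} p (inj₂ q) with find-arc {x} {y} p | find-arc {y} {x} q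
    ... | a , refl , refl | b , sb , tb = ⊥-elim (IsOriented.no-2-cycle o
            (two-cycle (sym sb) tb (λ e → IsOriented.loopless o a (trans e sb))) refl)
    thin5 : ∀ x → Thin (out multiplicity x) (inn multiplicity x)
    thin5 x = lem _ _ (trans (cong₂ _+_ (out-multiplicity x) (inn-multiplicity x)) (deg x))
      where
      lem : ∀ k l → k + l ≡ 5 → Thin k l
      lem 0 l e = inj₁ z≤n
      lem 1 l e = inj₁ (s≤s z≤n)
      lem 2 l e = inj₁ ≤-refl
      lem (suc (suc (suc k))) l e = inj₂ (≤-trans (m≤n+m l k) (≤-reflexive (cong (pred ∘ pred ∘ pred) e)))

  module _ (π : Fin n → ℕ) where

    backward : Fin m → Bool
    backward a = π (tgt D a) ≤ᵇ π (src D a)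

    -- Along a cycle of forward arcs the rank would rise after the arc whose source has the largest
    -- rank.
    backward-feedback : IsFeedbackArcSet D (Vec.tabulate backward)
    backward-feedback C with argmax (λ i → π (src D (proj₁ (arc C i))))
    ... | i , max = <⇒≱ up (max (next i))
      where
      aᵢ : Fin m
      aᵢ = proj₁ (arc C i)
      not-back : ¬ T (backward aᵢ)
      not-back t = proj₂ (arc C i) (lookup⇒[]= aᵢ _ (trans (lookup∘tabulate backward aᵢ) (Equivalence.to T-≡ t)))
      up : π (src D aᵢ) < π (src D (proj₁ (arc C (next i))))
      up = ≤-trans (≰⇒> (λ p → not-back (≤⇒≤ᵇ p))) (≤-reflexive (cong π (consecutive C i)))

    back-multiplicity : back π multiplicity ≡ ∣ Vec.tabulate backward ∣
    back-multiplicity = begin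
      sum (λ x → sum (λ y → when (β x y) (sum (λ a → E a x y))))
        ≡⟨ sum-cong-≗ (λ x → sum-cong-≗ (λ y → when-sum (β x y) (λ a → E a x y))) ⟩
      sum (λ x → sum (λ y → sum (λ a → when (β x y) (E a x y))))
        ≡⟨ sum-cong-≗ (λ x → ∑-comm (λ y a → when (β x y) (E a x y))) ⟩
      sum (λ x → sum (λ a → sum (λ y → when (β x y) (E a x y))))
        ≡⟨ ∑-comm (λ x a → sum (λ y → when (β x y) (E a x y))) ⟩
      sum (λ a → sum (λ x → sum (λ y → when (β x y) (E a x y))))
        ≡⟨ sum-cong-≗ (λ a → sum-single β (src D a) (tgt D a)) ⟩
      sum (λ a → when (backward a) 1)
        ≡⟨ ∣tabulate∣ backward ⟨
      ∣ Vec.tabulate backward ∣ ∎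
      where
      open ≡-Reasoning
      β : Fin n → Fin n → Bool
      β x y = π y ≤ᵇ π x
      E : Fin m → Fin n → Fin n → ℕ
      E a = single (src D a) (tgt D a)

theorem3 : ∀ {n m : ℕ} (D : MultiDigraph (Fin n) (Fin m)) →
    IsOriented D → IsDegree D 5 → 29 * fas D ≤ 24 * n
theorem3 {n} D oriented deg = subst₂ _≤_ (*-comm (fas D) 29) (*-comm n 24) (*-cancelʳ-≤ (fas D * 29) (n * 24) 300
  (linear (fas D ∷ n ∷ []) (hyp 1 (x₀ ⊛ 8700) (x₁ ⊛ 7200) bound ∷ []) (x₀ ⊛ 29 ⊛ 300) (x₁ ⊛ 24 ⊛ 300)))
  where
  M : Graph n
  M = multiplicity D
  ranking : Good M (Φ M)
  ranking = solve (suc (size M)) M ≤-refl (state-multiplicity D oriented deg)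
  π : Fin n → ℕ
  π = proj₁ ranking
  fas≤back : fas D ≤ back π M
  fas≤back = ≤-trans (proj₂ (proj₂ (minimumFeedbackArcSet D)) _ (backward-feedback D π))
    (≤-reflexive (sym (back-multiplicity D π)))
  Φ-bound : Φ M ≤ n * 7200
  Φ-bound = ≤-trans (sum-mono (λ x → φ-deg5 (out M x) (inn M x)
      (trans (cong₂ _+_ (out-multiplicity D x) (inn-multiplicity D x)) (deg x)))) (≤-reflexive (sum-const n 7200))
  -- 8700 = 29 * 300 and 7200 = 24 * 300, so the common factor 300 cancels.
  bound : fas D * 8700 ≤ n * 7200
  bound = ≤-trans (*-monoˡ-≤ 8700 fas≤back) (≤-trans (proj₂ (proj₂ ranking)) Φ-bound)
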